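{- Let $G$ be a Borel graph with finite maximum degree $\Delta \geq 3$ and without a $(\Delta+1)$-clique. If $\mathrm{asi}(G) < \infty$, then $\chi_{\mathsf{B}}(G) \leq \Delta$.
   Context: All graphs are undirected and simple; $\mathbb{N}=\{0,1,2,\dots\}$, and $q\in\mathbb{N}$ is identified with $\{0,\dots,q-1\}$. A Borel graph is a graph $G$ whose vertex set $V(G)$ is a standard Borel space and whose adjacency relation is a Borel subset of $V(G)^2$. The Borel chromatic number $\chi_{\mathsf{B}}(G)$ is the smallest $q\in\mathbb{N}$ such that there is a Borel function $f\colon V(G)\to q$ with $f(u)\neq f(v)$ for every edge $uv$ (a Borel proper $q$-coloring), and $\infty$ if no such $q$ exists. A graph is component-finite if all its connected components are finite. $G[U]$ denotes the subgraph induced by $U\subseteq V(G)$. For a Borel graph $G$, the separation index $\mathrm{si}(G)$ is the smallest $s\in\mathbb{N}$ for which there is a partition $V(G)=U_0\sqcup\dots\sqcup U_s$ into $s+1$ Borel sets such that every $G[U_i]$ is component-finite ($\infty$ if no such $s$ exists). For $R\in\mathbb{N}$, $G^R$ is the graph on $V(G)$ in which two distinct vertices are adjacent iff they are joined by a path of at most $R$ edges in $G$. The asymptotic separation index is $\mathrm{asi}(G)=\sup_{R\in\mathbb{N}}\mathrm{si}(G^R)$. -}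

module Defs where

open import Axiom.ExcludedMiddle using (ExcludedMiddle)
open import Data.Fin.Base using (Fin; zero; suc; inject₁; fromℕ; opposite)
open import Data.Fin.Properties using (opposite-involutive)
open import Data.List.Base using (List; length)
open import Data.List.Membership.Propositional using (_∈_)
open import Data.List.Relation.Unary.Unique.Propositional using (Unique)
open import Data.Maybe.Base using (Maybe; just)
open import Data.Nat.Base as ℕ using (ℕ; zero; suc)
open import Data.Product.Base using (∃; Σ-syntax; ∃-syntax; _×_; _,_; uncurry)
open import Data.Rational.Base as ℚ using (ℚ; 0ℚ; 1ℚ)
import Data.Rational.Properties as ℚₚ
open import Data.Refinement using (Refinement; value)
open import Function.Base using (_∘_)
open import Function.Bundles using (_⇔_)
open import Function.Definitions using (Injective)
open import Function.Metric.Structures using (IsGeneralMetric)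
open import Level using (Level; 0ℓ; _⊔_) renaming (suc to lsuc)
open import Relation.Binary.Construct.Closure.ReflexiveTransitive using (Star)
open import Relation.Binary.Core using (Rel)
open import Relation.Binary.Definitions using (Symmetric; Irreflexive)
open import Relation.Binary.PropositionalEquality
  using (_≡_; _≢_; refl; sym; trans; cong; subst)
open import Relation.Nullary.Construct.Add.Supremum using (_⁺; ⊤⁺; [_])
open import Relation.Nullary.Decidable.Core using (yes; no)
open import Relation.Nullary.Negation.Core using (¬_)
open import Relation.Unary using (Pred; ∅; ∁; ⋃; _≐_; _⊢_; _⟨×⟩_; _⊆_; _⊥_)
import Relation.Binary.Construct.Add.Supremum.NonStrict as NonStrict
import Relation.Binary.Construct.Add.Supremum.Strict as Strict

private
  variable
    ℓ : Level

------------------------------------------------------------------------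
-- Real numbers

-- Classical (one-sided) Dedekind reals.  The real x is represented by its
-- open upper cut { q ∈ ℚ | x < q }.
record ℝ : Set₁ where
  field
    upper     : Pred ℚ 0ℓ
    inhabited : ∃ upper
    bounded   : ∃[ b ] (∀ {q} → upper q → b ℚ.< q)
    upward    : ∀ {p q} → p ℚ.< q → upper p → upper q
    rounded   : ∀ {q} → upper q → ∃[ p ] p ℚ.< q × upper p

open ℝ

infix 4 _≈ᴿ_ _≤ᴿ_ _<ᴿ_
infixl 6 _+ᴿ_

_≈ᴿ_ : Rel ℝ 0ℓ
x ≈ᴿ y = upper x ≐ upper y

_≤ᴿ_ : Rel ℝ 0ℓ
x ≤ᴿ y = upper y ⊆ upper x

_<ᴿ_ : ℝ → ℚ → Set
x <ᴿ q = upper x q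

0ᴿ : ℝ
0ᴿ = record
  { upper     = 0ℚ ℚ.<_
  ; inhabited = 1ℚ , ℚₚ.positive⁻¹ 1ℚ
  ; bounded   = 0ℚ , λ 0<q → 0<q
  ; upward    = λ p<q 0<p → ℚₚ.<-trans 0<p p<q
  ; rounded   = λ 0<q → let (p , 0<p , p<q) = ℚₚ.<-dense 0<q in p , p<q , 0<p
  }

_+ᴿ_ : ℝ → ℝ → ℝ
x +ᴿ y = record
  { upper     = S
  ; inhabited = let (p , xp) = inhabited x ; (q , yq) = inhabited y
                in p ℚ.+ q , p , q , xp , yq , refl
  ; bounded   = let (a , a<) = bounded x ; (b , b<) = bounded y
                in a ℚ.+ b , λ where (p , q , xp , yq , refl) → ℚₚ.+-mono-< (a< xp) (b< yq)
  ; upward    = up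
  ; rounded   = λ where
      (p , q , xp , yq , refl) →
        let (p′ , p′<p , xp′) = rounded x xp
        in p′ ℚ.+ q , ℚₚ.+-monoˡ-< q p′<p , p′ , q , xp′ , yq , refl
  }
  where
  S : Pred ℚ 0ℓ
  S r = ∃[ p ] ∃[ q ] upper x p × upper y q × r ≡ p ℚ.+ q

  cancel : ∀ p q → (ℚ.- p) ℚ.+ (p ℚ.+ q) ≡ q
  cancel p q = trans (sym (ℚₚ.+-assoc (ℚ.- p) p q))
    (trans (cong (ℚ._+ q) (ℚₚ.+-inverseˡ p)) (ℚₚ.+-identityˡ q))

  cancel′ : ∀ p s → s ≡ p ℚ.+ ((ℚ.- p) ℚ.+ s)
  cancel′ p s = sym (trans (sym (ℚₚ.+-assoc p (ℚ.- p) s))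
    (trans (cong (ℚ._+ s) (ℚₚ.+-inverseʳ p)) (ℚₚ.+-identityˡ s)))

  up : ∀ {r s} → r ℚ.< s → S r → S s
  up {s = s} r<s (p , q , xp , yq , refl) =
    p , (ℚ.- p) ℚ.+ s , xp ,
    upward y (subst (ℚ._< (ℚ.- p) ℚ.+ s) (cancel p q) (ℚₚ.+-monoʳ-< (ℚ.- p) r<s)) yq ,
    cancel′ p s

------------------------------------------------------------------------
-- Standard Borel spaces

record CompleteSeparableMetric (X : Set) : Set₁ where
  field
    d        : X → X → ℝ
    isMetric : IsGeneralMetric _≡_ _≈ᴿ_ _≤ᴿ_ 0ᴿ _+ᴿ_ d

  IsCauchy : (ℕ → X) → Set
  IsCauchy s = ∀ ε → 0ℚ ℚ.< ε → ∃[ N ] (∀ m n → N ℕ.≤ m → N ℕ.≤ n → d (s m) (s n) <ᴿ ε)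

  _⟶_ : (ℕ → X) → X → Set
  s ⟶ x = ∀ ε → 0ℚ ℚ.< ε → ∃[ N ] (∀ n → N ℕ.≤ n → d (s n) x <ᴿ ε)

  field
    complete  : ∀ s → IsCauchy s → ∃[ x ] s ⟶ x
    -- The countable dense set is enumerated through Maybe so that X may be empty.
    separable : Σ[ s ∈ (ℕ → Maybe X) ]
                  (∀ x ε → 0ℚ ℚ.< ε → ∃[ n ] ∃[ y ] s n ≡ just y × d x y <ᴿ ε)

  IsOpen : Pred (Pred X 0ℓ) 0ℓ
  IsOpen U = ∀ x → U x → ∃[ ε ] 0ℚ ℚ.< ε × (∀ y → d x y <ᴿ ε → U y)

-- The σ-algebra generated by 𝒢.  Closure under ≐ is required because subsets
-- are predicates, which are only extensionally equal up to ≐.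
data σ[_] {X : Set} (𝒢 : Pred (Pred X 0ℓ) ℓ) : Pred (Pred X 0ℓ) (lsuc 0ℓ ⊔ ℓ) where
  generator  : ∀ {A} → 𝒢 A → σ[ 𝒢 ] A
  empty      : σ[ 𝒢 ] ∅
  complement : ∀ {A} → σ[ 𝒢 ] A → σ[ 𝒢 ] (∁ A)
  union      : ∀ {A : ℕ → Pred X 0ℓ} → (∀ n → σ[ 𝒢 ] (A n)) → σ[ 𝒢 ] (⋃ ℕ A)
  resp       : ∀ {A B} → A ≐ B → σ[ 𝒢 ] A → σ[ 𝒢 ] B

record StandardBorelSpace : Set₂ where
  field
    Carrier  : Set
    IsBorel  : Pred (Pred Carrier 0ℓ) (lsuc 0ℓ)
    standard : Σ[ M ∈ CompleteSeparableMetric Carrier ]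
                 (∀ A → IsBorel A ⇔ σ[ CompleteSeparableMetric.IsOpen M ] A)

open StandardBorelSpace using (Carrier; IsBorel)

IsRectangle : (V W : StandardBorelSpace) → Pred (Pred (Carrier V × Carrier W) 0ℓ) (lsuc 0ℓ)
IsRectangle V W R = ∃[ A ] ∃[ B ] IsBorel V A × IsBorel W B × R ≐ (A ⟨×⟩ B)

IsBorel× : (V W : StandardBorelSpace) → Pred (Pred (Carrier V × Carrier W) 0ℓ) (lsuc 0ℓ)
IsBorel× V W = σ[ IsRectangle V W ]

-- Fin q carries the discrete σ-algebra.
IsBorelFunction : (V : StandardBorelSpace) {q : ℕ} → (Carrier V → Fin q) → Set₁
IsBorelFunction V {q} f = ∀ (A : Pred (Fin q) 0ℓ) → IsBorel V (f ⊢ A)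

------------------------------------------------------------------------
-- Graphs

record Graph (X : Set) : Set₁ where
  field
    Adj       : Rel X 0ℓ
    symmetric : Symmetric Adj
    loopless  : Irreflexive _≡_ Adj

open Graph using (Adj)

module _ {X : Set} (G : Graph X) where

  HasDegree : X → ℕ → Set
  HasDegree v n = Σ[ xs ∈ List X ] Unique xs × length xs ≡ n × (∀ u → u ∈ xs ⇔ Adj G v u)

  HasMaxDegree : ℕ → Set
  HasMaxDegree Δ = (∀ v → ∃[ n ] n ℕ.≤ Δ × HasDegree v n) × ∃[ v ] HasDegree v Δ

  HasClique : ℕ → Set
  HasClique n = Σ[ c ∈ (Fin n → X) ] Injective _≡_ _≡_ c × (∀ i j → i ≢ j → Adj G (c i) (c j))

  record Path (k : ℕ) (u v : X) : Set where
    field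
      vertex    : Fin (suc k) → X
      injective : Injective _≡_ _≡_ vertex
      start     : vertex zero ≡ u
      end       : vertex (fromℕ k) ≡ v
      step      : ∀ (i : Fin k) → Adj G (vertex (inject₁ i)) (vertex (suc i))

  ComponentFinite : Set
  ComponentFinite = ∀ v → Σ[ xs ∈ List X ] (∀ w → Star (Adj G) v w → w ∈ xs)

-- Membership in U is proof-irrelevant in Refinement X U, so its elements are
-- equal exactly when the underlying vertices are.
induced : {X : Set} → Graph X → (U : Pred X 0ℓ) → Graph (Refinement X U)
induced G U = record
  { Adj       = λ u v → Adj G (value u) (value v)
  ; symmetric = Graph.symmetric G
  ; loopless  = λ { refl → Graph.loopless G refl }
  }

private
  opposite-inject₁ : ∀ {n} (i : Fin n) → opposite (inject₁ i) ≡ suc (opposite i)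
  opposite-inject₁ zero    = refl
  opposite-inject₁ (suc i) = cong inject₁ (opposite-inject₁ i)

reverse : {X : Set} {G : Graph X} {k : ℕ} {u v : X} → Path G k u v → Path G k v u
reverse {G = G} {k} p = record
  { vertex    = vertex ∘ opposite
  ; injective = λ {i} {j} e → trans (sym (opposite-involutive i))
                  (trans (cong opposite (injective e)) (opposite-involutive j))
  ; start     = end
  ; end       = trans (cong vertex (opposite-involutive zero)) start
  ; step      = λ i → subst (λ j → Adj G (vertex j) (vertex (inject₁ (opposite i))))
                  (sym (opposite-inject₁ i)) (Graph.symmetric G (step (opposite i)))
  }
  where open Path p

infixl 8 _^_

_^_ : {X : Set} → Graph X → ℕ → Graph X
G ^ R = record
  { Adj       = λ u v → u ≢ v × ∃[ k ] k ℕ.≤ R × Path G k u v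
  ; symmetric = λ (u≢v , k , k≤R , p) → (λ e → u≢v (sym e)) , k , k≤R , reverse p
  ; loopless  = λ u≡v (u≢v , _) → u≢v u≡v
  }

record BorelGraph : Set₂ where
  field
    space    : StandardBorelSpace
    graph    : Graph (Carrier space)
    adjBorel : IsBorel× space space (uncurry (Adj graph))

open BorelGraph

BorelColorable : BorelGraph → ℕ → Set₁
BorelColorable G q =
  Σ[ f ∈ (Carrier (space G) → Fin q) ]
    IsBorelFunction (space G) f × (∀ u v → Adj (graph G) u v → f u ≢ f v)

HasSeparation : (V : StandardBorelSpace) → Graph (Carrier V) → ℕ → Set₁
HasSeparation V H s =
  Σ[ U ∈ (Fin (suc s) → Pred (Carrier V) 0ℓ) ]
    (∀ i → IsBorel V (U i)) ×
    (∀ x → ∃[ i ] U i x) ×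
    (∀ i j → i ≢ j → U i ⊥ U j) ×
    (∀ i → ComponentFinite (induced H (U i)))

------------------------------------------------------------------------
-- Extended natural numbers and the numerical invariants

ℕ∞ : Set
ℕ∞ = ℕ ⁺

∞ : ℕ∞
∞ = ⊤⁺

open NonStrict ℕ._≤_ public using () renaming (_≤⁺_ to _≤∞_)
open Strict ℕ._<_ public using () renaming (_<⁺_ to _<∞_)

IsLeast : Pred ℕ ℓ → ℕ → Set ℓ
IsLeast P n = P n × (∀ m → P m → n ℕ.≤ m)

-- These least elements exist only classically, so excluded middle is needed to
-- make the invariants total functions.  Since P ranges over all types, em also
-- yields choice.
module Invariants (em : ∀ {ℓ} → ExcludedMiddle ℓ) where

  least : Pred ℕ ℓ → ℕ∞
  least P with em {P = ∃ (IsLeast P)}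
  ... | yes (n , _) = [ n ]
  ... | no  _       = ∞

  -- A supremum in ℕ∞ is the least finite upper bound, or ∞ when there is none.
  sup : (ℕ → ℕ∞) → ℕ∞
  sup f = least (λ b → ∀ n → f n ≤∞ [ b ])

  χᴮ : BorelGraph → ℕ∞
  χᴮ G = least (BorelColorable G)

  si : (V : StandardBorelSpace) → Graph (Carrier V) → ℕ∞
  si V H = least (HasSeparation V H)

  asi : BorelGraph → ℕ∞
  asi G = sup (λ R → si (space G) (graph G ^ R))

{-# OPTIONS --safe #-}
module Submission where

-- Standard Borel spaces are coded by closed subsets of Baire space, where Lusin–Souslin and
-- Lusin–Novikov show that neighbourhoods of Borel sets are Borel; hence so is everything defined
-- within a bounded radius.
--
-- If u has degree < Δ, or its neighbours stay connected near u once u is deleted, then every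
-- colouring outside a ball around u extends to the ball (Lovász's proof of Brooks' theorem).  Let Y
-- be a sparse maximal set of such u and Z a net of the points far from Y.  Following pointers
-- towards Y and Z splits the graph into cells; every vertex of the cell of z ∈ Z is a local cut
-- vertex, so this cell branches exponentially.  It therefore contains many disjoint spots (t; a, b)
-- near its bottom: a and b are nonadjacent neighbours of t, and little lies below them.  Giving a
-- and b the same colour creates slack at t, and what they cut off escapes into other cells unless it
-- meets a piece cut off there.  So we need one spot per cell such that the pieces cut off do not
-- touch.  This is an independent transversal; it is found in finitely many stages, one for each
-- component-finite part of the separation, where a stage keeps one out of every m candidates so as
-- to resolve all conflicts touching that part.  Finally colour all a and b alike, everything else
-- greedily towards the t and Y, then the t, and last the balls around Y.

open import Axiom.ExcludedMiddle using (ExcludedMiddle)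
open import Data.Empty using (⊥; ⊥-elim)
open import Data.Fin.Base as Fin
  using (Fin; zero; suc; combine; remQuot; finToFun; funToFin; punchOut; inject≤; inject₁)
open import Data.Fin.Properties
  using (remQuot-combine; combine-remQuot; finToFun-funToFin; injective⇒≤; punchOut-injective; inject≤-injective)
  renaming (_≟_ to _≟ᶠ_; suc-injective to suc-injectiveᶠ)
open import Data.List.Base as List
  using (List; []; _∷_; length; map; _++_; concatMap; filter; tabulate; allFin)
open import Data.List.Membership.Propositional using (_∈_; _∉_; lose)
open import Data.List.Membership.Propositional.Properties
  using (∈-concatMap⁺; ∈-tabulate⁺; ∈-map⁺; ∈-filter⁺; ∈-filter⁻; ∈-allFin; ∈-++⁺ˡ; ∈-++⁺ʳ)
open import Data.List.Properties using (filter-notAll; length-map; length-++; length-tabulate)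
open import Data.List.Relation.Unary.Any as Any using (here; there)
import Data.List.Relation.Unary.Any.Properties as Anyₚ
open import Data.Nat.Base as ℕ
  using (ℕ; zero; suc; _+_; _*_; _^_; _⊔_; _≤_; _<_; _≥_; z≤n; s≤s; z<s; s<s; s≤s⁻¹; s<s⁻¹; >-nonZero)
open import Data.Nat.Induction using (<-rec)
open import Data.Nat.Properties as ℕₚ hiding (_≟_)
open import Data.Product.Base using (Σ; ∃; ∃₂; _×_; _,_; proj₁; proj₂; uncurry)
open import Data.Sum.Base using (_⊎_; inj₁; inj₂; swap)
open import Data.Unit.Base using (⊤; tt)
open import Function.Base using (_∘_; id)
open import Function.Bundles using (Equivalence)
open import Level using (Level; 0ℓ) renaming (suc to lsuc)
open import Relation.Binary.Construct.Closure.ReflexiveTransitive using (Star; ε; _◅_; _◅◅_; reverse)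
open import Relation.Binary.Definitions using (tri<; tri≈; tri>)
open import Relation.Binary.PropositionalEquality
  using (_≡_; _≢_; refl; sym; trans; cong; cong₂; subst; subst₂; subst-sym-subst; module ≡-Reasoning)
open import Relation.Nullary using (¬_; Dec; yes; no; ¬?)
open import Relation.Nullary.Construct.Add.Supremum using ([_])
open import Relation.Unary using (Pred; ∁; _≐_; _⊢_)
open import Defs hiding (reverse) renaming (_^_ to _^ᴳ_)

-- The order of the choices is the obstacle. Conflicts between cells are resolved with a separation
-- of `G^R` for an `R` larger than the cells, so the cells must be fixed before the separation is. A
-- finite asymptotic separation index supplies a number `b` that bounds the separation index for all
-- `R` at once, and the branching depth `n` is computed from `b` and `Δ` alone. A cell then offers
-- `2 ^ n` candidates, while one candidate meets only `κ` others, with `κ` linear in `n`: below a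
-- vertex without a triple `(t; a, b)` every generation of descendants is a clique and has at most
-- `Δ + 1` vertices, so little lies below a lowest spot. Each of the at most `b + 1` stages divides
-- the number of candidates by `m = 4 * κ`, so `m ^ (b + 1) ≤ 2 ^ n` suffices: a polynomial against
-- an exponential. A stage must leave many candidates per cell, because the same cell may meet
-- conflicts of later parts; hence it keeps one candidate in every block of `m`, whatever later
-- stages select among the blocks.

module _ (em : ∀ {ℓ} → ExcludedMiddle ℓ) where

  -- Classical logic, least witnesses and countable types.

  module Classical where

    private
      variable
        ℓ : Level

    dne : {A : Set ℓ} → ¬ ¬ A → A
    dne {A = A} ¬¬a with em {P = A}
    ... | yes a = a
    ... | no ¬a = ⊥-elim (¬¬a ¬a)

    ¬∀⇒∃ : {A : Set} {P : A → Set ℓ} → ¬ (∀ x → P x) → ∃ λ x → ¬ P x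
    ¬∀⇒∃ ¬∀ = dne λ ¬∃ → ¬∀ λ x → dne λ ¬p → ¬∃ (x , ¬p)

    minimum : {P : ℕ → Set ℓ} → ∃ P → ∃ λ n → P n × (∀ m → m < n → ¬ P m)
    minimum {P = P} (n , p) = <-rec (λ n → P n → Min) step n p
      where
      Min = ∃ λ n → P n × (∀ m → m < n → ¬ P m)
      step : ∀ n → (∀ {m} → m < n → P m → Min) → P n → Min
      step n rec p with em {P = ∃ λ m → m < n × P m}
      ... | yes (m , m<n , q) = rec m<n q
      ... | no ¬smaller = n , p , λ m m<n q → ¬smaller (m , m<n , q)

    minimum-unique : {P : ℕ → Set ℓ} {m n : ℕ} →
      P m → (∀ k → k < m → ¬ P k) → P n → (∀ k → k < n → ¬ P k) → m ≡ n
    minimum-unique {m = m} {n} pm m-min pn n-min with <-cmp m n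
    ... | tri< m<n _ _ = ⊥-elim (n-min m m<n pm)
    ... | tri≈ _ m≡n _ = m≡n
    ... | tri> _ _ n<m = ⊥-elim (m-min n n<m pn)

    abstract
      next : ℕ × ℕ → ℕ × ℕ
      next (zero  , n) = suc n , 0
      next (suc m , n) = m , suc n

      unpair : ℕ → ℕ × ℕ
      unpair zero    = 0 , 0
      unpair (suc k) = next (unpair k)

      -- The walk `next` runs through the antidiagonals: `(m , suc n)` follows `(suc m , n)` on the
      -- same diagonal, and `(suc s , 0)` follows `(0 , s)`, the end of the preceding one.
      unpair-onto : ∀ s m n → m + n ≡ s → ∃ λ k → unpair k ≡ (m , n)
      unpair-onto s m (suc n) eq with unpair-onto s (suc m) n (trans (sym (+-suc m n)) eq)
      ... | k , e = suc k , cong next e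
      unpair-onto zero zero zero eq = 0 , refl
      unpair-onto (suc s) (suc m) zero refl with unpair-onto s zero m (sym (+-identityʳ m))
      ... | k , e = suc k , cong next e

      pair : ℕ → ℕ → ℕ
      pair m n = proj₁ (unpair-onto (m + n) m n refl)

      unpair-pair : ∀ m n → unpair (pair m n) ≡ (m , n)
      unpair-pair m n = proj₂ (unpair-onto (m + n) m n refl)

    pair-injective : ∀ {k l m n} → pair k l ≡ pair m n → k ≡ m × l ≡ n
    pair-injective {k} {l} {m} {n} eq = cong proj₁ unpaired , cong proj₂ unpaired
      where
      unpaired : (k , l) ≡ (m , n)
      unpaired = trans (sym (unpair-pair k l)) (trans (cong unpair eq) (unpair-pair m n))

    -- A surjection from ℕ with a chosen section. As `enum` is total, such a type is inhabited;
    -- hence the instance for `Fin (suc q)` only, and the separate treatment of `Fin 0` in finite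
    -- quantifiers.
    record Countable (A : Set) : Set where
      field
        enum       : ℕ → A
        index      : A → ℕ
        enum-index : ∀ a → enum (index a) ≡ a

    open Countable {{...}} public

    instance
      ℕ-countable : Countable ℕ
      ℕ-countable = record { enum = λ n → n ; index = λ n → n ; enum-index = λ _ → refl }

      ×-countable : {A B : Set} {{_ : Countable A}} {{_ : Countable B}} → Countable (A × B)
      ×-countable = record
        { enum = λ n → enum (proj₁ (unpair n)) , enum (proj₂ (unpair n))
        ; index = λ (a , b) → pair (index a) (index b)
        ; enum-index = λ (a , b) → cong₂ _,_
            (trans (cong (λ p → enum (proj₁ p)) (unpair-pair (index a) (index b))) (enum-index a))
            (trans (cong (λ p → enum (proj₂ p)) (unpair-pair (index a) (index b))) (enum-index b)) }

      Fin-countable : ∀ {q} → Countable (Fin (suc q))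
      Fin-countable {q} = record { enum = en q ; index = Fin.toℕ ; enum-index = en-to }
        where
        en : ∀ q → ℕ → Fin (suc q)
        en q       zero    = zero
        en zero    (suc n) = zero
        en (suc q) (suc n) = suc (en q n)
        en-to : ∀ {q} (i : Fin (suc q)) → en q (Fin.toℕ i) ≡ i
        en-to zero = refl
        en-to {suc q} (suc i) = cong suc (en-to i)

    module _ {A : Set} {{_ : Countable A}} where

      private
        -- Coding the length separately makes decoding structurally recursive.
        decode : (length code : ℕ) → List A
        decode zero    n = []
        decode (suc k) n = enum (proj₁ (unpair n)) ∷ decode k (proj₂ (unpair n))

        encode : List A → ℕ × ℕ
        encode []       = 0 , 0
        encode (a ∷ as) = suc (proj₁ (encode as)) , pair (index a) (proj₂ (encode as))

        decode-encode : ∀ as → decode (proj₁ (encode as)) (proj₂ (encode as)) ≡ as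
        decode-encode [] = refl
        decode-encode (a ∷ as) rewrite unpair-pair (index a) (proj₂ (encode as)) =
          cong₂ _∷_ (enum-index a) (decode-encode as)

      instance
        List-countable : Countable (List A)
        List-countable = record
          { enum = λ n → decode (proj₁ (unpair n)) (proj₂ (unpair n))
          ; index = λ as → pair (proj₁ (encode as)) (proj₂ (encode as))
          ; enum-index = λ as → trans
              (cong (λ p → decode (proj₁ p) (proj₂ p)) (unpair-pair (proj₁ (encode as)) (proj₂ (encode as))))
              (decode-encode as) }

  -- Closure properties of Borel sets, coded spaces and measurable maps.

  module BorelSets where
    open Classical

    module _ {X : Set} {ℓ : Level} {𝒢 : Pred (Pred X 0ℓ) ℓ} where

      σ-const : (P : Set) → σ[ 𝒢 ] (λ _ → P)
      σ-const P with em {P = P}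
      ... | yes p = resp ((λ _ → p) , λ _ ()) (complement empty)
      ... | no ¬p = resp ((λ ()) , ¬p) empty

      σ-⋃ : {I : Set} {{_ : Countable I}} {A : I → Pred X 0ℓ} → (∀ i → σ[ 𝒢 ] (A i)) → σ[ 𝒢 ] (λ x → ∃ λ i → A i x)
      σ-⋃ {A = A} as = resp ((λ (n , a) → enum n , a) ,
        λ {x} (i , a) → index i , subst (λ j → A j x) (sym (enum-index i)) a) (union (λ n → as (enum n)))

      σ-∁ : {A : Pred X 0ℓ} → σ[ 𝒢 ] A → σ[ 𝒢 ] (λ x → ¬ A x)
      σ-∁ = complement

      σ-⋂ : {I : Set} {{_ : Countable I}} {A : I → Pred X 0ℓ} → (∀ i → σ[ 𝒢 ] (A i)) → σ[ 𝒢 ] (λ x → ∀ i → A i x)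
      σ-⋂ as = resp ((λ ¬∃ i → dne λ ¬a → ¬∃ (i , ¬a)) , λ ∀a (i , ¬a) → ¬a (∀a i))
        (complement (σ-⋃ (λ i → complement (as i))))

      σ-∪ : {A B : Pred X 0ℓ} → σ[ 𝒢 ] A → σ[ 𝒢 ] B → σ[ 𝒢 ] (λ x → A x ⊎ B x)
      σ-∪ {A} {B} a b = resp
        ((λ { (zero , a) → inj₁ a ; (suc _ , b) → inj₂ b }) , λ { (inj₁ a) → zero , a ; (inj₂ b) → suc zero , b })
        (σ-⋃ {I = Fin 2} {A = C} λ { zero → a ; (suc _) → b })
        where
        C : Fin 2 → Pred X 0ℓ
        C zero    = A
        C (suc _) = B

      σ-∩ : {A B : Pred X 0ℓ} → σ[ 𝒢 ] A → σ[ 𝒢 ] B → σ[ 𝒢 ] (λ x → A x × B x)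
      σ-∩ a b = resp
        ((λ ¬∪ → dne (λ ¬a → ¬∪ (inj₁ ¬a)) , dne (λ ¬b → ¬∪ (inj₂ ¬b))) ,
         λ { (a , b) (inj₁ ¬a) → ¬a a ; (a , b) (inj₂ ¬b) → ¬b b })
        (complement (σ-∪ (complement a) (complement b)))

      σ-⇒ : {A B : Pred X 0ℓ} → σ[ 𝒢 ] A → σ[ 𝒢 ] B → σ[ 𝒢 ] (λ x → A x → B x)
      σ-⇒ {A} {B} a b = resp ((λ { (inj₁ ¬a) a → ⊥-elim (¬a a) ; (inj₂ b) _ → b }) , split) (σ-∪ (complement a) b)
        where
        split : ∀ {x} → (A x → B x) → ¬ A x ⊎ B x
        split {x} f with em {P = A x}
        ... | yes a = inj₂ (f a)
        ... | no ¬a = inj₁ ¬a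

      σ-⋂< : {A : ℕ → Pred X 0ℓ} (k : ℕ) → (∀ n → σ[ 𝒢 ] (A n)) → σ[ 𝒢 ] (λ x → ∀ n → n < k → A n x)
      σ-⋂< k as = σ-⋂ λ n → σ-⇒ (σ-const (n < k)) (as n)

      σ-Fin∃ : ∀ {n} {A : Fin n → Pred X 0ℓ} → (∀ i → σ[ 𝒢 ] (A i)) → σ[ 𝒢 ] (λ x → ∃ λ i → A i x)
      σ-Fin∃ {zero}  as = resp ((λ ()) , λ ()) empty
      σ-Fin∃ {suc n} as = σ-⋃ as

      σ-Fin∀ : ∀ {n} {A : Fin n → Pred X 0ℓ} → (∀ i → σ[ 𝒢 ] (A i)) → σ[ 𝒢 ] (λ x → ∀ i → A i x)
      σ-Fin∀ {zero}  as = resp ((λ _ ()) , λ _ → tt) (σ-const ⊤)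
      σ-Fin∀ {suc n} as = σ-⋂ as

    -- A coding identifies X with a closed subset of Baire space.
    record Coded (X : Set) : Set where
      field
        code           : X → ℕ → ℕ
        code-injective : ∀ {x y} → (∀ n → code x n ≡ code y n) → x ≡ y
        code-closed    : ∀ (β : ℕ → ℕ) → (∀ k → ∃ λ x → ∀ n → n < k → code x n ≡ β n) →
                         ∃ λ x → ∀ n → code x n ≡ β n

    open Coded {{...}} public

    IsCylinder : {X : Set} {{_ : Coded X}} → Pred (Pred X 0ℓ) 0ℓ
    IsCylinder A = ∃₂ λ n m → A ≐ (λ x → code x n ≡ m)

    Borel : {X : Set} {{_ : Coded X}} → Pred (Pred X 0ℓ) (lsuc 0ℓ)
    Borel = σ[ IsCylinder ]

    Measurable : {X Y : Set} {{_ : Coded X}} {{_ : Coded Y}} → (X → Y) → Set₁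
    Measurable {X} {Y} f = ∀ {A : Pred Y 0ℓ} → Borel A → Borel (f ⊢ A)

    ℕ-Measurable : {X I : Set} {{_ : Coded X}} → (X → I) → Set₁
    ℕ-Measurable f = ∀ i → Borel (λ x → f x ≡ i)

    module _ {X : Set} {{_ : Coded X}} where

      cylinder : ∀ n m → Borel {X} (λ x → code x n ≡ m)
      cylinder n m = generator (n , m , (id , id))

      cylinder-pred : (n : ℕ) (P : ℕ → Set) → Borel {X} (λ x → P (code x n))
      cylinder-pred n P = resp ((λ { (m , refl , p) → p }) , λ p → _ , refl , p)
        (σ-⋃ λ m → σ-∩ (cylinder n m) (σ-const (P m)))

      ℕ-measurable-pred : {I : Set} {{_ : Countable I}} {f : X → I} → ℕ-Measurable f → (P : I → Pred X 0ℓ) →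
        (∀ i → Borel (P i)) → Borel (λ x → P (f x) x)
      ℕ-measurable-pred mf P bP = resp ((λ { (m , refl , p) → p }) , λ p → _ , refl , p)
        (σ-⋃ λ m → σ-∩ (mf m) (bP m))

    measurable-from-cylinders : {X Y : Set} {{_ : Coded X}} {{_ : Coded Y}} {f : X → Y} →
      (∀ n m → Borel (λ x → code (f x) n ≡ m)) → Measurable f
    measurable-from-cylinders cyl (generator (n , m , (to , from))) = resp (from , to) (cyl n m)
    measurable-from-cylinders cyl empty = resp ((λ ()) , λ ()) empty
    measurable-from-cylinders cyl (complement b) = complement (measurable-from-cylinders cyl b)
    measurable-from-cylinders cyl (union bs) = union (λ n → measurable-from-cylinders cyl (bs n))
    measurable-from-cylinders {f = f} cyl (resp (to , from) b) =
      resp ((λ {x} → to {f x}) , λ {x} → from {f x}) (measurable-from-cylinders cyl b)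

    id-measurable : {X : Set} {{_ : Coded X}} → Measurable {X} (λ x → x)
    id-measurable b = b

    instance
      ×-coded : {X Y : Set} {{_ : Coded X}} {{_ : Coded Y}} → Coded (X × Y)
      ×-coded {X} {Y} = record
        { code = λ (x , y) n → pair (code x n) (code y n)
        ; code-injective = λ eq → cong₂ _,_
            (code-injective (λ n → proj₁ (pair-injective (eq n))))
            (code-injective (λ n → proj₂ (pair-injective (eq n))))
        ; code-closed = λ β approx →
            let left  : ∀ k → ∃ λ x → ∀ n → n < k → code x n ≡ proj₁ (unpair (β n))
                left k = let ((x , y) , e) = approx k in
                  x , λ n n<k → trans (cong proj₁ (sym (unpair-pair _ _))) (cong (proj₁ ∘ unpair) (e n n<k))
                right : ∀ k → ∃ λ y → ∀ n → n < k → code y n ≡ proj₂ (unpair (β n))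
                right k = let ((x , y) , e) = approx k in
                  y , λ n n<k → trans (cong proj₂ (sym (unpair-pair _ _))) (cong (proj₂ ∘ unpair) (e n n<k))
                (x , ex) = code-closed _ left
                (y , ey) = code-closed _ right
            -- `pair` after `unpair` is not known to be the identity, so an approximating point is
            -- used once more to see that `β n` is a value of `pair`.
            in (x , y) , λ n → let ((x' , y') , e) = approx (suc n) in
              begin
                pair (code x n) (code y n)   ≡⟨ cong₂ pair (ex n) (ey n) ⟩
                pair (proj₁ (unpair (β n))) (proj₂ (unpair (β n)))
                  ≡⟨ cong (λ p → pair (proj₁ (unpair p)) (proj₂ (unpair p))) (sym (e n ≤-refl)) ⟩
                pair (proj₁ (unpair (pair (code x' n) (code y' n)))) (proj₂ (unpair (pair (code x' n) (code y' n))))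
                  ≡⟨ cong (λ p → pair (proj₁ p) (proj₂ p)) (unpair-pair _ _) ⟩
                pair (code x' n) (code y' n) ≡⟨ e n ≤-refl ⟩
                β n ∎ }
        where
        open ≡-Reasoning

    module _ {X Y : Set} {{_ : Coded X}} {{_ : Coded Y}} where

      proj₁-measurable : Measurable {X × Y} proj₁
      proj₁-measurable = measurable-from-cylinders λ n m →
        resp ((λ e → trans (cong proj₁ (sym (unpair-pair _ _))) e) , λ e → trans (cong proj₁ (unpair-pair _ _)) e)
          (cylinder-pred n (λ c → proj₁ (unpair c) ≡ m))

      proj₂-measurable : Measurable {X × Y} proj₂
      proj₂-measurable = measurable-from-cylinders λ n m →
        resp ((λ e → trans (cong proj₂ (sym (unpair-pair _ _))) e) , λ e → trans (cong proj₂ (unpair-pair _ _)) e)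
          (cylinder-pred n (λ c → proj₂ (unpair c) ≡ m))

    ⟨_,_⟩-measurable : {X Y Z : Set} {{_ : Coded X}} {{_ : Coded Y}} {{_ : Coded Z}} {f : X → Y} {g : X → Z} →
      Measurable f → Measurable g → Measurable (λ x → f x , g x)
    ⟨_,_⟩-measurable {f = f} {g} mf mg = measurable-from-cylinders λ n m → resp
      {A = λ x → ∃ λ a → ∃ λ b → code (f x) n ≡ a × code (g x) n ≡ b × pair a b ≡ m}
      ((λ { (a , b , fa , gb , e) → trans (cong₂ pair fa gb) e }) , λ e → _ , _ , refl , refl , e)
      (σ-⋃ λ a → σ-⋃ λ b → σ-∩ (mf (cylinder n a)) (σ-∩ (mg (cylinder n b)) (σ-const (pair a b ≡ m))))

    ∘-measurable : {X Y Z : Set} {{_ : Coded X}} {{_ : Coded Y}} {{_ : Coded Z}} {f : X → Y} {g : Y → Z} →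
      Measurable g → Measurable f → Measurable (λ x → g (f x))
    ∘-measurable mg mf b = mf (mg b)

    ≡-Borel : {X Y : Set} {{_ : Coded X}} {{_ : Coded Y}} {f g : X → Y} →
      Measurable f → Measurable g → Borel (λ x → f x ≡ g x)
    ≡-Borel {X} {Y} {f} {g} mf mg = resp {A = λ x → ∀ n → ∃ λ m → code (f x) n ≡ m × code (g x) n ≡ m}
      ((λ {x} all → code-injective (λ n → let (m , e , e') = all n in trans e (sym e'))) ,
       λ {x} e n → code (f x) n , refl , cong (λ y → code y n) (sym e))
      (σ-⋂ λ n → σ-⋃ λ m → σ-∩ (mf (cylinder n m)) (mg (cylinder n m)))

  -- Lusin's separation theorem and the Lusin-Souslin theorem.

  module LusinSouslin where
    open Classical
    open BorelSets

    -- A family of labels is complete on E when its image of E is closed in Baire space.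
    Complete : {Z : Set} → (ℕ → Z → ℕ) → Pred Z 0ℓ → Set
    Complete {Z} w E = ∀ (β : ℕ → ℕ) →
      (∀ k → ∃ λ (z : Z) → E z × (∀ n → n < k → w n z ≡ β n)) → ∃ λ z → E z × (∀ n → w n z ≡ β n)

    refined : {X : Set} {{_ : Coded X}} → (ℕ → X → ℕ) → ℕ → X → ℕ
    refined u n x = pair (code x n) (u n x)

    -- This makes `E` the bijective projection of a closed subset of the product of `X` with Baire
    -- space: the labels `u` are the second coordinate, given as a function of the point.
    Presented : {X : Set} {{_ : Coded X}} → Pred X 0ℓ → Set
    Presented {X} E = ∃ λ (u : ℕ → X → ℕ) → Complete (refined u) E

    private
      bound : (f : ℕ → ℕ) (k : ℕ) → ∃ λ K → k ≤ K × (∀ j → j < k → f j < K)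
      bound f zero = 0 , z≤n , λ _ ()
      bound f (suc k) with bound f k
      ... | K , k≤K , b = suc (f k + K) , s≤s (≤-trans k≤K (m≤n+m K (f k))) , go
        where
        go : ∀ j → j < suc k → f j < suc (f k + K)
        go j j<k+1 with m<1+n⇒m<n∨m≡n j<k+1
        ... | inj₁ j<k = m<n⇒m<1+n (≤-trans (b j j<k) (m≤n+m K (f k)))
        ... | inj₂ refl = s≤s (m≤m+n (f k) K)

    module _ {X : Set} {{_ : Coded X}} where

      private
        Presented₂ : Pred X 0ℓ → Set
        Presented₂ E = ∃ λ (u : ℕ → X → ℕ) → ∀ (β γ : ℕ → ℕ) →
          (∀ k → ∃ λ x → E x × (∀ n → n < k → code x n ≡ β n × u n x ≡ γ n)) →
          ∃ λ x → E x × (∀ n → code x n ≡ β n × u n x ≡ γ n)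

        presented : {E : Pred X 0ℓ} → Presented₂ E → Presented E
        presented {E} (u , c) = u , λ β approx →
          let split : ∀ {x n} → refined u n x ≡ β n →
                      code x n ≡ proj₁ (unpair (β n)) × u n x ≡ proj₂ (unpair (β n))
              split {x} {n} e = cong proj₁ (trans (sym (unpair-pair _ _)) (cong unpair e)) ,
                                cong proj₂ (trans (sym (unpair-pair _ _)) (cong unpair e))
              (x , Ex , e) = c (proj₁ ∘ unpair ∘ β) (proj₂ ∘ unpair ∘ β)
                               (λ k → let (x , Ex , e) = approx k in x , Ex , λ n n<k → split (e n n<k))
          in x , Ex , λ n → let (x' , _ , e') = approx (suc n) in trans
               (cong₂ pair (trans (proj₁ (e n)) (sym (proj₁ (split (e' n ≤-refl)))))
                           (trans (proj₂ (e n)) (sym (proj₂ (split (e' n ≤-refl))))))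
               (e' n ≤-refl)

        ≐-presented : {A B : Pred X 0ℓ} → A ≐ B → Presented₂ A → Presented₂ B
        ≐-presented (to , from) (u , c) = u , λ β γ approx →
          let (x , Ax , e) = c β γ (λ k → let (x , Bx , e) = approx k in x , from Bx , e) in x , to Ax , e

        coordinate-presented : (n : ℕ) (P : ℕ → Set) → Presented₂ (λ x → P (code x n))
        coordinate-presented n P = (λ _ _ → 0) , λ β γ approx →
          let (x , e) = code-closed β (λ k → let (x , _ , e) = approx k in x , λ m m<k → proj₁ (e m m<k))
              (x' , Px' , e') = approx (suc n)
          in x , subst P (trans (proj₁ (e' n ≤-refl)) (sym (e n))) Px' ,
             λ m → e m , let (_ , _ , e″) = approx (suc m) in proj₂ (e″ m ≤-refl)

        -- The labels of all the sets are interleaved through `unpair`. Each `A n` yields its own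
        -- limit; all of them have code `β`, so they are one point.
        ⋂-presented : {A : ℕ → Pred X 0ℓ} → (∀ n → Presented₂ (A n)) → Presented₂ (λ x → ∀ n → A n x)
        ⋂-presented {A} pres = v , λ β γ approx →
          let limit : ∀ n → ∃ λ x → A n x × (∀ i → code x i ≡ β i × proj₁ (pres n) i x ≡ γ (pair n i))
              limit n = proj₂ (pres n) β (γ ∘ pair n) λ k →
                let (K , k≤K , b) = bound (pair n) k
                    (x , Ax , e) = approx K
                in x , Ax n , λ i i<k → proj₁ (e i (≤-trans i<k k≤K)) ,
                     trans (cong (λ p → proj₁ (pres (proj₁ p)) (proj₂ p) x) (sym (unpair-pair n i)))
                       (proj₂ (e (pair n i) (b i i<k)))
              (x , _ , e) = limit 0
              same : ∀ n → proj₁ (limit n) ≡ x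
              same n = code-injective λ i → trans (proj₁ (proj₂ (proj₂ (limit n)) i)) (sym (proj₁ (e i)))
              all : ∀ n → A n x × (∀ i → code x i ≡ β i × proj₁ (pres n) i x ≡ γ (pair n i))
              all n = subst (λ y → A n y × (∀ i → code y i ≡ β i × proj₁ (pres n) i y ≡ γ (pair n i)))
                        (same n) (proj₂ (limit n))
          in x , (λ n → proj₁ (all n)) , λ m → proj₁ (e m) ,
               value β γ approx m x (λ n i → proj₂ (proj₂ (all n) i))
          where
          v : ℕ → X → ℕ
          v m x = proj₁ (pres (proj₁ (unpair m))) (proj₂ (unpair m)) x
          -- With `unpair m = (p , q)`, the indices `m` and `pair p q` need not coincide, but they
          -- carry the same label of every point. An approximation that realizes `γ` at both shows
          -- that `γ` agrees there.
          value : ∀ (β γ : ℕ → ℕ) →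
            (∀ k → ∃ λ x → (∀ n → A n x) × (∀ n → n < k → code x n ≡ β n × v n x ≡ γ n)) →
            ∀ m x → (∀ n i → proj₁ (pres n) i x ≡ γ (pair n i)) → v m x ≡ γ m
          value β γ approx m x e =
            let p = proj₁ (unpair m) ; q = proj₂ (unpair m)
                (x₁ , _ , e₁) = approx (suc m + suc (pair p q))
                at-m  = proj₂ (e₁ m (m≤m+n (suc m) _))
                at-pq = proj₂ (e₁ (pair p q) (m≤n+m (suc (pair p q)) (suc m)))
                v≡ : v m x₁ ≡ v (pair p q) x₁
                v≡ = cong (λ r → proj₁ (pres (proj₁ r)) (proj₂ r) x₁) (sym (unpair-pair p q))
            in trans (e p q) (trans (sym at-pq) (trans (sym v≡) at-m))

        -- The first label records which `A n` contains the point, the remaining ones are the labels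
        -- of that set. A limit thus stays within a single `A n`, and disjointness identifies its
        -- recorded index.
        disjoint-⋃-presented : {A : ℕ → Pred X 0ℓ} → (∀ {m n x} → A m x → A n x → m ≡ n) →
          (∀ n → Presented₂ (A n)) → Presented₂ (λ x → ∃ λ n → A n x)
        disjoint-⋃-presented {A} disjoint pres = v , λ β γ approx →
          let N = γ 0
              (x , Ax , e) = proj₂ (pres N) β (γ ∘ suc) λ k →
                let (x , (n , Ax) , e) = approx (suc k)
                    νx≡N = proj₂ (e 0 z<s)
                    n≡N = trans (disjoint Ax (ν-spec (n , Ax))) νx≡N
                in x , subst (λ i → A i x) n≡N Ax , λ i i<k → proj₁ (e i (m<n⇒m<1+n i<k)) ,
                     trans (cong (λ j → proj₁ (pres j) i x) (sym νx≡N)) (proj₂ (e (suc i) (s<s i<k)))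
              νx≡N = disjoint (ν-spec (N , Ax)) Ax
          in x , (N , Ax) , λ { zero → proj₁ (e 0) , νx≡N
                              ; (suc i) → proj₁ (e (suc i)) ,
                                  trans (cong (λ j → proj₁ (pres j) i x) νx≡N) (proj₂ (e i)) }
          where
          ν : X → ℕ
          ν x with em {P = ∃ λ n → A n x}
          ... | yes (n , _) = n
          ... | no _ = 0
          ν-spec : ∀ {x} → ∃ (λ n → A n x) → A (ν x) x
          ν-spec {x} ∃A with em {P = ∃ λ n → A n x}
          ... | yes (_ , a) = a
          ... | no ¬∃A = ⊥-elim (¬∃A ∃A)
          v : ℕ → X → ℕ
          v zero    x = ν x
          v (suc i) x = proj₁ (pres (ν x)) i x

        everything-presented : Presented₂ (λ _ → ⊤)
        everything-presented = coordinate-presented 0 (λ _ → ⊤)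

        ∩-presented : {A B : Pred X 0ℓ} → Presented₂ A → Presented₂ B → Presented₂ (λ x → A x × B x)
        ∩-presented {A} {B} a b = ≐-presented ((λ f → f 0 , f 1) , λ { (a , b) zero → a ; (a , b) (suc _) → b })
          (⋂-presented {A = C} λ { zero → a ; (suc _) → b })
          where
          C : ℕ → Pred X 0ℓ
          C zero    = A
          C (suc _) = B

        -- A presentation of a set gives none of its complement, so the induction carries both. A
        -- union is made disjoint by taking the least index that contains the point.
        borel-presented₂ : {A : Pred X 0ℓ} → Borel A → Presented₂ A × Presented₂ (∁ A)
        borel-presented₂ (generator (n , m , to , from)) =
          ≐-presented (from , to) (coordinate-presented n (_≡ m)) ,
          ≐-presented ((λ ¬e a → ¬e (to a)) , λ ¬a e → ¬a (from e)) (coordinate-presented n (_≢ m))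
        borel-presented₂ empty =
          ((λ _ _ → 0) , λ β γ approx → ⊥-elim (proj₁ (proj₂ (approx 0)))) ,
          ≐-presented ((λ _ ()) , λ _ → tt) everything-presented
        borel-presented₂ (complement b) =
          proj₂ (borel-presented₂ b) ,
          ≐-presented ((λ a ¬a → ¬a a) , dne) (proj₁ (borel-presented₂ b))
        borel-presented₂ (union {A = A} bs) =
          ≐-presented
            ((λ (n , a , _) → n , a) , λ ∃A → let (n , a , min) = minimum ∃A in n , a , min)
            (disjoint-⋃-presented
              (λ (a , min) (a' , min') → minimum-unique a min a' min')
              (λ n → ∩-presented (proj₁ (borel-presented₂ (bs n))) (⋂-presented (first n)))) ,
          ≐-presented ((λ ¬a (n , a) → ¬a n a) , λ ¬∃ n a → ¬∃ (n , a))
            (⋂-presented (λ n → proj₂ (borel-presented₂ (bs n))))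
          where
          first : ∀ n m → Presented₂ (λ x → m < n → ¬ A m x)
          first n m with em {P = m < n}
          ... | yes m<n = ≐-presented ((λ ¬a _ → ¬a) , λ f → f m<n) (proj₂ (borel-presented₂ (bs m)))
          ... | no m≮n = ≐-presented ((λ _ m<n → ⊥-elim (m≮n m<n)) , λ _ → tt) everything-presented
        borel-presented₂ (resp (to , from) b) =
          ≐-presented (to , from) (proj₁ (borel-presented₂ b)) ,
          ≐-presented ((λ ¬a b → ¬a (from b)) , λ ¬b a → ¬b (to a)) (proj₂ (borel-presented₂ b))

      borel-presented : {A : Pred X 0ℓ} → Borel A → Presented A
      borel-presented b = presented (proj₁ (borel-presented₂ b))

    complete-∩ : {Z : Set} {w : ℕ → Z → ℕ} {E : Pred Z 0ℓ} → Complete w E →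
      (n : ℕ) (P : ℕ → Set) → Complete w (λ z → E z × P (w n z))
    complete-∩ c n P β approx =
      let (z , Ez , e) = c β (λ k → let (z , (Ez , _) , e) = approx k in z , Ez , e)
          (z' , (_ , Pz') , e') = approx (suc n)
      in z , (Ez , subst P (trans (e' n ≤-refl) (sym (e n))) Pz') , e

    Continuous : {Z X : Set} {{_ : Coded X}} → (ℕ → Z → ℕ) → (Z → X) → Set
    Continuous w f = ∀ n {z z'} → w n z ≡ w n z' → code (f z) n ≡ code (f z') n

    module _ {X : Set} {{_ : Coded X}} where

      Separated : {Z Z' : Set} → (Z → X) → (Z' → X) → Pred Z 0ℓ → Pred Z' 0ℓ → Set₁
      Separated f g P Q = ∃ λ (B : Pred X 0ℓ) → Borel B × (∀ {z} → P z → B (f z)) × (∀ {z} → Q z → ¬ B (g z))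

      -- Lusin's separation argument. Inseparability descends, one label at a time, to a shrinking
      -- pair of cells; completeness yields limits `z` and `z'`. Their images differ at some
      -- coordinate `n`, and by continuity the cylinder of `f z` at `n` separates the pair of stage
      -- `suc n`.
      module Separation {Z Z' : Set} {w : ℕ → Z → ℕ} {w' : ℕ → Z' → ℕ} {f : Z → X} {g : Z' → X}
        {E : Pred Z 0ℓ} {E' : Pred Z' 0ℓ} (c : Complete w E) (c' : Complete w' E')
        (cont : Continuous w f) (cont' : Continuous w' g)
        (disjoint : ∀ {z z'} → E z → E' z' → f z ≢ g z') where

        private
          Cell : {Z : Set} → (ℕ → Z → ℕ) → Pred Z 0ℓ → ℕ → ℕ → Pred Z 0ℓ
          Cell w P n l z = P z × w n z ≡ l

          -- There are countably many pairs of cells, so separators of all of them combine: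
          -- intersect over `l'`, then unite over `l`.
          refine : ∀ n {P Q} → ¬ Separated f g P Q → ∃₂ λ l l' → ¬ Separated f g (Cell w P n l) (Cell w' Q n l')
          refine n {P} {Q} insep = dne λ ¬∃ → insep (glue λ l l' → dne λ ¬s → ¬∃ (l , l' , ¬s))
            where
            glue : (∀ l l' → Separated f g (Cell w P n l) (Cell w' Q n l')) → Separated f g P Q
            glue sep =
              (λ x → ∃ λ l → ∀ l' → proj₁ (sep l l') x) ,
              σ-⋃ (λ l → σ-⋂ (λ l' → proj₁ (proj₂ (sep l l')))) ,
              (λ {z} Pz → w n z , λ l' → proj₁ (proj₂ (proj₂ (sep (w n z) l'))) (Pz , refl)) ,
              (λ {z} Qz (l , all) → proj₂ (proj₂ (proj₂ (sep l (w' n z)))) (Qz , refl) (all (w' n z)))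

          record Stage : Set₁ where
            field
              {P}   : Pred Z 0ℓ
              {Q}   : Pred Z' 0ℓ
              insep : ¬ Separated f g P Q

          open Stage

          module Descent (start : ¬ Separated f g E E') where

            stage : ℕ → Stage
            stage zero = record { insep = start }
            stage (suc n) = record { insep = proj₂ (proj₂ (refine n (insep (stage n)))) }

            l l' : ℕ → ℕ
            l n  = proj₁ (refine n (insep (stage n)))
            l' n = proj₁ (proj₂ (refine n (insep (stage n))))

            inhabited : ∀ k → ∃ (P (stage k))
            inhabited k = dne λ ¬∃ → insep (stage k)
              ((λ _ → ⊥) , σ-const ⊥ , (λ p → ⊥-elim (¬∃ (_ , p))) , λ _ ())
            inhabited' : ∀ k → ∃ (Q (stage k))
            inhabited' k = dne λ ¬∃ → insep (stage k)
              ((λ _ → ⊤) , σ-const ⊤ , (λ _ → tt) , λ q → ⊥-elim (¬∃ (_ , q)))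

            labels : ∀ k {z} → P (stage k) z → E z × (∀ n → n < k → w n z ≡ l n)
            labels zero    p = p , λ _ ()
            labels (suc k) (p , e) = proj₁ (labels k p) , λ n n<k+1 → go n (m<1+n⇒m<n∨m≡n n<k+1)
              where
              go : ∀ n → n < k ⊎ n ≡ k → w n _ ≡ l n
              go n (inj₁ n<k) = proj₂ (labels k p) n n<k
              go n (inj₂ refl) = e
            labels' : ∀ k {z} → Q (stage k) z → E' z × (∀ n → n < k → w' n z ≡ l' n)
            labels' zero    q = q , λ _ ()
            labels' (suc k) (q , e) = proj₁ (labels' k q) , λ n n<k+1 → go n (m<1+n⇒m<n∨m≡n n<k+1)
              where
              go : ∀ n → n < k ⊎ n ≡ k → w' n _ ≡ l' n
              go n (inj₁ n<k) = proj₂ (labels' k q) n n<k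
              go n (inj₂ refl) = e

            contradiction : ⊥
            contradiction =
              let (z , Ez , e) = c l (λ k → let (z , p) = inhabited k in z , labels k p)
                  (z' , Ez' , e') = c' l' (λ k → let (z , q) = inhabited' k in z , labels' k q)
                  (n , differ) = ¬∀⇒∃ (λ same → disjoint Ez Ez' (code-injective same))
              in insep (stage (suc n))
                   ((λ x → code x n ≡ code (f z) n) , cylinder n _ ,
                    (λ p → cont n (trans (proj₂ (labels (suc n) p) n ≤-refl) (sym (e n)))) ,
                    (λ q eq → differ (trans (sym eq) (cont' n (trans (proj₂ (labels' (suc n) q) n ≤-refl) (sym (e' n)))))))

        separate : Separated f g E E'
        separate = dne Descent.contradiction

      module _ {Z : Set} {w : ℕ → Z → ℕ} {f : Z → X} {E : Pred Z 0ℓ}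
        (c : Complete w E) (cont : Continuous w f)
        (injective : ∀ {z z'} → E z → E z' → f z ≡ f z' → z ≡ z') where

        private
          abstract
            piece : ∀ n l → Separated f f (λ z → E z × w n z ≡ l) (λ z → E z × w n z ≢ l)
            piece n l = Separation.separate (complete-∩ c n (_≡ l)) (complete-∩ c n (_≢ l)) cont cont
              λ (Ez , e) (Ez' , ne) fz≡fz' → ne (trans (cong (w n) (sym (injective Ez Ez' fz≡fz'))) e)

          C : ℕ → ℕ → Pred X 0ℓ
          C n l = proj₁ (piece n l)

          C-in : ∀ {n z} → E z → C n (w n z) (f z)
          C-in {n} {z} Ez = proj₁ (proj₂ (proj₂ (piece n (w n z)))) (Ez , refl)

          C-label : ∀ {n l z} → E z → C n l (f z) → w n z ≡ l
          C-label {n} {l} {z} Ez c = dne λ ne → proj₂ (proj₂ (proj₂ (piece n l))) (Ez , ne) c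

          Compatible : ℕ → X → Z → Set
          Compatible n x z = C n (w n z) x × code x n ≡ code (f z) n

          -- No complexity of `Z` enters: countable unions first fix the labels and codes of `z`
          -- that matter, after which the existence of `z` no longer mentions `x` and is a constant
          -- set.
          prefix-borel : ∀ m k (P : Pred Z 0ℓ) →
            Borel (λ x → ∃ λ z → P z × (∀ n → n < k → Compatible (m + n) x z))
          prefix-borel m zero P = resp ((λ (z , p) → z , p , λ _ ()) , λ (z , p , _) → z , p)
            (σ-const (∃ P))
          prefix-borel m (suc k) P = resp (to , from)
            (σ-⋃ {I = ℕ} λ l → σ-⋃ {I = ℕ} λ v → σ-∩ (proj₁ (proj₂ (piece m l)))
              (σ-∩ (cylinder m v) (prefix-borel (suc m) k (λ z → P z × w m z ≡ l × code (f z) m ≡ v))))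
            where
            Step : X → Set
            Step x = ∃ λ l → ∃ λ v → C m l x × code x m ≡ v ×
              ∃ λ z → (P z × w m z ≡ l × code (f z) m ≡ v) × (∀ n → n < k → Compatible (suc m + n) x z)
            to : ∀ {x} → Step x → ∃ λ z → P z × (∀ n → n < suc k → Compatible (m + n) x z)
            to {x} (l , v , Clx , xv , z , (Pz , wl , fv) , rest) = z , Pz , λ
              { zero _ → subst (λ i → Compatible i x z) (sym (+-identityʳ m))
                           (subst (λ j → C m j x) (sym wl) Clx , trans xv (sym fv))
              ; (suc n) n<k → subst (λ i → Compatible i x z) (sym (+-suc m n)) (rest n (s<s⁻¹ n<k)) }
            from : ∀ {x} → ∃ (λ z → P z × (∀ n → n < suc k → Compatible (m + n) x z)) → Step x
            from {x} (z , Pz , all) =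
              let (c₀ , v₀) = subst (λ i → Compatible i x z) (+-identityʳ m) (all 0 z<s)
              in w m z , code (f z) m , c₀ , v₀ , z , (Pz , refl , refl) ,
                 λ n n<k → subst (λ i → Compatible i x z) (+-suc m n) (all (suc n) (s<s n<k))

        -- By injectivity the sets `C n l` read the labels of a preimage off the image point.
        -- Conversely, if at most one label is read at each `n` and all finite prefixes are
        -- compatible with members of `E`, these members converge in labels; completeness gives the
        -- limit, and the code clause of `Compatible` shows that it is mapped to `x`.
        injective-image-borel : Borel (λ x → ∃ λ z → E z × f z ≡ x)
        injective-image-borel = resp
          {A = λ x → (∀ n l l' → C n l x → C n l' x → l ≡ l') ×
                     (∀ k → ∃ λ z → E z × (∀ n → n < k → Compatible n x z))}
          (to , from)
          (σ-∩ (σ-⋂ {I = ℕ} λ n → σ-⋂ {I = ℕ} λ l → σ-⋂ {I = ℕ} λ l' →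
                  σ-⇒ (proj₁ (proj₂ (piece n l))) (σ-⇒ (proj₁ (proj₂ (piece n l'))) (σ-const (l ≡ l'))))
               (σ-⋂ {I = ℕ} λ k → prefix-borel 0 k E))
          where
          to : ∀ {x} → (∀ n l l' → C n l x → C n l' x → l ≡ l') ×
                       (∀ k → ∃ λ z → E z × (∀ n → n < k → Compatible n x z)) → ∃ λ z → E z × f z ≡ x
          to {x} (unique , approx) =
            let zₖ : ℕ → Z
                zₖ k = proj₁ (approx k)
                compat : ∀ k n → n < k → Compatible n x (zₖ k)
                compat k = proj₂ (proj₂ (approx k))
                (z , Ez , e) = c (λ n → w n (zₖ (suc n))) λ k → zₖ k , proj₁ (proj₂ (approx k)) ,
                  λ n n<k → unique n _ _ (proj₁ (compat k n n<k)) (proj₁ (compat (suc n) n ≤-refl))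
            in z , Ez , code-injective λ n → trans (cont n (e n)) (sym (proj₂ (compat (suc n) n ≤-refl)))
          from : ∀ {x} → ∃ (λ z → E z × f z ≡ x) → (∀ n l l' → C n l x → C n l' x → l ≡ l') ×
                       (∀ k → ∃ λ z → E z × (∀ n → n < k → Compatible n x z))
          from (z , Ez , refl) =
            (λ n l l' c c' → trans (sym (C-label Ez c)) (C-label Ez c')) ,
            λ k → z , Ez , λ n _ → C-in Ez , refl

  -- Lusin-Novikov uniformization for relations with boundedly many values.

  module LusinNovikov where
    open Classical
    open BorelSets
    open LusinSouslin

    remove : {A : Set} {y : A} (ys : List A) → y ∈ ys →
      ∃ λ zs → length ys ≡ suc (length zs) × (∀ {z} → z ∈ ys → z ≢ y → z ∈ zs)
    remove (y ∷ ys) (here refl) = ys , refl , λ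
      { (here refl) z≢y → ⊥-elim (z≢y refl) ; (there z∈ys) _ → z∈ys }
    remove (y' ∷ ys) (there y∈ys) with remove ys y∈ys
    ... | zs , len , keep = y' ∷ zs , cong suc len , λ
      { (here refl) _ → here refl ; (there z∈ys) z≢y → there (keep z∈ys z≢y) }

    infix 4 _≺_
    -- The lexicographic order of codes. It need not be well-founded; minima are taken in finite
    -- sections only.
    _≺_ : {Y : Set} {{_ : Coded Y}} → Y → Y → Set
    y ≺ z = ∃ λ n → code y n < code z n × (∀ i → i < n → code y i ≡ code z i)

    module _ {Y : Set} {{_ : Coded Y}} where

      ≺-irrefl : {y : Y} → ¬ y ≺ y
      ≺-irrefl (n , lt , _) = <-irrefl refl lt

      ≺-trans : {x y z : Y} → x ≺ y → y ≺ z → x ≺ z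
      ≺-trans {x} {y} {z} (m , x<y , x≡y) (n , y<z , y≡z) with <-cmp m n
      ... | tri< m<n _ _ = m , subst (code x m <_) (y≡z m m<n) x<y ,
                           λ i i<m → trans (x≡y i i<m) (y≡z i (<-trans i<m m<n))
      ... | tri≈ _ refl _ = m , <-trans x<y y<z , λ i i<m → trans (x≡y i i<m) (y≡z i i<m)
      ... | tri> _ _ n<m = n , subst (_< code z n) (sym (x≡y n n<m)) y<z ,
                           λ i i<n → trans (x≡y i (<-trans i<n n<m)) (y≡z i i<n)

      ≺-total : {y z : Y} → y ≢ z → y ≺ z ⊎ z ≺ y
      ≺-total {y} {z} y≢z with minimum (¬∀⇒∃ {P = λ n → code y n ≡ code z n} (y≢z ∘ code-injective))
      ... | n , differ , agree with <-cmp (code y n) (code z n)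
      ...   | tri< lt _ _ = inj₁ (n , lt , λ i i<n → dne (agree i i<n))
      ...   | tri≈ _ eq _ = ⊥-elim (differ eq)
      ...   | tri> _ _ gt = inj₂ (n , gt , λ i i<n → sym (dne (agree i i<n)))

      ≺-minimal : ∀ k (S : Pred Y 0ℓ) (ys : List Y) → length ys ≤ k → (∀ {y} → S y → y ∈ ys) → ∃ S →
        ∃ λ y → S y × (∀ {z} → S z → ¬ z ≺ y)
      ≺-minimal zero S [] len cover (y , s) with () ← cover s
      ≺-minimal (suc k) S ys len cover (y , s) with em {P = ∃ λ z → S z × z ≺ y}
      ... | no ¬lower = y , s , λ sz z≺y → ¬lower (_ , sz , z≺y)
      ... | yes (z , sz , z≺y) with remove ys (cover s)
      ...   | zs , eq , keep with ≺-minimal k (λ z → S z × z ≺ y) zs (s≤s⁻¹ (subst (_≤ suc k) eq len))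
                                   (λ { (s , z≺y) → keep (cover s) (λ { refl → ≺-irrefl z≺y }) }) (z , sz , z≺y)
      ...     | m , (sm , m≺y) , min = m , sm , λ sz z≺m → min (sz , ≺-trans z≺m m≺y) z≺m

    ≺-Borel : {X Y : Set} {{_ : Coded X}} {{_ : Coded Y}} {f g : X → Y} →
      Measurable f → Measurable g → Borel (λ x → f x ≺ g x)
    ≺-Borel {X} {Y} {f} {g} mf mg = σ-⋃ {I = ℕ} λ n → σ-∩ (compare _<_ n) (σ-⋂< n (compare _≡_))
      where
      compare : (R : ℕ → ℕ → Set) → ∀ n → Borel (λ x → R (code (f x) n) (code (g x) n))
      compare R n = resp {A = λ x → ∃ λ a → ∃ λ b → code (f x) n ≡ a × code (g x) n ≡ b × R a b}
        ((λ { (a , b , refl , refl , r) → r }) , λ r → _ , _ , refl , refl , r)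
        (σ-⋃ {I = ℕ} λ a → σ-⋃ {I = ℕ} λ b → σ-∩ (mf (cylinder n a)) (σ-∩ (mg (cylinder n b)) (σ-const (R a b))))

    -- Lusin–Souslin for relations.
    functional-domain-borel : {X Y : Set} {{_ : Coded X}} {{_ : Coded Y}} {E : Pred (X × Y) 0ℓ} → Borel E →
      (∀ {x y z} → E (x , y) → E (x , z) → y ≡ z) → Borel (λ x → ∃ λ y → E (x , y))
    functional-domain-borel {X} {Y} {E} b functional = resp
      ((λ { ((x , y) , e , refl) → y , e }) , λ (y , e) → (_ , y) , e , refl)
      (injective-image-borel {w = refined (proj₁ pres)} {f = proj₁} (proj₂ pres) cont inj)
      where
      pres = borel-presented b
      cont : Continuous (refined {X = X × Y} (proj₁ pres)) proj₁
      cont n eq = proj₁ (pair-injective (proj₁ (pair-injective eq)))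
      inj : ∀ {p q : X × Y} → E p → E q → proj₁ p ≡ proj₁ q → p ≡ q
      inj {x , y} {_ , z} e e' refl = cong (x ,_) (functional e e')

    -- Lusin–Novikov for bounded sections, peeling off the ≺-least point of each section.
    uniformize : ∀ k {X Y : Set} {{_ : Coded X}} {{_ : Coded Y}} {E : Pred (X × Y) 0ℓ} → Borel E →
      (∀ x → ∃ λ ys → length ys ≤ k × (∀ {y} → E (x , y) → y ∈ ys)) →
      (d : X → Y) → Measurable d →
      ∃ λ (φ : Fin k → X → Y) → (∀ i → Measurable (φ i)) × (∀ {x y} → E (x , y) → ∃ λ i → φ i x ≡ y)
    uniformize zero b cover d md = (λ ()) , (λ ()) , λ {x} e → no-member (proj₁ (cover x)) (proj₁ (proj₂ (cover x))) (proj₂ (proj₂ (cover x)) e)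
      where
      no-member : {A : Set} {y : A} {B : Set} (ys : List A) → length ys ≤ 0 → y ∈ ys → B
      no-member [] _ ()
    uniformize (suc k) {X} {Y} {E} b cover d md = φ , measurable , covers
      where
      -- The induction passes to the base `X × Y`: over `(x , y)` lie the members of the section
      -- below `y`. As `y` itself is lost, `k` functions list them, and being least becomes the
      -- finite, hence Borel, condition that none of these functions hits a lower member.
      Lower : Pred ((X × Y) × Y) 0ℓ
      Lower ((x , y) , z) = (E (x , y) × E (x , z)) × z ≺ y

      Lower-borel : Borel Lower
      Lower-borel = σ-∩
        (σ-∩ (proj₁-measurable b)
             (⟨ ∘-measurable proj₁-measurable proj₁-measurable , proj₂-measurable ⟩-measurable b))
        (≺-Borel proj₂-measurable (∘-measurable proj₂-measurable proj₁-measurable))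

      Lower-cover : ∀ p → ∃ λ ys → length ys ≤ k × (∀ {z} → Lower (p , z) → z ∈ ys)
      Lower-cover (x , y) with cover x | em {P = E (x , y)}
      ... | ys , len , c | no ¬e = [] , z≤n , λ ((e , _) , _) → ⊥-elim (¬e e)
      ... | ys , len , c | yes e with remove ys (c e)
      ...   | zs , eq , keep = zs , s≤s⁻¹ (subst (_≤ suc k) eq len) ,
              λ ((_ , e') , z≺y) → keep (c e') (λ { refl → ≺-irrefl {y = y} z≺y })

      abstract
        lower : ∃ λ (ψ : Fin k → X × Y → Y) → (∀ i → Measurable (ψ i)) × (∀ {p z} → Lower (p , z) → ∃ λ i → ψ i p ≡ z)
        lower = uniformize k {X × Y} {Y} Lower-borel Lower-cover proj₂ proj₂-measurable

      Least : Pred (X × Y) 0ℓ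
      Least p = E p × ¬ ∃ λ i → Lower (p , proj₁ lower i p)

      Least-borel : Borel Least
      Least-borel = σ-∩ b (σ-∁ (σ-Fin∃ λ i → ⟨ id-measurable , proj₁ (proj₂ lower) i ⟩-measurable Lower-borel))

      not-lower : ∀ {x y z} → Least (x , y) → E (x , z) → ¬ z ≺ y
      not-lower {x} {y} {z} (e , ¬∃) e' z≺y with proj₂ (proj₂ lower) {x , y} {z} ((e , e') , z≺y)
      ... | i , eq = ¬∃ (i , subst (λ z → Lower ((x , y) , z)) (sym eq) ((e , e') , z≺y))

      Least-functional : ∀ {x y z} → Least (x , y) → Least (x , z) → y ≡ z
      Least-functional {x} {y} {z} l m = dne λ y≢z → cases (≺-total y≢z)
        where
        cases : ¬ (y ≺ z ⊎ z ≺ y)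
        cases (inj₁ y≺z) = not-lower m (proj₁ l) y≺z
        cases (inj₂ z≺y) = not-lower l (proj₁ m) z≺y

      least-exists : ∀ {x y} → E (x , y) → ∃ λ y → Least (x , y)
      least-exists {x} {y} e with cover x
      ... | ys , len , c with ≺-minimal (suc k) (λ y → E (x , y)) ys len c (y , e)
      ...   | m , em' , min = m , em' , λ (i , ((_ , e') , lt)) → min e' lt

      φ₀ : X → Y
      φ₀ x with em {P = ∃ λ y → Least (x , y)}
      ... | yes (y , _) = y
      ... | no _ = d x

      φ₀-least : ∀ {x y} → Least (x , y) → φ₀ x ≡ y
      φ₀-least {x} l with em {P = ∃ λ y → Least (x , y)}
      ... | yes (_ , l') = Least-functional l' l
      ... | no ¬∃ = ⊥-elim (¬∃ (_ , l))

      φ₀-default : ∀ {x} → ¬ (∃ λ y → Least (x , y)) → φ₀ x ≡ d x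
      φ₀-default {x} ¬∃ with em {P = ∃ λ y → Least (x , y)}
      ... | yes ∃l = ⊥-elim (¬∃ ∃l)
      ... | no _ = refl

      φ₀-measurable : Measurable φ₀
      φ₀-measurable {A} a = resp (to , from)
        (σ-∪ (functional-domain-borel (σ-∩ Least-borel (proj₂-measurable a)) (λ (l , _) (m , _) → Least-functional l m))
             (σ-∩ (σ-∁ (functional-domain-borel Least-borel Least-functional)) (md a)))
        where
        to : ∀ {x} → (∃ λ y → Least (x , y) × A y) ⊎ (¬ (∃ λ y → Least (x , y)) × A (d x)) → A (φ₀ x)
        to (inj₁ (y , l , ay)) = subst A (sym (φ₀-least l)) ay
        to (inj₂ (¬∃ , ad)) = subst A (sym (φ₀-default ¬∃)) ad
        from : ∀ {x} → A (φ₀ x) → (∃ λ y → Least (x , y) × A y) ⊎ (¬ (∃ λ y → Least (x , y)) × A (d x))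
        from {x} a with em {P = ∃ λ y → Least (x , y)}
        ... | yes (y , l) = inj₁ (y , l , a)
        ... | no ¬∃ = inj₂ (¬∃ , a)

      Rest : Pred (X × Y) 0ℓ
      Rest p = E p × ¬ Least p

      Rest-cover : ∀ x → ∃ λ ys → length ys ≤ k × (∀ {y} → Rest (x , y) → y ∈ ys)
      Rest-cover x with cover x | em {P = ∃ λ y → Least (x , y)}
      ... | ys , len , c | no ¬∃ = [] , z≤n , λ (e , _) → ⊥-elim (¬∃ (least-exists e))
      ... | ys , len , c | yes (y , l) with remove ys (c (proj₁ l))
      ...   | zs , eq , keep = zs , s≤s⁻¹ (subst (_≤ suc k) eq len) ,
              λ (e , ¬l) → keep (c e) (λ { refl → ¬l l })

      abstract
        rest : ∃ λ (φ : Fin k → X → Y) → (∀ i → Measurable (φ i)) × (∀ {x y} → Rest (x , y) → ∃ λ i → φ i x ≡ y)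
        rest = uniformize k {X} {Y} (σ-∩ b (σ-∁ Least-borel)) Rest-cover d md

      φ : Fin (suc k) → X → Y
      φ zero    = φ₀
      φ (suc i) = proj₁ rest i

      measurable : ∀ i → Measurable (φ i)
      measurable zero    = φ₀-measurable
      measurable (suc i) = proj₁ (proj₂ rest) i

      covers : ∀ {x y} → E (x , y) → ∃ λ i → φ i x ≡ y
      covers {x} {y} e with em {P = Least (x , y)}
      ... | yes l = zero , φ₀-least l
      ... | no ¬l with proj₂ (proj₂ rest) (e , ¬l)
      ...   | i , eq = suc i , eq

  -- Coding a complete separable metric space by a closed subset of Baire space.

  module StandardCoding where
    open Classical
    open BorelSets
    open import Data.Integer.Base as ℤ using (+_; +<+; +≤+)
    open import Data.Maybe.Base using (Maybe; just)
    open import Data.Maybe.Properties using (just-injective)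
    open import Data.Nat.Coprimality using (1-coprimeTo)
    open import Data.Rational.Base as ℚ using (ℚ; mkℚ; 0ℚ; *<*; *≤*)
    import Data.Rational.Properties as ℚₚ
    open import Function.Metric.Structures using (IsGeneralMetric)

    abstract
      1/suc : ℕ → ℚ
      1/suc n = mkℚ (+ 1) n (1-coprimeTo (suc n))

      1/suc-positive : ∀ n → 0ℚ ℚ.< 1/suc n
      1/suc-positive n = ℚₚ.positive⁻¹ (1/suc n)

      1/suc-antitone : ∀ {m n} → m ℕ.≤ n → 1/suc n ℚ.≤ 1/suc m
      1/suc-antitone {m} {n} m≤n = *≤* (subst₂ ℤ._≤_ (sym (ℤ*1 m)) (sym (ℤ*1 n)) (+≤+ (s≤s m≤n)))
        where
        ℤ*1 : ∀ k → + 1 ℤ.* + suc k ≡ + suc k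
        ℤ*1 k = cong (λ i → + suc i) (ℕₚ.+-identityʳ k)

      1/suc-small : ∀ {δ} → 0ℚ ℚ.< δ → ∃ λ n → 1/suc n ℚ.< δ
      1/suc-small {δ@(mkℚ (+ zero) d _)} 0<δ = ⊥-elim (ℚ-zero 0<δ)
        where
        ℚ-zero : ¬ 0ℚ ℚ.< δ
        ℚ-zero (*<* (+<+ ()))
      1/suc-small {δ@(mkℚ (+ suc a) d _)} 0<δ = suc d , *<* (+<+ bound)
        where
        bound : suc (d ℕ.+ 0) ℕ.< suc a ℕ.* suc (suc d)
        bound = subst (λ e → suc e < suc a ℕ.* suc (suc d)) (sym (ℕₚ.+-identityʳ d))
                  (ℕₚ.≤-trans ℕₚ.≤-refl (ℕₚ.m≤m+n (suc (suc d)) (a ℕ.* suc (suc d))))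
      1/suc-small {mkℚ (ℤ.-[1+ _ ]) d _} (*<* ())

    1/suc-gap : ∀ {p q} → p ℚ.< q → ∃ λ n → p ℚ.+ 1/suc n ℚ.< q
    1/suc-gap {p} {q} p<q =
      let 0<q-p = subst (ℚ._< q ℚ.- p) (ℚₚ.+-inverseʳ p) (ℚₚ.+-monoˡ-< (ℚ.- p) p<q)
          (n , εn<) = 1/suc-small 0<q-p
      in n , subst (p ℚ.+ 1/suc n ℚ.<_) cancel (ℚₚ.+-monoʳ-< p εn<)
      where
      cancel : p ℚ.+ (q ℚ.- p) ≡ q
      cancel = trans (cong (p ℚ.+_) (ℚₚ.+-comm q (ℚ.- p)))
        (trans (sym (ℚₚ.+-assoc p (ℚ.- p) q))
          (trans (cong (ℚ._+ q) (ℚₚ.+-inverseʳ p)) (ℚₚ.+-identityˡ q)))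

    1/suc-gap₂ : ∀ {p q} → p ℚ.< q → ∃ λ n → (1/suc n ℚ.+ p) ℚ.+ 1/suc n ℚ.< q
    1/suc-gap₂ {p} {q} p<q =
      let (m , pm<q) = 1/suc-gap p<q
          (n , pmn<q) = 1/suc-gap pm<q
          k = m ℕ.⊔ n
          le : (1/suc k ℚ.+ p) ℚ.+ 1/suc k ℚ.≤ (p ℚ.+ 1/suc m) ℚ.+ 1/suc n
          le = ℚₚ.+-mono-≤ (subst (ℚ._≤ p ℚ.+ 1/suc m) (ℚₚ.+-comm p (1/suc k)) (ℚₚ.+-monoʳ-≤ p (1/suc-antitone (ℕₚ.m≤m⊔n m n))))
                 (1/suc-antitone (ℕₚ.m≤n⊔m m n))
      in k , ℚₚ.≤-<-trans le pmn<q

    1/suc-half : ∀ {δ} → 0ℚ ℚ.< δ → ∃ λ n → 1/suc n ℚ.+ 1/suc n ℚ.< δ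
    1/suc-half {δ} 0<δ = let (n , lt) = 1/suc-gap₂ 0<δ in
      n , subst (λ r → r ℚ.+ 1/suc n ℚ.< δ) (ℚₚ.+-identityʳ (1/suc n)) lt

    module Coding {X : Set} (M : CompleteSeparableMetric X) where
      open CompleteSeparableMetric M
      open IsGeneralMetric isMetric using (triangle; nonNegative; 0⇒≈) renaming (sym to d-sym)

      private
        s : ℕ → Maybe X
        s = proj₁ separable

        tri : ∀ {x y z p q} → d x y <ᴿ p → d y z <ᴿ q → d x z <ᴿ (p ℚ.+ q)
        tri {x} {y} {z} xy yz = triangle x y z (_ , _ , xy , yz , refl)

        flip : ∀ {x y q} → d x y <ᴿ q → d y x <ᴿ q
        flip {x} {y} = proj₁ (d-sym x y)

        widen : ∀ {x y p q} → p ℚ.< q → d x y <ᴿ p → d x y <ᴿ q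
        widen {x} {y} = ℝ.upward (d x y)

        widen≤ : ∀ {x y p q} → p ℚ.≤ q → d x y <ᴿ p → d x y <ᴿ q
        widen≤ {x} {y} p≤q xy<p = let (r , r<p , xy<r) = ℝ.rounded (d x y) xy<p in
          widen (ℚₚ.<-≤-trans r<p p≤q) xy<r

        indiscernible : ∀ {x y} → (∀ q → 0ℚ ℚ.< q → d x y <ᴿ q) → x ≡ y
        indiscernible {x} {y} close = 0⇒≈ (nonNegative , close _)

      O : ℕ → ℕ → X → Set
      O j n x = ∃ λ y → s j ≡ just y × d x y <ᴿ 1/suc n

      private
        dense : ∀ n x → ∃ λ j → O j n x
        dense n x = proj₂ separable x (1/suc n) (1/suc-positive n)

      abstract
        I : ℕ → X → ℕ
        I n x = proj₁ (minimum (dense n x))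

        I-O : ∀ n x → O (I n x) n x
        I-O n x = proj₁ (proj₂ (minimum (dense n x)))

        I-min : ∀ n x j → j < I n x → ¬ O j n x
        I-min n x = proj₂ (proj₂ (minimum (dense n x)))

      Inside : (i m j n : ℕ) → Set
      Inside i m j n = ∃₂ λ y z → s i ≡ just y × s j ≡ just z × ∃ λ q → d y z <ᴿ q × q ℚ.+ 1/suc m ℚ.< 1/suc n

      private
        inside-exists : ∀ {j n x} → O j n x → ∃ λ m → Inside (I m x) m j n
        inside-exists {j} {n} {x} (z , sj , xz) =
          let (q , q<1/suc , xz<q) = ℝ.rounded (d x z) xz
              (m , lt) = 1/suc-gap₂ q<1/suc
              (y , si , xy) = I-O m x
          in m , y , z , si , sj , 1/suc m ℚ.+ q , tri (flip xy) xz<q , lt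

      -- The indices `I` determine `x`, but a limit may fall on the boundary of a ball that contains
      -- all its approximations. A second record prevents this: 0 says that `x` is outside `O j n`,
      -- and `suc m` that `m` is the first scale at which the ball around the chosen centre fits
      -- into `O j n` with room to spare. Both kinds of record survive limits.
      WSpec : (j n : ℕ) (x : X) (v : ℕ) → Set
      WSpec j n x v = (¬ O j n x × v ≡ 0) ⊎
        (O j n x × ∃ λ m → v ≡ suc m × Inside (I m x) m j n × (∀ k → k < m → ¬ Inside (I k x) k j n))

      private
        W-total : ∀ j n x → ∃ (WSpec j n x)
        W-total j n x = go em
          where
          go : Dec (O j n x) → ∃ (WSpec j n x)
          go (no ¬o) = 0 , inj₁ (¬o , refl)
          go (yes o) = let (m , ins , least) = minimum {P = λ m → Inside (I m x) m j n} (inside-exists {j} {n} {x} o) in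
            suc m , inj₂ (o , m , refl , ins , least)

        W-functional : ∀ {j n x v w} → WSpec j n x v → WSpec j n x w → v ≡ w
        W-functional (inj₁ (_ , refl)) (inj₁ (_ , refl)) = refl
        W-functional (inj₁ (¬o , _)) (inj₂ (o , _)) = ⊥-elim (¬o o)
        W-functional (inj₂ (o , _)) (inj₁ (¬o , _)) = ⊥-elim (¬o o)
        W-functional {j} {n} {x} (inj₂ (_ , m , refl , i , min)) (inj₂ (_ , k , refl , i' , min')) =
          cong suc (minimum-unique {P = λ m → Inside (I m x) m j n} i min i' min')

      abstract
        W : ℕ → ℕ → X → ℕ
        W j n x = proj₁ (W-total j n x)

        W-spec : ∀ j n x → WSpec j n x (W j n x)
        W-spec j n x = proj₂ (W-total j n x)

      private
        code' : X → ℕ → ℕ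
        code' x k = pair (I k x) (W (proj₁ (unpair k)) (proj₂ (unpair k)) x)

        I-code : ∀ x k → I k x ≡ proj₁ (unpair (code' x k))
        I-code x k = cong proj₁ (sym (unpair-pair _ _))

        W-code : ∀ x j n → W j n x ≡ proj₂ (unpair (code' x (pair j n)))
        W-code x j n = trans (cong (λ p → W (proj₁ p) (proj₂ p) x) (sym (unpair-pair j n)))
                             (cong proj₂ (sym (unpair-pair _ _)))

        injective' : ∀ {x y} → (∀ n → code' x n ≡ code' y n) → x ≡ y
        injective' {x} {y} eq = indiscernible λ q 0<q →
          let (n , lt) = 1/suc-half 0<q
              (a , sa , xa) = I-O n x
              (b , sb , yb) = I-O n y
              I≡ = trans (I-code x n) (trans (cong (proj₁ ∘ unpair) (eq n)) (sym (I-code y n)))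
              a≡b = just-injective (trans (sym sa) (trans (cong s I≡) sb))
          in widen lt (tri (subst (λ c → d x c <ᴿ 1/suc n) a≡b xa) (flip yb))

        module Limit (β : ℕ → ℕ) (approx : ∀ k → ∃ λ x → ∀ n → n < k → code' x n ≡ β n) where

          ι : ℕ → ℕ
          ι n = proj₁ (unpair (β n))

          ω : ℕ → ℕ → ℕ
          ω j n = proj₂ (unpair (β (pair j n)))

          z : ℕ → X
          z k = proj₁ (approx k)

          I-z : ∀ {n k} → n < k → I n (z k) ≡ ι n
          I-z {n} {k} n<k = trans (I-code (z k) n) (cong (proj₁ ∘ unpair) (proj₂ (approx k) n n<k))

          W-z : ∀ {j n k} → pair j n < k → W j n (z k) ≡ ω j n
          W-z {j} {n} {k} lt = trans (W-code (z k) j n) (cong (proj₂ ∘ unpair) (proj₂ (approx k) (pair j n) lt))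

          center : ∀ n → ∃ λ y → s (ι n) ≡ just y
          center n = let (y , sy , _) = I-O n (z (suc n)) in y , trans (cong s (sym (I-z {n} ℕₚ.≤-refl))) sy

          y : ℕ → X
          y n = proj₁ (center n)

          near : ∀ {n k} → n < k → d (z k) (y n) <ᴿ 1/suc n
          near {n} {k} n<k =
            let (c , sc , zc) = I-O n (z k)
                c≡y = just-injective (trans (sym sc) (trans (cong s (I-z n<k)) (proj₂ (center n))))
            in subst (λ c → d (z k) c <ᴿ 1/suc n) c≡y zc

          cauchy : IsCauchy y
          cauchy δ 0<δ = let (N , lt) = 1/suc-half 0<δ in N , λ m n N≤m N≤n →
            let k = ℕ.suc (m ℕ.+ n) in
            widen lt (tri (flip (widen≤ (1/suc-antitone N≤m) (near (s≤s (ℕₚ.m≤m+n m n)))))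
                          (widen≤ (1/suc-antitone N≤n) (near (s≤s (ℕₚ.m≤n+m n m)))))

          x : X
          x = proj₁ (complete y cauchy)

          close : ∀ δ → 0ℚ ℚ.< δ → ∃ λ K → ∀ k → K ℕ.≤ k → d (z k) x <ᴿ δ
          close δ 0<δ =
            let (m , lt) = 1/suc-half 0<δ
                (N , conv) = proj₂ (complete y cauchy) (1/suc m) (1/suc-positive m)
                n = m ℕ.⊔ N
            in suc n , λ k n<k → widen lt
                 (tri (widen≤ (1/suc-antitone (ℕₚ.m≤m⊔n m N)) (near n<k)) (conv n (ℕₚ.m≤n⊔m m N)))

          O-eventually : ∀ {j n} → O j n x → ∃ λ K → ∀ k → K ℕ.≤ k → O j n (z k)
          O-eventually {j} {n} (c , sc , xc) =
            let (q , q<1/suc , xc<q) = ℝ.rounded (d x c) xc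
                (m , lt) = 1/suc-gap q<1/suc
                (K , cl) = close (1/suc m) (1/suc-positive m)
            in K , λ k K≤k → c , sc ,
                 widen (subst (ℚ._< 1/suc n) (ℚₚ.+-comm q (1/suc m)) lt) (tri (cl k K≤k) xc<q)

          ω-spec : ∀ {j n k} → pair j n < k → WSpec j n (z k) (ω j n)
          ω-spec {j} {n} {k} lt = subst (WSpec j n (z k)) (W-z lt) (W-spec j n (z k))

          ω-nonzero : ∀ {j n k m} → ω j n ≡ suc m → WSpec j n (z k) (ω j n) →
            O j n (z k) × Inside (I m (z k)) m j n × (∀ l → l < m → ¬ Inside (I l (z k)) l j n)
          ω-nonzero e (inj₁ (_ , e')) with () ← trans (sym e) e'
          ω-nonzero {j} {n} {k} e (inj₂ (o , m' , e' , ins , min)) =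
            subst (λ m → O j n (z k) × Inside (I m (z k)) m j n × (∀ l → l < m → ¬ Inside (I l (z k)) l j n))
              (ℕₚ.suc-injective (trans (sym e') e)) (o , ins , min)

          -- Whether `ω j n` is zero decides membership for every approximation that has reached the
          -- coordinate `pair j n`.
          O-stable : ∀ {j n k l} → pair j n < k → pair j n < l → O j n (z k) → O j n (z l)
          O-stable {j} {n} {k} {l} j<k j<l o = go (ω-spec {j} {n} {k} j<k)
            where
            go : WSpec j n (z k) (ω j n) → O j n (z l)
            go (inj₁ (¬o , _)) = ⊥-elim (¬o o)
            go (inj₂ (_ , m , e , _)) = proj₁ (ω-nonzero {j} {n} {l} {m} e (ω-spec {j} {n} {l} j<l))

          inside-limit : ∀ {j n m} → ω j n ≡ suc m → Inside (ι m) m j n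
          inside-limit {j} {n} {m} e = subst (λ i → Inside i m j n) (I-z {m} {K} (s≤s (ℕₚ.m≤n+m m (pair j n))))
            (proj₁ (proj₂ (ω-nonzero {j} {n} {K} {m} e (ω-spec {j} {n} {K} (s≤s (ℕₚ.m≤m+n (pair j n) m))))))
            where
            K = suc (pair j n ℕ.+ m)

          -- Approximations within `1/suc m` of the centre only put `x` within `1/suc m + 1/suc l`
          -- of it, for every `l`; the strict inequality in `Inside` absorbs the extra term.
          inside-O : ∀ {j n m} → Inside (ι m) m j n → O j n x
          inside-O {j} {n} {m} (c , b , sc , sb , q , cb , q+ε<1/suc) = b , sb , widen small xb
            where
            c≡y : c ≡ y m
            c≡y = just-injective (trans (sym sc) (proj₂ (center m)))
            gap : ∃ λ l → (q ℚ.+ 1/suc m) ℚ.+ 1/suc l ℚ.< 1/suc n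
            gap = 1/suc-gap q+ε<1/suc
            l : ℕ
            l = proj₁ gap
            K : ∃ λ K → ∀ k → K ℕ.≤ k → d (z k) x <ᴿ 1/suc l
            K = close (1/suc l) (1/suc-positive l)
            k' : ℕ
            k' = proj₁ K ℕ.+ suc m
            xy : d x (y m) <ᴿ (1/suc l ℚ.+ 1/suc m)
            xy = tri (flip (proj₂ K k' (ℕₚ.m≤m+n (proj₁ K) (suc m)))) (near {m} {k'} (ℕₚ.m≤n+m (suc m) (proj₁ K)))
            xb : d x b <ᴿ ((1/suc l ℚ.+ 1/suc m) ℚ.+ q)
            xb = tri xy (subst (λ c → d c b <ᴿ q) c≡y cb)
            rearrange : ∀ a b c → (a ℚ.+ b) ℚ.+ c ≡ (c ℚ.+ b) ℚ.+ a
            rearrange a b c = trans (ℚₚ.+-comm (a ℚ.+ b) c) (trans (cong (c ℚ.+_) (ℚₚ.+-comm a b)) (sym (ℚₚ.+-assoc c b a)))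
            small : (1/suc l ℚ.+ 1/suc m) ℚ.+ q ℚ.< 1/suc n
            small = subst (ℚ._< 1/suc n) (rearrange q (1/suc m) (1/suc l)) (proj₂ gap)

          O-limit : ∀ {j n k} → pair j n < k → O j n (z k) → O j n x
          O-limit {j} {n} {k} lt o = go (ω-spec {j} {n} {k} lt)
            where
            go : WSpec j n (z k) (ω j n) → O j n x
            go (inj₁ (¬o , _)) = ⊥-elim (¬o o)
            go (inj₂ (_ , m , e , _)) = inside-O {j} {n} {m} (inside-limit e)

          O-approx : ∀ {j n k} → pair j n < k → O j n x → O j n (z k)
          O-approx {j} {n} {k} lt o = O-stable {j} {n} {proj₁ ev ℕ.+ k} {k} (ℕₚ.≤-trans lt (ℕₚ.m≤n+m k (proj₁ ev))) lt
            (proj₂ ev (proj₁ ev ℕ.+ k) (ℕₚ.m≤m+n (proj₁ ev) k))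
            where
            ev : ∃ λ K → ∀ k → K ℕ.≤ k → O j n (z k)
            ev = O-eventually {j} {n} o

          I-x : ∀ n → I n x ≡ ι n
          I-x n = minimum-unique {P = λ j → O j n x} (I-O n x) (I-min n x) I∈O below
            where
            late : ∀ j → I n (z (suc (n ℕ.+ pair j n))) ≡ ι n
            late j = I-z (s≤s (ℕₚ.m≤m+n n (pair j n)))
            lt : ∀ j → pair j n < suc (n ℕ.+ pair j n)
            lt j = s≤s (ℕₚ.m≤n+m (pair j n) n)
            I∈O : O (ι n) n x
            I∈O = O-limit (lt (ι n)) (subst (λ i → O i n (z (suc (n ℕ.+ pair (ι n) n)))) (late (ι n)) (I-O n _))
            below : ∀ j → j < ι n → ¬ O j n x
            below j j<ι o = I-min n (z (suc (n ℕ.+ pair j n))) j (subst (j <_) (sym (late j)) j<ι) (O-approx (lt j) o)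

          W-x : ∀ j n → W j n x ≡ ω j n
          W-x j n = W-functional (W-spec j n x) spec
            where
            spec : WSpec j n x (ω j n)
            spec = go (ω-spec {j} {n} {suc (pair j n)} ℕₚ.≤-refl)
              where
              go : WSpec j n (z (suc (pair j n))) (ω j n) → WSpec j n x (ω j n)
              go (inj₁ (¬o , ω≡0)) = inj₁ ((λ o → ¬o (O-approx ℕₚ.≤-refl o)) , ω≡0)
              go (inj₂ (o , m , ω≡ , _)) = inj₂ (O-limit ℕₚ.≤-refl o , m , ω≡ ,
                  subst (λ i → Inside i m j n) (I≡ m ℕₚ.≤-refl) (proj₁ (proj₂ approximate)) ,
                  λ k k<m ins → proj₂ (proj₂ approximate) k k<m
                    (subst (λ i → Inside i k j n) (sym (I≡ k (ℕₚ.<⇒≤ k<m))) ins))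
                where
                K = suc (pair j n ℕ.+ m)
                I≡ : ∀ k → k ℕ.≤ m → I k (z K) ≡ I k x
                I≡ k k≤m = trans (I-z (s≤s (ℕₚ.≤-trans k≤m (ℕₚ.m≤n+m m (pair j n))))) (sym (I-x k))
                approximate : O j n (z K) × Inside (I m (z K)) m j n × (∀ l → l < m → ¬ Inside (I l (z K)) l j n)
                approximate = ω-nonzero {j} {n} {K} {m} ω≡ (ω-spec {j} {n} {K} (s≤s (ℕₚ.m≤m+n (pair j n) m)))

          code-x : ∀ k → code' x k ≡ β k
          code-x k =
            let (j , n) = unpair k
                e = proj₂ (approx (suc k)) k ℕₚ.≤-refl
                kz = suc (k ℕ.+ pair j n)
                ek = proj₂ (approx kz) k (s≤s (ℕₚ.m≤m+n k (pair j n)))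
                W≡ : W j n x ≡ W j n (z kz)
                W≡ = trans (W-x j n) (sym (W-z (s≤s (ℕₚ.m≤n+m (pair j n) k))))
                I≡ : I k x ≡ I k (z kz)
                I≡ = trans (I-x k) (sym (I-z (s≤s (ℕₚ.m≤m+n k (pair j n)))))
            in trans (cong₂ pair I≡ W≡) ek

      coded : Coded X
      coded = record
        { code = code'
        ; code-injective = injective'
        ; code-closed = λ β approx → Limit.x β approx , Limit.code-x β approx }

      private
        instance
          coded-instance : Coded X
          coded-instance = coded

        OpenBorel : Pred (Pred X 0ℓ) _
        OpenBorel = σ[ IsOpen ]

        O-open : ∀ j n → IsOpen (O j n)
        O-open j n x (y , sy , xy) =
          let (q , q<1/suc , xy<q) = ℝ.rounded (d x y) xy
              (m , lt) = 1/suc-gap q<1/suc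
          in 1/suc m , 1/suc-positive m , λ w xw → y , sy ,
               widen (subst (ℚ._< 1/suc n) (ℚₚ.+-comm q (1/suc m)) lt) (tri (flip xw) xy<q)

        I-borel : ∀ n i → OpenBorel (λ x → I n x ≡ i)
        I-borel n i = resp {A = λ x → O i n x × (∀ j → j < i → ¬ O j n x)}
          ((λ {x} (o , min) → minimum-unique {P = λ j → O j n x} (I-O n x) (I-min n x) o min) ,
           λ {x} → λ { refl → I-O n x , I-min n x })
          (σ-∩ (generator (O-open i n)) (σ-⋂< i λ j → complement (generator (O-open j n))))

        Inside-borel : ∀ m j n → OpenBorel (λ x → Inside (I m x) m j n)
        Inside-borel m j n = resp {A = λ x → ∃ λ i → I m x ≡ i × Inside i m j n}
          ((λ { (i , refl , ins) → ins }) , λ ins → _ , refl , ins)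
          (σ-⋃ {I = ℕ} λ i → σ-∩ (I-borel m i) (σ-const (Inside i m j n)))

        WSpec-borel : ∀ j n v → OpenBorel (λ x → WSpec j n x v)
        WSpec-borel j n v = σ-∪ (σ-∩ (σ-∁ (generator (O-open j n))) (σ-const (v ≡ 0)))
          (σ-∩ (generator (O-open j n)) (σ-⋃ {I = ℕ} λ m → σ-∩ (σ-const (v ≡ suc m))
            (σ-∩ (Inside-borel m j n) (σ-⋂< m λ k → σ-∁ (Inside-borel k j n)))))

        W-borel : ∀ j n v → OpenBorel (λ x → W j n x ≡ v)
        W-borel j n v = resp ((λ {x} spec → W-functional (W-spec j n x) spec) , λ {x} → λ { refl → W-spec j n x })
          (WSpec-borel j n v)

        code-borel : ∀ k m → OpenBorel (λ x → code' x k ≡ m)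
        code-borel k m = resp
          {A = λ x → ∃ λ a → ∃ λ b → I k x ≡ a × W (proj₁ (unpair k)) (proj₂ (unpair k)) x ≡ b × pair a b ≡ m}
          ((λ { (a , b , refl , refl , e) → e }) , λ e → _ , _ , refl , refl , e)
          (σ-⋃ {I = ℕ} λ a → σ-⋃ {I = ℕ} λ b →
            σ-∩ (I-borel k a) (σ-∩ (W-borel _ _ b) (σ-const (pair a b ≡ m))))

        O-borel : ∀ j n → Borel (O j n)
        O-borel j n = resp (to , from) (cylinder-pred (pair j n) (λ c → proj₂ (unpair c) ≢ 0))
          where
          to : ∀ {x} → proj₂ (unpair (code' x (pair j n))) ≢ 0 → O j n x
          to {x} ne with W-spec j n x
          ... | inj₁ (_ , W≡0) = ⊥-elim (ne (trans (sym (W-code x j n)) W≡0))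
          ... | inj₂ (o , _) = o
          from : ∀ {x} → O j n x → proj₂ (unpair (code' x (pair j n))) ≢ 0
          from {x} o eq with W-spec j n x
          ... | inj₁ (¬o , _) = ¬o o
          ... | inj₂ (_ , m , W≡ , _) with () ← trans (sym W≡) (trans (W-code x j n) eq)

        open-borel : ∀ {U} → IsOpen U → Borel U
        open-borel {U} open-U = resp {A = λ x → ∃ λ j → ∃ λ n → O j n x × (∀ y → O j n y → U y)}
          ((λ (j , n , o , sub) → sub _ o) , from)
          (σ-⋃ {I = ℕ} λ j → σ-⋃ {I = ℕ} λ n → σ-∩ (O-borel j n) (σ-const _))
          where
          from : ∀ {x} → U x → ∃ λ j → ∃ λ n → O j n x × (∀ y → O j n y → U y)
          from {x} u =
            let (δ , 0<δ , sub) = open-U x u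
                (n , lt) = 1/suc-half 0<δ
                (c , sc , xc) = I-O n x
            in I n x , n , I-O n x , λ w (c' , sc' , wc') → sub w (widen lt
                 (tri xc (flip (subst (λ c → d w c <ᴿ 1/suc n) (just-injective (trans (sym sc') sc)) wc'))))

      toCoded : ∀ {A} → σ[ IsOpen ] A → Borel A
      toCoded (generator o) = open-borel o
      toCoded empty = empty
      toCoded (complement b) = complement (toCoded b)
      toCoded (union bs) = union (λ n → toCoded (bs n))
      toCoded (resp e b) = resp e (toCoded b)

      fromCoded : ∀ {A} → Borel A → σ[ IsOpen ] A
      fromCoded (generator (n , m , to , from)) = resp (from , to) (code-borel n m)
      fromCoded empty = empty
      fromCoded (complement b) = complement (fromCoded b)
      fromCoded (union bs) = union (λ n → fromCoded (bs n))
      fromCoded (resp e b) = resp e (fromCoded b)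

    module _ (V : StandardBorelSpace) where
      open StandardBorelSpace V

      standard-coded : Coded Carrier
      standard-coded = Coding.coded (proj₁ standard)

      private
        instance
          V-coded : Coded Carrier
          V-coded = standard-coded

      IsBorel⇒Borel : ∀ {A} → IsBorel A → Borel A
      IsBorel⇒Borel b = Coding.toCoded (proj₁ standard) (Equivalence.to (proj₂ standard _) b)

      Borel⇒IsBorel : ∀ {A} → Borel A → IsBorel A
      Borel⇒IsBorel b = Equivalence.from (proj₂ standard _) (Coding.fromCoded (proj₁ standard) b)

      IsBorel×⇒Borel : ∀ {A} → IsBorel× V V A → Borel A
      IsBorel×⇒Borel (generator (P , Q , p , q , to , from)) = resp (from , to)
        (σ-∩ (proj₁-measurable (IsBorel⇒Borel p)) (proj₂-measurable (IsBorel⇒Borel q)))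
      IsBorel×⇒Borel empty = empty
      IsBorel×⇒Borel (complement b) = complement (IsBorel×⇒Borel b)
      IsBorel×⇒Borel (union bs) = union (λ n → IsBorel×⇒Borel (bs n))
      IsBorel×⇒Borel (resp e b) = resp e (IsBorel×⇒Borel b)

  -- Borel combinatorics of graphs of bounded degree.

  module BorelGraphs where
    open Classical
    open BorelSets

    -- The maps `φ` come from Lusin-Novikov. They only cover the neighbours: values may repeat or
    -- fail to be neighbours.
    record BoundedGraph (V : Set) {{_ : Coded V}} (Δ : ℕ) : Set₁ where
      field
        Adj         : V → V → Set
        symmetric   : ∀ {u v} → Adj u v → Adj v u
        loopless    : ∀ {u} → ¬ Adj u u
        adj-borel   : Borel {V × V} (uncurry Adj)
        φ           : Fin Δ → V → V
        φ-measurable : ∀ i → Measurable (φ i)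
        φ-covers    : ∀ {u v} → Adj u v → ∃ λ i → φ i u ≡ v

    module _ {X : Set} {{_ : Coded X}} where

      least : (P : ℕ → Pred X 0ℓ) → X → ℕ
      least P x with em {P = ∃ λ n → P n x}
      ... | yes ∃P = proj₁ (minimum ∃P)
      ... | no  _  = 0

      least-spec : (P : ℕ → Pred X 0ℓ) → ∀ {x n} → P n x → P (least P x) x × (∀ m → m < least P x → ¬ P m x)
      least-spec P {x} p with em {P = ∃ λ n → P n x}
      ... | yes ∃P = proj₂ (minimum ∃P)
      ... | no ¬∃P = ⊥-elim (¬∃P (_ , p))

      least-unique : (P : ℕ → Pred X 0ℓ) → ∀ {x n} → P n x → (∀ m → m < n → ¬ P m x) → least P x ≡ n
      least-unique P {x} {n} p min = minimum-unique {P = λ n → P n x} (proj₁ (least-spec P p)) (proj₂ (least-spec P p)) p min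

      least-default : (P : ℕ → Pred X 0ℓ) → ∀ {x} → ¬ (∃ λ n → P n x) → least P x ≡ 0
      least-default P {x} ¬∃P with em {P = ∃ λ n → P n x}
      ... | yes ∃P = ⊥-elim (¬∃P ∃P)
      ... | no _ = refl

      least-measurable : {P : ℕ → Pred X 0ℓ} → (∀ n → Borel (P n)) → ℕ-Measurable (least P)
      least-measurable {P} b i = resp
        {A = λ x → (P i x × (∀ m → m < i → ¬ P m x)) ⊎ ((¬ ∃ λ n → P n x) × 0 ≡ i)}
        (to , from)
        (σ-∪ (σ-∩ (b i) (σ-⋂< i λ m → σ-∁ (b m))) (σ-∩ (σ-∁ (σ-⋃ {I = ℕ} b)) (σ-const (0 ≡ i))))
        where
        to : ∀ {x} → (P i x × (∀ m → m < i → ¬ P m x)) ⊎ ((¬ ∃ λ n → P n x) × 0 ≡ i) → least P x ≡ i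
        to (inj₁ (p , min)) = least-unique P p min
        to (inj₂ (¬∃P , 0≡i)) = trans (least-default P ¬∃P) 0≡i
        from : ∀ {x} → least P x ≡ i → (P i x × (∀ m → m < i → ¬ P m x)) ⊎ ((¬ ∃ λ n → P n x) × 0 ≡ i)
        from {x} refl with em {P = ∃ λ n → P n x}
        ... | yes ∃P = inj₁ (proj₂ (minimum ∃P))
        ... | no ¬∃P = inj₂ (¬∃P , refl)

      Prefix : List ℕ → ℕ → Pred X 0ℓ
      Prefix []      n x = ⊤
      Prefix (a ∷ s) n x = code x n ≡ a × Prefix s (suc n) x

      prefix-borel : ∀ s n → Borel (Prefix s n)
      prefix-borel []      n = σ-const ⊤
      prefix-borel (a ∷ s) n = σ-∩ (cylinder n a) (prefix-borel s (suc n))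

      initial : X → ℕ → ℕ → List ℕ
      initial x zero    n = []
      initial x (suc k) n = code x n ∷ initial x k (suc n)

      prefix-initial : ∀ x k n → Prefix (initial x k n) n x
      prefix-initial x zero    n = tt
      prefix-initial x (suc k) n = refl , prefix-initial x k (suc n)

      prefix-agree : ∀ {x y} k n → Prefix (initial x k n) n y → ∀ i → i < k → code y (n + i) ≡ code x (n + i)
      prefix-agree {x} {y} (suc k) n (e , p) zero _ = subst (λ j → code y j ≡ code x j) (sym (+-identityʳ n)) e
      prefix-agree {x} {y} (suc k) n (e , p) (suc i) i<k =
        subst (λ j → code y j ≡ code x j) (sym (+-suc n i)) (prefix-agree k (suc n) p i (s<s⁻¹ i<k))

      separating-depth : (x : X) (ys : List X) →
        ∃ λ k → ∀ {y} → y ∈ ys → (∀ n → n < k → code y n ≡ code x n) → y ≡ x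
      separating-depth x [] = 0 , λ ()
      separating-depth x (z ∷ ys) with separating-depth x ys | em {P = z ≡ x}
      ... | k , sep | yes z≡x = k , λ { (here refl) _ → z≡x ; (there y∈ys) agree → sep y∈ys agree }
      ... | k , sep | no z≢x with ¬∀⇒∃ {P = λ n → code z n ≡ code x n} (z≢x ∘ code-injective)
      ...   | n , differ = k ⊔ suc n , λ
        { (here refl) agree → ⊥-elim (differ (agree n (m≤n⊔m k (suc n))))
        ; (there y∈ys) agree → sep y∈ys (λ m m<k → agree m (≤-trans m<k (m≤m⊔n k (suc n)))) }

      separating-prefix : (x : X) (ys : List X) →
        ∃ λ s → Prefix s 0 x × (∀ {y} → y ∈ ys → Prefix s 0 y → y ≡ x)
      separating-prefix x ys = let (k , sep) = separating-depth x ys in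
        initial x k 0 , prefix-initial x k 0 , λ y∈ys p → sep y∈ys (prefix-agree k 0 p)

    module Graphs {V : Set} {{cV : Coded V}} {Δ : ℕ} (G : BoundedGraph V Δ) where
      open BoundedGraph G

      Ball : ℕ → V → V → Set
      Ball zero    u v = u ≡ v
      Ball (suc n) u v = ∃ λ w → (u ≡ w ⊎ Adj u w) × Ball n w v

      ball-refl : ∀ n {u} → Ball n u u
      ball-refl zero    = refl
      ball-refl (suc n) = _ , inj₁ refl , ball-refl n

      ball-trans : ∀ m {n u v w} → Ball m u v → Ball n v w → Ball (m + n) u w
      ball-trans zero    refl c = c
      ball-trans (suc m) (x , s , b) c = x , s , ball-trans m b c

      ball-mono : ∀ {m n u v} → m ≤ n → Ball m u v → Ball n u v
      ball-mono {n = n} z≤n refl = ball-refl n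
      ball-mono (s≤s m≤n) (w , s , b) = w , s , ball-mono m≤n b

      adj-ball : ∀ {u v} → Adj u v → Ball 1 u v
      adj-ball a = _ , inj₂ a , refl

      ball-sym : ∀ n {u v} → Ball n u v → Ball n v u
      ball-sym zero    refl = refl
      ball-sym (suc n) {u} {v} (w , s , b) = subst (λ k → Ball k v u) (+-comm n 1) (ball-trans n (ball-sym n b) (w⇒u s))
        where
        w⇒u : u ≡ w ⊎ Adj u w → Ball 1 w u
        w⇒u (inj₁ refl) = ball-refl 1
        w⇒u (inj₂ a)    = adj-ball (symmetric a)

      neighbours : V → List V
      neighbours u = tabulate (λ i → φ i u)

      ∈-neighbours : ∀ {u v} → Adj u v → v ∈ neighbours u
      ∈-neighbours {u} a with φ-covers a
      ... | i , refl = ∈-tabulate⁺ i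

      ball-list : ∀ n u → ∃ λ (vs : List V) → ∀ {v} → Ball n u v → v ∈ vs
      ball-list zero    u = u ∷ [] , λ { refl → here refl }
      ball-list (suc n) u = concatMap (proj₁ ∘ ball-list n) (u ∷ neighbours u) , λ (w , s , b) →
        ∈-concatMap⁺ (proj₁ ∘ ball-list n) (lose (step s) (proj₂ (ball-list n w) b))
        where
        step : ∀ {w} → u ≡ w ⊎ Adj u w → w ∈ u ∷ neighbours u
        step (inj₁ refl) = here refl
        step (inj₂ a)    = there (∈-neighbours a)

      module _ {X : Set} {{_ : Coded X}} {f : X → V} (f-measurable : Measurable f) where

        Adj-Borel : {g : X → V} → Measurable g → Borel (λ x → Adj (f x) (g x))
        Adj-Borel mg = ⟨ f-measurable , mg ⟩-measurable adj-borel

        ∃Adj-borel : {P : Pred (X × V) 0ℓ} → Borel P → Borel (λ x → ∃ λ v → Adj (f x) v × P (x , v))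
        ∃Adj-borel {P} b = resp
          {A = λ x → ∃ λ i → Adj (f x) (φ i (f x)) × P (x , φ i (f x))}
          ((λ (i , a , p) → _ , a , p) , from)
          (σ-Fin∃ λ i → let m = ∘-measurable (φ-measurable i) f-measurable in
            σ-∩ (Adj-Borel m) (⟨ id-measurable , m ⟩-measurable b))
          where
          from : ∀ {x} → ∃ (λ v → Adj (f x) v × P (x , v)) → ∃ λ i → Adj (f x) (φ i (f x)) × P (x , φ i (f x))
          from (v , a , p) with φ-covers a
          ... | i , refl = i , a , p

      ∃Ball-borel : ∀ n {X : Set} {{_ : Coded X}} {f : X → V} → Measurable f → {P : Pred (X × V) 0ℓ} → Borel P →
        Borel (λ x → ∃ λ v → Ball n (f x) v × P (x , v))
      ∃Ball-borel zero {f = f} mf {P} b = resp ((λ p → _ , refl , p) , λ { (_ , refl , p) → p })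
        (⟨ id-measurable , mf ⟩-measurable b)
      ∃Ball-borel (suc n) {X} {f = f} mf {P} b = resp
        {A = λ x → (∃ λ v → Ball n (f x) v × P (x , v)) ⊎ (∃ λ w → Adj (f x) w × ∃ λ v → Ball n w v × P (x , v))}
        ((λ { (inj₁ (v , d , p)) → v , (_ , inj₁ refl , d) , p
            ; (inj₂ (w , a , v , d , p)) → v , (w , inj₂ a , d) , p }) ,
         λ { (v , (_ , inj₁ refl , d) , p) → inj₁ (v , d , p)
           ; (v , (w , inj₂ a , d) , p) → inj₂ (w , a , v , d , p) })
        (σ-∪ (∃Ball-borel n mf b)
             (∃Adj-borel mf (∃Ball-borel n {X × V} proj₂-measurable
               {λ ((x , _) , v) → P (x , v)}
               (⟨ ∘-measurable proj₁-measurable proj₁-measurable , proj₂-measurable ⟩-measurable b))))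

      ∃-borel : ∀ n {X : Set} {{_ : Coded X}} {f : X → V} → Measurable f → {P : Pred (X × V) 0ℓ} →
        (∀ {x v} → P (x , v) → Ball n (f x) v) → Borel P → Borel (λ x → ∃ λ v → P (x , v))
      ∃-borel n mf local b = resp ((λ (v , _ , p) → v , p) , λ (v , p) → v , local p , p) (∃Ball-borel n mf b)

      Ball-Borel : ∀ n {X : Set} {{_ : Coded X}} {f g : X → V} → Measurable f → Measurable g →
        Borel (λ x → Ball n (f x) (g x))
      Ball-Borel n {X} {f = f} {g} mf mg = resp {A = λ x → ∃ λ v → Ball n (f x) v × v ≡ g x}
        ((λ { (_ , d , refl) → d }) , λ d → _ , d , refl)
        (∃Ball-borel n mf (≡-Borel proj₂-measurable (∘-measurable mg proj₁-measurable)))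

      private
        step : Fin (suc Δ) → V → V
        step zero    v = v
        step (suc i) v = φ i v

        walk : List (Fin (suc Δ)) → V → V
        walk []      v = v
        walk (i ∷ w) v = walk w (step i v)

        walk-measurable : ∀ w → Measurable (walk w)
        walk-measurable [] = id-measurable
        walk-measurable (zero ∷ w) b = walk-measurable w b
        walk-measurable (suc i ∷ w) b = φ-measurable i (walk-measurable w b)

        walk-covers : ∀ n {u v} → Ball n u v → ∃ λ w → walk w u ≡ v
        walk-covers zero    refl = [] , refl
        walk-covers (suc n) (_ , inj₁ refl , b) = walk-covers n b
        walk-covers (suc n) (_ , inj₂ a , b) with φ-covers a | walk-covers n b
        ... | i , refl | w , eq = suc i ∷ w , eq

      -- Every vertex at finite distance is the end of a walk, a finite word in the measurable maps
      -- `φ`. There are countably many words, and `g` follows the first that leads into `R`; its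
      -- definition involves no bound on the distance.
      select : ∀ {X : Set} {{_ : Coded X}} {f : X → V} → Measurable f → {R : Pred (X × V) 0ℓ} → Borel R →
        ∃ λ (g : X → V) → Measurable g × (∀ n {x v} → Ball n (f x) v → R (x , v) → R (x , g x))
      select {X} {f} mf {R} b = g , g-measurable , spec
        where
        P : ℕ → Pred X 0ℓ
        P m x = R (x , walk (enum m) (f x))
        g : X → V
        g x = walk (enum (least P x)) (f x)
        m-measurable : ∀ m → Measurable (λ x → walk (enum m) (f x))
        m-measurable m = ∘-measurable (walk-measurable (enum m)) mf
        g-measurable : Measurable g
        g-measurable {A} a = ℕ-measurable-pred
          (least-measurable {P = P} λ m → ⟨ id-measurable , m-measurable m ⟩-measurable b)
          (λ m x → A (walk (enum m) (f x))) (λ m → m-measurable m a)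
        spec : ∀ n {x v} → Ball n (f x) v → R (x , v) → R (x , g x)
        spec n {x} {v} d r with walk-covers n d
        ... | w , eq = proj₁ (least-spec P {x} {index w}
          (subst (λ w → R (x , walk w (f x))) (sym (enum-index w)) (subst (λ v → R (x , v)) (sym eq) r)))

      -- Balls are finite, so some finite prefix of the code of `x` belongs to no other vertex of
      -- the `N`-ball. The first such word is the colour.
      countable-colouring : ∀ N → ∃ λ (c : V → ℕ) → ℕ-Measurable c × (∀ {u v} → Ball N u v → c u ≡ c v → u ≡ v)
      countable-colouring N = c , least-measurable Isolated-borel , proper
        where
        Isolated : ℕ → Pred V 0ℓ
        Isolated m x = Prefix (enum m) 0 x × ¬ ∃ λ y → Ball N x y × y ≢ x × Prefix (enum m) 0 y
        Isolated-borel : ∀ m → Borel (Isolated m)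
        Isolated-borel m = σ-∩ (prefix-borel (enum m) 0) (σ-∁ (∃Ball-borel N id-measurable
          (σ-∩ (σ-∁ (≡-Borel proj₂-measurable proj₁-measurable)) (proj₂-measurable (prefix-borel (enum m) 0)))))
        c : V → ℕ
        c = least Isolated
        isolated : ∀ x → Isolated (c x) x
        isolated x = let (s , p , sep) = separating-prefix x (proj₁ (ball-list N x)) in
          proj₁ (least-spec Isolated {x} {index s} (subst (λ s → Prefix s 0 x × ¬ ∃ λ y → Ball N x y × y ≢ x × Prefix s 0 y)
            (sym (enum-index s)) (p , λ (y , d , y≢x , q) → y≢x (sep (proj₂ (ball-list N x) d) q))))
        proper : ∀ {u v} → Ball N u v → c u ≡ c v → u ≡ v
        proper {u} {v} d eq = dne λ u≢v → proj₂ (isolated u)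
          (v , d , (λ v≡u → u≢v (sym v≡u)) , subst (λ m → Prefix (enum m) 0 v) (sym eq) (proj₁ (isolated v)))

      -- Greedy choice along the countable colouring: distinct vertices of one colour are never
      -- within distance `N`, so a whole colour class can be decided at once.
      maximal-independent : ∀ N {S : Pred V 0ℓ} → Borel S → ∃ λ (I : Pred V 0ℓ) → Borel I × (∀ {v} → I v → S v) ×
        (∀ {u v} → I u → I v → Ball N u v → u ≡ v) × (∀ {v} → S v → ∃ λ u → I u × Ball N v u)
      maximal-independent N {S} S-borel = (λ v → ∃ λ n → Chosen n v) , σ-⋃ {I = ℕ} Chosen-borel ,
        (λ (n , ch) → proj₁ (chosen-early n ch)) , independent , maximal
        where
        colouring = countable-colouring N
        c = proj₁ colouring
        Chosen : ℕ → Pred V 0ℓ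
        Chosen zero    v = ⊥
        Chosen (suc n) v = Chosen n v ⊎ (S v × c v ≡ n × ¬ ∃ λ w → Ball N v w × Chosen n w)
        Chosen-borel : ∀ n → Borel (Chosen n)
        Chosen-borel zero    = σ-const ⊥
        Chosen-borel (suc n) = σ-∪ (Chosen-borel n) (σ-∩ S-borel (σ-∩ (proj₁ (proj₂ colouring) n)
          (σ-∁ (∃Ball-borel N id-measurable (proj₂-measurable (Chosen-borel n))))))
        chosen-early : ∀ n {v} → Chosen n v → S v × c v < n × ¬ ∃ λ w → Ball N v w × Chosen (c v) w
        chosen-early (suc n) (inj₁ ch) = let (s , c<n , none) = chosen-early n ch in s , m<n⇒m<1+n c<n , none
        chosen-early (suc n) (inj₂ (s , refl , none)) = s , ≤-refl , none
        chosen-mono : ∀ {m n v} → m ≤ n → Chosen m v → Chosen n v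
        chosen-mono {m} {n} m≤n ch with m≤n⇒m<n∨m≡n m≤n
        ... | inj₂ refl = ch
        chosen-mono {m} {suc n} _ ch | inj₁ m<n = inj₁ (chosen-mono (s≤s⁻¹ m<n) ch)
        now : ∀ n {v} → Chosen n v → Chosen (suc (c v)) v
        now (suc n) (inj₁ ch) = now n ch
        now (suc n) (inj₂ (s , refl , none)) = inj₂ (s , refl , none)
        independent : ∀ {u v} → ∃ (λ n → Chosen n u) → ∃ (λ n → Chosen n v) → Ball N u v → u ≡ v
        independent {u} {v} (m , chu) (n , chv) d with <-cmp (c u) (c v)
        ... | tri< lt _ _ = ⊥-elim (proj₂ (proj₂ (chosen-early n chv)) (u , ball-sym N d , chosen-mono lt (now m chu)))
        ... | tri≈ _ eq _ = proj₂ (proj₂ colouring) d eq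
        ... | tri> _ _ gt = ⊥-elim (proj₂ (proj₂ (chosen-early m chu)) (v , d , chosen-mono gt (now n chv)))
        maximal : ∀ {v} → S v → ∃ λ u → (∃ λ n → Chosen n u) × Ball N v u
        maximal {v} s with em {P = ∃ λ w → Ball N v w × Chosen (c v) w}
        ... | yes (w , d , ch) = w , (_ , ch) , d
        ... | no none = v , (suc (c v) , inj₂ (s , refl , none)) , ball-refl N

      -- Binary constraint satisfaction on a graph with finite components: every finite
      -- assignment is induced by one of countably many Borel labelings, and each component
      -- uses the first of these that solves its constraints.
      module _ {k : ℕ} {{_ : Countable (Fin k)}} (default : Fin k) (N : ℕ) (Allowed : Fin k → Pred V 0ℓ) (allowed-borel : ∀ i → Borel (Allowed i))
        (Forbidden : Fin k → Fin k → V → V → Set)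
        (forbidden-borel : ∀ i j → Borel {V × V} (uncurry (Forbidden i j)))
        (local : ∀ {i j u v} → Forbidden i j u v → Ball N u v) where

        Linked : V → V → Set
        Linked u v = ∃ λ i → ∃ λ j → Forbidden i j u v ⊎ Forbidden j i v u

        private
          candidate : List (List ℕ × Fin k) → V → Fin k
          candidate []            v = default
          candidate ((s , i) ∷ L) v with em {P = Prefix s 0 v}
          ... | yes _ = i
          ... | no  _ = candidate L v

          candidate-measurable : ∀ L → ℕ-Measurable (candidate L)
          candidate-measurable []            i = σ-const (default ≡ i)
          candidate-measurable ((s , j) ∷ L) i = resp
            {A = λ v → (Prefix s 0 v × j ≡ i) ⊎ (¬ Prefix s 0 v × candidate L v ≡ i)}
            (to , from)
            (σ-∪ (σ-∩ (prefix-borel s 0) (σ-const (j ≡ i))) (σ-∩ (σ-∁ (prefix-borel s 0)) (candidate-measurable L i)))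
            where
            to : ∀ {v} → (Prefix s 0 v × j ≡ i) ⊎ (¬ Prefix s 0 v × candidate L v ≡ i) → candidate ((s , j) ∷ L) v ≡ i
            to {v} h with em {P = Prefix s 0 v} | h
            ... | yes p | inj₁ (_ , e) = e
            ... | yes p | inj₂ (¬p , _) = ⊥-elim (¬p p)
            ... | no ¬p | inj₁ (p , _) = ⊥-elim (¬p p)
            ... | no ¬p | inj₂ (_ , e) = e
            from : ∀ {v} → candidate ((s , j) ∷ L) v ≡ i → (Prefix s 0 v × j ≡ i) ⊎ (¬ Prefix s 0 v × candidate L v ≡ i)
            from {v} e with em {P = Prefix s 0 v}
            ... | yes p = inj₁ (p , e)
            ... | no ¬p = inj₂ (¬p , e)

          realize : (xs ys : List V) → (∀ {y} → y ∈ ys → y ∈ xs) → (a : V → Fin k) →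
            ∃ λ L → ∀ {y} → y ∈ ys → candidate L y ≡ a y
          realize xs []       sub a = [] , λ ()
          realize xs (y ∷ ys) sub a with separating-prefix y xs | realize xs ys (sub ∘ there) a
          ... | s , p , sep | L , ok = (s , a y) ∷ L , go
            where
            go : ∀ {z} → z ∈ y ∷ ys → candidate ((s , a y) ∷ L) z ≡ a z
            go {z} z∈ with em {P = Prefix s 0 z}
            ... | yes pz = cong a (sym (sep (sub z∈) pz))
            go (here refl)  | no ¬pz = ⊥-elim (¬pz p)
            go (there z∈ys) | no ¬pz = ok z∈ys

          Bad : List (List ℕ × Fin k) → Pred V 0ℓ
          Bad L u = ¬ Allowed (candidate L u) u ⊎
            ∃ λ v → Ball N u v × Forbidden (candidate L u) (candidate L v) u v

          Bad-borel : ∀ L → Borel (Bad L)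
          Bad-borel L = σ-∪
            (σ-∁ (ℕ-measurable-pred (candidate-measurable L) Allowed allowed-borel))
            (∃Ball-borel N id-measurable
              (ℕ-measurable-pred (λ i → proj₁-measurable (candidate-measurable L i))
                (λ i (u , v) → Forbidden i (candidate L v) u v)
                (λ i → ℕ-measurable-pred (λ j → proj₂-measurable (candidate-measurable L j))
                  (λ j (u , v) → Forbidden i j u v) (λ j → forbidden-borel i j))))

          Reach : List (List ℕ × Fin k) → ℕ → Pred V 0ℓ
          Reach L zero    u = Bad L u
          Reach L (suc k) u = ∃ λ v → Ball N u v × Linked u v × Reach L k v

          Linked-borel : Borel {V × V} (uncurry Linked)
          Linked-borel = σ-Fin∃ λ i → σ-Fin∃ λ j → σ-∪ (forbidden-borel i j)
            (⟨ proj₂-measurable , proj₁-measurable ⟩-measurable (forbidden-borel j i))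

          Reach-borel : ∀ L k → Borel (Reach L k)
          Reach-borel L zero    = Bad-borel L
          Reach-borel L (suc k) = ∃Ball-borel N id-measurable (σ-∩ Linked-borel (proj₂-measurable (Reach-borel L k)))

          -- The condition concerns the whole linked component of `u` and is constant on it. Hence
          -- all vertices of a component choose the same candidate, although each chooses for
          -- itself.
          Good : ℕ → Pred V 0ℓ
          Good m u = ¬ ∃ λ k → Reach (enum m) k u

          choice : V → ℕ
          choice = least Good

          linked-sym : ∀ {u v} → Linked u v → Linked v u
          linked-sym (i , j , inj₁ f) = j , i , inj₂ f
          linked-sym (i , j , inj₂ f) = j , i , inj₁ f

          linked-local : ∀ {u v} → Linked u v → Ball N u v
          linked-local (i , j , inj₁ f) = local f
          linked-local (i , j , inj₂ f) = ball-sym N (local f)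

          good-linked : ∀ {m u v} → Linked u v → Good m u → Good m v
          good-linked l g (k , r) = g (suc k , _ , linked-local l , l , r)

          reach-star : ∀ {L} k {u} → Reach L k u → ∃ λ v → Star Linked u v × Bad L v
          reach-star zero    b = _ , ε , b
          reach-star (suc k) (v , _ , l , r) = let (w , s , b) = reach-star k r in w , l ◅ s , b

        component-solution :
          (∀ v → ∃ λ (xs : List V) → ∀ {w} → Star Linked v w → w ∈ xs) →
          (∀ v → ∃ λ (a : V → Fin k) → (∀ {u} → Star Linked v u → Allowed (a u) u) ×
            (∀ {u w} → Star Linked v u → Star Linked v w → ¬ Forbidden (a u) (a w) u w)) →
          ∃ λ (f : V → Fin k) → ℕ-Measurable f × (∀ v → Allowed (f v) v) ×
            (∀ {u v} → ¬ Forbidden (f u) (f v) u v)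
        component-solution finite solvable = f , f-measurable , allowed , respects
          where
          f : V → Fin k
          f v = candidate (enum (choice v)) v
          f-measurable : ℕ-Measurable f
          f-measurable i = ℕ-measurable-pred
            (least-measurable {P = Good} λ m → σ-∁ (σ-⋃ {I = ℕ} (Reach-borel (enum m))))
            (λ m v → candidate (enum m) v ≡ i) (λ m → candidate-measurable (enum m) i)
          good : ∀ v → Good (choice v) v
          good v = proj₁ (least-spec Good {v} {index (proj₁ list)}
            (subst (λ L → ¬ ∃ λ k → Reach L k v) (sym (enum-index (proj₁ list))) none))
            where
            a = proj₁ (solvable v)
            list : ∃ λ L → ∀ {y} → y ∈ proj₁ (finite v) → candidate L y ≡ a y
            list = realize (proj₁ (finite v)) (proj₁ (finite v)) id a
            agrees : ∀ {u} → Star Linked v u → candidate (proj₁ list) u ≡ a u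
            agrees s = proj₂ list (proj₂ (finite v) s)
            not-bad : ∀ {u} → Star Linked v u → ¬ Bad (proj₁ list) u
            not-bad {u} s (inj₁ ¬a) = ¬a (subst (λ i → Allowed i u) (sym (agrees s)) (proj₁ (proj₂ (solvable v)) s))
            not-bad {u} s (inj₂ (w , _ , forb)) =
              let s' = s ◅◅ ((_ , _ , inj₁ forb) ◅ ε) in
              proj₂ (proj₂ (solvable v)) s s' (subst₂ (λ i j → Forbidden i j u w) (agrees s) (agrees s') forb)
            none : ¬ ∃ λ k → Reach (proj₁ list) k v
            none (k , r) = let (u , s , b) = reach-star k r in not-bad s b
          choice-linked : ∀ {u v} → Linked u v → choice u ≡ choice v
          choice-linked {u} {v} l = least-unique Good (good-linked (linked-sym l) (good v))
            λ m m<c g → proj₂ (least-spec Good (good v)) m m<c (good-linked l g)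
          allowed : ∀ v → Allowed (f v) v
          allowed v = dne λ ¬a → good v (0 , inj₁ ¬a)
          respects : ∀ {u v} → ¬ Forbidden (f u) (f v) u v
          respects {u} {v} forb = good u (0 , inj₂ (v , local forb , subst
            (λ m → Forbidden (f u) (candidate (enum m) v) u v) (sym (choice-linked {u} {v} (_ , _ , inj₁ forb))) forb))

  -- Independent transversals of finite systems with bounded conflicts.

  module FiniteTransversal where
    open Classical
    open import Data.Nat.Solver using (module +-*-Solver)
    open import Data.Vec.Base using (Vec; []; _∷_; lookup; _[_]≔_)
    open import Data.Vec.Properties using (lookup∘update′)

    𝟙 : Set → ℕ
    𝟙 P with em {P = P}
    ... | yes _ = 1
    ... | no  _ = 0

    𝟙-yes : ∀ {P} → P → 𝟙 P ≡ 1
    𝟙-yes {P} p with em {P = P}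
    ... | yes _ = refl
    ... | no ¬p = ⊥-elim (¬p p)

    𝟙-no : ∀ {P} → ¬ P → 𝟙 P ≡ 0
    𝟙-no {P} ¬p with em {P = P}
    ... | yes p = ⊥-elim (¬p p)
    ... | no _ = refl

    𝟙-mono : ∀ {P Q} → (P → Q) → 𝟙 P ≤ 𝟙 Q
    𝟙-mono {P} {Q} f with em {P = P}
    ... | yes p = ≤-reflexive (sym (𝟙-yes (f p)))
    ... | no _ = z≤n

    𝟙-cong : ∀ {P Q} → (P → Q) → (Q → P) → 𝟙 P ≡ 𝟙 Q
    𝟙-cong f g = ≤-antisym (𝟙-mono f) (𝟙-mono g)

    𝟙-× : ∀ {P Q} → 𝟙 (P × Q) ≡ 𝟙 P * 𝟙 Q
    𝟙-× {P} {Q} with em {P = P}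
    ... | no ¬p = 𝟙-no (¬p ∘ proj₁)
    ... | yes p = trans (𝟙-cong proj₂ (p ,_)) (sym (*-identityˡ (𝟙 Q)))

    ∑ : ∀ {m} → (Fin m → ℕ) → ℕ
    ∑ {zero}  f = 0
    ∑ {suc m} f = f zero + ∑ (f ∘ suc)

    ∑-mono : ∀ {m} {f g : Fin m → ℕ} → (∀ i → f i ≤ g i) → ∑ f ≤ ∑ g
    ∑-mono {zero}  h = z≤n
    ∑-mono {suc m} h = +-mono-≤ (h zero) (∑-mono (h ∘ suc))

    ∑-cong : ∀ {m} {f g : Fin m → ℕ} → (∀ i → f i ≡ g i) → ∑ f ≡ ∑ g
    ∑-cong {zero}  h = refl
    ∑-cong {suc m} h = cong₂ _+_ (h zero) (∑-cong (h ∘ suc))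

    ∑-+ : ∀ {m} (f g : Fin m → ℕ) → ∑ (λ i → f i + g i) ≡ ∑ f + ∑ g
    ∑-+ {zero}  f g = refl
    ∑-+ {suc m} f g = trans (cong (f zero + g zero +_) (∑-+ (f ∘ suc) (g ∘ suc)))
      (solve 4 (λ a b c d → a :+ b :+ (c :+ d) := a :+ c :+ (b :+ d)) refl (f zero) (g zero) (∑ (f ∘ suc)) (∑ (g ∘ suc)))
      where open +-*-Solver

    ∑-* : ∀ {m} c (f : Fin m → ℕ) → ∑ (λ i → c * f i) ≡ c * ∑ f
    ∑-* {zero}  c f = sym (*-zeroʳ c)
    ∑-* {suc m} c f = trans (cong (c * f zero +_) (∑-* c (f ∘ suc))) (sym (*-distribˡ-+ c (f zero) _))

    ∑-const : ∀ m c → ∑ {m} (λ _ → c) ≡ m * c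
    ∑-const zero    c = refl
    ∑-const (suc m) c = cong (c +_) (∑-const m c)

    ∑-0 : ∀ {m} {f : Fin m → ℕ} → (∀ i → f i ≡ 0) → ∑ f ≡ 0
    ∑-0 {m} h = trans (∑-cong h) (trans (∑-const m 0) (*-zeroʳ m))

    ∑-single : ∀ {m} (i : Fin m) (f : Fin m → ℕ) → (∀ j → j ≢ i → f j ≡ 0) → ∑ f ≡ f i
    ∑-single zero    f h = trans (cong (f zero +_) (∑-0 (λ j → h (suc j) λ ()))) (+-identityʳ (f zero))
    ∑-single (suc i) f h = cong₂ _+_ (h zero λ ()) (∑-single i (f ∘ suc) (λ j j≢i → h (suc j) (j≢i ∘ suc-injectiveᶠ)))

    total : ∀ {m} n → (Vec (Fin m) n → ℕ) → ℕ
    total zero    F = F []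
    total (suc n) F = ∑ λ i → total n (λ a → F (i ∷ a))

    total-mono : ∀ {m} n {F G : Vec (Fin m) n → ℕ} → (∀ a → F a ≤ G a) → total n F ≤ total n G
    total-mono zero    h = h []
    total-mono (suc n) h = ∑-mono λ i → total-mono n (λ a → h (i ∷ a))

    total-cong : ∀ {m} n {F G : Vec (Fin m) n → ℕ} → (∀ a → F a ≡ G a) → total n F ≡ total n G
    total-cong zero    h = h []
    total-cong (suc n) h = ∑-cong λ i → total-cong n (λ a → h (i ∷ a))

    total-+ : ∀ {m} n (F G : Vec (Fin m) n → ℕ) → total n (λ a → F a + G a) ≡ total n F + total n G
    total-+ zero    F G = refl
    total-+ (suc n) F G = trans (∑-cong (λ i → total-+ n (λ a → F (i ∷ a)) (λ a → G (i ∷ a))))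
      (∑-+ (λ i → total n (λ a → F (i ∷ a))) (λ i → total n (λ a → G (i ∷ a))))

    total-0 : ∀ {m} n → total {m} n (λ _ → 0) ≡ 0
    total-0 zero    = refl
    total-0 {m} (suc n) = ∑-0 {m} {λ _ → total n (λ _ → 0)} (λ _ → total-0 n)

    total-positive : ∀ {m} n (F : Vec (Fin m) n → ℕ) → 0 < total n F → ∃ λ a → 0 < F a
    total-positive n F 0<t = dne λ ¬∃ → <-irrefl (sym (trans
      (total-cong n (λ a → n≤0⇒n≡0 (≮⇒≥ λ 0<F → ¬∃ (a , 0<F)))) (total-0 n))) 0<t

    total-one : ∀ {m} → 1 ≤ m → ∀ n → 1 ≤ total {m} n (λ _ → 1)
    total-one (s≤s _) zero    = ≤-refl
    total-one 1≤m@(s≤s _) (suc n) = ≤-trans (total-one 1≤m n) (m≤m+n _ _)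

    Independent : ∀ {m n} → Fin n → (Vec (Fin m) n → ℕ) → Set
    Independent z F = ∀ a j → F (a [ z ]≔ j) ≡ F a

    -- All `m` values of a coordinate that `F` ignores contribute equally.
    total-fix : ∀ {m} n (z : Fin n) (i : Fin m) (F : Vec (Fin m) n → ℕ) → Independent z F →
      m * total n (λ a → 𝟙 (lookup a z ≡ i) * F a) ≡ total n F
    total-fix {m} (suc n) zero i F ind = begin
      m * ∑ (λ j → total n (λ a → 𝟙 (j ≡ i) * F (j ∷ a)))
        ≡⟨ cong (m *_) (∑-single i _ λ j j≢i → trans (total-cong n (λ a → cong (_* F (j ∷ a)) (𝟙-no j≢i))) (total-0 n)) ⟩
      m * total n (λ a → 𝟙 (i ≡ i) * F (i ∷ a))
        ≡⟨ cong (m *_) (total-cong n (λ a → trans (cong (_* F (i ∷ a)) (𝟙-yes refl)) (*-identityˡ _))) ⟩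
      m * total n (λ a → F (i ∷ a))
        ≡⟨ sym (∑-const m _) ⟩
      ∑ {m} (λ j → total n (λ a → F (i ∷ a)))
        ≡⟨ ∑-cong (λ j → total-cong n (λ a → ind (j ∷ a) i)) ⟩
      ∑ (λ j → total n (λ a → F (j ∷ a))) ∎
      where open ≡-Reasoning
    total-fix {m} (suc n) (suc z) i F ind = trans
      (sym (∑-* m (λ j → total n (λ a → 𝟙 (lookup a z ≡ i) * F (j ∷ a)))))
      (∑-cong λ j → total-fix n z i (λ a → F (j ∷ a)) (λ a k → ind (j ∷ a) k))

    ∑ᴸ : {A : Set} → List A → (A → ℕ) → ℕ
    ∑ᴸ []       f = 0
    ∑ᴸ (x ∷ xs) f = f x + ∑ᴸ xs f

    ∑ᴸ-∈ : {A : Set} {xs : List A} {x : A} (f : A → ℕ) → x ∈ xs → f x ≤ ∑ᴸ xs f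
    ∑ᴸ-∈ f (here refl) = m≤m+n _ _
    ∑ᴸ-∈ {xs = y ∷ _} f (there x∈) = ≤-trans (∑ᴸ-∈ f x∈) (m≤n+m _ (f y))

    total-∑ᴸ : ∀ {m} n {A : Set} (xs : List A) (f : A → Vec (Fin m) n → ℕ) →
      total n (λ a → ∑ᴸ xs (λ x → f x a)) ≡ ∑ᴸ xs (λ x → total n (f x))
    total-∑ᴸ n []       f = total-0 n
    total-∑ᴸ n (x ∷ xs) f = trans (total-+ n (f x) (λ a → ∑ᴸ xs (λ y → f y a))) (cong (total n (f x) +_) (total-∑ᴸ n xs f))

    ∑ᴸ-bound : {A : Set} (xs : List A) (f : A → ℕ) (c b : ℕ) → (∀ x → c * f x ≤ b) → c * ∑ᴸ xs f ≤ length xs * b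
    ∑ᴸ-bound []       f c b h = ≤-reflexive (*-zeroʳ c)
    ∑ᴸ-bound (x ∷ xs) f c b h = ≤-trans (≤-reflexive (*-distribˡ-+ c (f x) _)) (+-mono-≤ (h x) (∑ᴸ-bound xs f c b h))

    -- Rosenfeld's counting argument: adding a group keeps at least half of the valid assignments.
    module _ {n m κ : ℕ} (C : Fin n → Fin m → Fin n → Fin m → Set)
      (conflict-sym : ∀ {x i y j} → C x i y j → C y j x i)
      (conflicts : ∀ x i → ∃ λ (ys : List (Fin n × Fin m)) → length ys ≤ κ × (∀ {y j} → C x i y j → (y , j) ∈ ys))
      (4κ≤m : 4 * κ ≤ m) (1≤m : 1 ≤ m) where

      private
        Valid : List (Fin n) → Vec (Fin m) n → Set
        Valid T a = ∀ x y → x ∈ T → y ∈ T → x ≢ y → ¬ C x (lookup a x) y (lookup a y)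

        count : List (Fin n) → ℕ
        count T = total n (λ a → 𝟙 (Valid T a))

        valid-independent : ∀ {z} T → z ∉ T → Independent z (λ a → 𝟙 (Valid T a))
        valid-independent {z} T z∉T a j = 𝟙-cong
          (λ v x y x∈ y∈ x≢y c → v x y x∈ y∈ x≢y (subst₂ (λ i k → C x i y k) (sym (same x∈)) (sym (same y∈)) c))
          (λ v x y x∈ y∈ x≢y c → v x y x∈ y∈ x≢y (subst₂ (λ i k → C x i y k) (same x∈) (same y∈) c))
          where
          same : ∀ {x} → x ∈ T → lookup (a [ z ]≔ j) x ≡ lookup a x
          same {x} x∈ = lookup∘update′ (λ { refl → z∉T x∈ }) a j

        edges : Fin n → List (Fin m × (Fin n × Fin m))
        edges z = concatMap (λ i → map (i ,_) (proj₁ (conflicts z i))) (allFin m)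

        edges-length : ∀ z → length (edges z) ≤ m * κ
        edges-length z = subst (λ k → length (edges z) ≤ k * κ) (length-allFin m) (go (allFin m))
          where
          length-allFin : ∀ m → length (allFin m) ≡ m
          length-allFin m = length-tabulate {n = m} id
          go : ∀ is → length (concatMap (λ i → map (i ,_) (proj₁ (conflicts z i))) is) ≤ length is * κ
          go []       = z≤n
          go (i ∷ is) = ≤-trans (≤-reflexive (trans (length-++ (map (i ,_) (proj₁ (conflicts z i))))
              (cong (_+ _) (length-map (i ,_) (proj₁ (conflicts z i))))))
            (+-mono-≤ (proj₁ (proj₂ (conflicts z i))) (go is))

        _∖_ : List (Fin n) → Fin n → List (Fin n)
        T ∖ y = filter (λ x → ¬? (x ≟ᶠ y)) T

        ∖-⊆ : ∀ {T y x} → x ∈ T ∖ y → x ∈ T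
        ∖-⊆ {T} {y} x∈ = proj₁ (∈-filter⁻ (λ x → ¬? (x ≟ᶠ y)) {xs = T} x∈)

        ∖-∉ : ∀ {T y} → y ∉ T ∖ y
        ∖-∉ {T} {y} y∈ = proj₂ (∈-filter⁻ (λ x → ¬? (x ≟ᶠ y)) {xs = T} y∈) refl

        ∈-∖ : ∀ {T y x} → x ∈ T → x ∈ y ∷ (T ∖ y)
        ∈-∖ {T} {y} {x} x∈ with x ≟ᶠ y
        ... | yes refl = here refl
        ... | no x≢y = there (∈-filter⁺ (λ x → ¬? (x ≟ᶠ y)) x∈ x≢y)

        -- Validity is required only after the removal of `y`. This leaves both coordinates `z` and
        -- `y` free, so that prescribing them divides the count by `m * m`.
        Clash : List (Fin n) → Fin n → Fin m × (Fin n × Fin m) → Vec (Fin m) n → Set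
        Clash T z (i , y , j) a = y ∈ T × (lookup a z ≡ i × (lookup a y ≡ j × Valid (T ∖ y) a))

        pointwise : ∀ T z a → 𝟙 (Valid T a) ≤ 𝟙 (Valid (z ∷ T) a) + ∑ᴸ (edges z) (λ e → 𝟙 (Clash T z e a))
        pointwise T z a with em {P = Valid (z ∷ T) a}
        ... | yes v = ≤-trans (𝟙-mono {Q = Valid (z ∷ T) a} (λ _ → v))
                        (≤-trans (≤-reflexive (𝟙-yes v)) (m≤m+n 1 _))
        ... | no ¬v with em {P = Valid T a}
        ...   | no _ = z≤n
        ...   | yes v = ≤-trans (≤-reflexive (sym (𝟙-yes (proj₂ clash)))) (≤-trans (∑ᴸ-∈ (λ e → 𝟙 (Clash T z e a)) e∈) (m≤n+m _ 0))
          where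
          witness : ∃ λ y → y ∈ T × C z (lookup a z) y (lookup a y)
          witness = dne λ none → ¬v λ
            { _ _ (here refl) (here refl) x≢y _ → x≢y refl
            ; _ _ (here refl) (there y∈) _ c → none (_ , y∈ , c)
            ; _ _ (there x∈) (here refl) _ c → none (_ , x∈ , conflict-sym c)
            ; x y (there x∈) (there y∈) x≢y c → v x y x∈ y∈ x≢y c }
          y = proj₁ witness
          clash : ∃ λ e → Clash T z e a
          clash = (lookup a z , y , lookup a y) , proj₁ (proj₂ witness) , refl , refl ,
            λ x y x∈ y∈ → v x y (∖-⊆ x∈) (∖-⊆ y∈)
          e∈ : (lookup a z , y , lookup a y) ∈ edges z
          e∈ = ∈-concatMap⁺ (λ i → map (i ,_) (proj₁ (conflicts z i))) (lose (∈-allFin (lookup a z))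
            (∈-map⁺ (lookup a z ,_) (proj₂ (proj₂ (conflicts z (lookup a z))) (proj₂ (proj₂ witness)))))

        -- Two applications of `total-fix` release the coordinates `z` and `y`; putting `y` back
        -- costs the factor 2 of the induction hypothesis.
        clash-count : ∀ T z → z ∉ T → (∀ y → y ∈ T → count (T ∖ y) ≤ 2 * count (y ∷ (T ∖ y))) →
          ∀ e → m * m * total n (λ a → 𝟙 (Clash T z e a)) ≤ 2 * count T
        clash-count T z z∉T half (i , y , j) with em {P = y ∈ T}
        ... | no y∉T = ≤-trans (≤-reflexive (trans
                (cong (m * m *_) (trans (total-cong n (λ a → 𝟙-no (y∉T ∘ proj₁))) (total-0 n))) (*-zeroʳ (m * m)))) z≤n
        ... | yes y∈T = begin
          m * m * total n (λ a → 𝟙 (Clash T z (i , y , j) a))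
            ≡⟨ *-assoc m m _ ⟩
          m * (m * total n (λ a → 𝟙 (Clash T z (i , y , j) a)))
            ≡⟨ cong (λ t → m * (m * t)) (total-cong n (λ a → trans (𝟙-cong proj₂ (y∈T ,_)) 𝟙-×)) ⟩
          m * (m * total n (λ a → 𝟙 (lookup a z ≡ i) * 𝟙 (lookup a y ≡ j × Valid (T ∖ y) a)))
            ≡⟨ cong (m *_) (total-fix n z i _ λ a k → trans 𝟙-× (trans (cong₂ _*_
                  (cong (λ l → 𝟙 (l ≡ j)) (lookup∘update′ y≢z a k))
                  (valid-independent (T ∖ y) (z∉T ∘ ∖-⊆) a k)) (sym 𝟙-×))) ⟩
          m * total n (λ a → 𝟙 (lookup a y ≡ j × Valid (T ∖ y) a))
            ≡⟨ cong (m *_) (total-cong n (λ a → 𝟙-×)) ⟩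
          m * total n (λ a → 𝟙 (lookup a y ≡ j) * 𝟙 (Valid (T ∖ y) a))
            ≡⟨ total-fix n y j _ (valid-independent (T ∖ y) (∖-∉ {T})) ⟩
          count (T ∖ y)
            ≤⟨ half y y∈T ⟩
          2 * count (y ∷ (T ∖ y))
            ≤⟨ *-monoʳ-≤ 2 (total-mono n λ a → 𝟙-mono (λ v x x' x∈ x'∈ → v x x' (∈-∖ x∈) (∈-∖ x'∈))) ⟩
          2 * count T ∎
          where
          open ≤-Reasoning
          y≢z : y ≢ z
          y≢z refl = z∉T y∈T

        -- The origin of the constant 4: at most `m * κ` clashes, each of relative size at most
        -- `2 / (m * m)`, lose the fraction `2 * κ / m`, which is at most one half.
        arithmetic : ∀ c d S → c ≤ d + S → m * m * S ≤ m * κ * (2 * c) → c ≤ 2 * d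
        arithmetic c d S c≤d+S mmS≤ = cancel 1≤m (cancel 1≤m (+-cancelʳ-≤ (m * (m * c)) _ _ main))
          where
          open ≤-Reasoning
          open +-*-Solver
          cancel : ∀ {k x y} → 1 ≤ k → k * x ≤ k * y → x ≤ y
          cancel {suc k} _ = *-cancelˡ-≤ (suc k)
          main : m * (m * c) + m * (m * c) ≤ m * (m * (2 * d)) + m * (m * c)
          main = begin
            m * (m * c) + m * (m * c)
              ≡⟨ solve 2 (λ m c → m :* (m :* c) :+ m :* (m :* c) := con 2 :* (m :* m :* c)) refl m c ⟩
            2 * (m * m * c)
              ≤⟨ *-monoʳ-≤ 2 (*-monoʳ-≤ (m * m) c≤d+S) ⟩
            2 * (m * m * (d + S))
              ≡⟨ solve 3 (λ m d s → con 2 :* (m :* m :* (d :+ s)) := m :* (m :* (con 2 :* d)) :+ con 2 :* (m :* m :* s)) refl m d S ⟩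
            m * (m * (2 * d)) + 2 * (m * m * S)
              ≤⟨ +-monoʳ-≤ (m * (m * (2 * d))) (*-monoʳ-≤ 2 mmS≤) ⟩
            m * (m * (2 * d)) + 2 * (m * κ * (2 * c))
              ≡⟨ cong (m * (m * (2 * d)) +_) (solve 3 (λ m k c → con 2 :* (m :* k :* (con 2 :* c)) := m :* (con 4 :* k :* c)) refl m κ c) ⟩
            m * (m * (2 * d)) + m * (4 * κ * c)
              ≤⟨ +-monoʳ-≤ (m * (m * (2 * d))) (*-monoʳ-≤ m (*-monoˡ-≤ c 4κ≤m)) ⟩
            m * (m * (2 * d)) + m * (m * c) ∎

        -- Induction on the size of `T`: the bound on the clashes uses the claim only for `T`
        -- without `y`, which is shorter.
        half : ∀ k T → length T ≤ k → ∀ z → z ∉ T → count T ≤ 2 * count (z ∷ T)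
        half k T len z z∉T = arithmetic (count T) (count (z ∷ T)) (∑ᴸ (edges z) (λ e → total n (λ a → 𝟙 (Clash T z e a))))
          (≤-trans (total-mono n (pointwise T z)) (≤-reflexive (trans (total-+ n _ _)
            (cong (count (z ∷ T) +_) (total-∑ᴸ n (edges z) (λ e a → 𝟙 (Clash T z e a)))))))
          (≤-trans (∑ᴸ-bound (edges z) _ (m * m) (2 * count T) (clash-count T z z∉T (smaller k T len)))
            (*-monoˡ-≤ (2 * count T) (edges-length z)))
          where
          smaller : ∀ k T → length T ≤ k → ∀ y → y ∈ T → count (T ∖ y) ≤ 2 * count (y ∷ (T ∖ y))
          smaller zero [] _ y ()
          smaller (suc k) T len y y∈T = half k (T ∖ y) (s≤s⁻¹ (≤-trans
            (filter-notAll (λ x → ¬? (x ≟ᶠ y)) T (Any.map (λ { refl x≢x → x≢x refl }) y∈T)) len)) y (∖-∉ {T})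

        count-positive : ∀ T → 1 ≤ count T
        count-positive [] = ≤-trans (total-one 1≤m n) (≤-reflexive (total-cong n λ a → sym (𝟙-yes λ _ _ ())))
        count-positive (z ∷ T) with em {P = z ∈ T}
        ... | yes z∈T = ≤-trans (count-positive T) (total-mono n λ a → 𝟙-mono λ v x y x∈ y∈ → v x y (absorb x∈) (absorb y∈))
          where
          absorb : ∀ {x} → x ∈ z ∷ T → x ∈ T
          absorb (here refl) = z∈T
          absorb (there x∈)  = x∈
        ... | no z∉T = positive (count (z ∷ T)) (≤-trans (count-positive T) (half (length T) T ≤-refl z z∉T))
          where
          positive : ∀ c → 1 ≤ 2 * c → 1 ≤ c
          positive (suc c) _ = s≤s z≤n

      independent-transversal : ∃ λ (f : Fin n → Fin m) → ∀ {x y} → x ≢ y → ¬ C x (f x) y (f y)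
      independent-transversal with total-positive n _ (count-positive (allFin n))
      ... | a , pos = lookup a , λ x≢y → valid _ _ (∈-allFin _) (∈-allFin _) x≢y
        where
        valid : Valid (allFin n) a
        valid = dne λ ¬v → <-irrefl (sym (𝟙-no ¬v)) pos

  -- Borel selection of pairwise compatible options by means of a separation.

  module BorelTransversal where
    open Classical
    open BorelSets
    open BorelGraphs
    open FiniteTransversal using (independent-transversal)

    module Select {V : Set} {{cV : Coded V}} {Δ : ℕ} (G : BoundedGraph V Δ) (m κ R : ℕ)
      (4κ≤m : 4 * κ ≤ m) (1≤m : 1 ≤ m) where
      open BoundedGraph G
      open Graphs G

      -- The bound `κ` counts the conflicts of a single option and does not depend on `J`, so there
      -- may be far more options than conflicts.
      record Conflicts (J : ℕ) : Set₁ where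
        field
          Conf    : V → Fin J → V → Fin J → Set
          borel   : ∀ i j → Borel {V × V} (λ (x , y) → Conf x i y j)
          sym-c   : ∀ {x i y j} → Conf x i y j → Conf y j x i
          near    : ∀ {x i y j} → Conf x i y j → Ball R x y
          apart   : ∀ {x i y j} → Conf x i y j → x ≢ y
          bounded : ∀ x i → ∃ λ (ys : List (V × Fin J)) → length ys ≤ κ × (∀ {y j} → Conf x i y j → (y , j) ∈ ys)

      Close : Pred V 0ℓ → V → V → Set
      Close U x y = U x × U y × Ball (R + R) x y

      ComponentsFinite : Pred V 0ℓ → Set
      ComponentsFinite U = ∀ {v} → U v → ∃ λ (xs : List V) → ∀ {w} → Star (Close U) v w → w ∈ xs

      module _ {n : ℕ} (K : Conflicts (m * n)) (U : Pred V 0ℓ) (U-borel : Borel U) (U-finite : ComponentsFinite U) where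
        open Conflicts K

        private
          abstract
            -- The constraint solver wants its labels in a countable, hence inhabited, type; the
            -- labels here are the `m ^ n` ways to keep one of the `m` options in each of `n`
            -- blocks.
            size : ∃ λ q → m ^ n ≡ suc q
            size = go (m ^ n) (positive 1≤m)
              where
              positive : 1 ≤ m → 1 ≤ m ^ n
              positive (s≤s {n = m'} _) = m^n>0 (suc m') n
              go : ∀ k → 1 ≤ k → ∃ λ q → k ≡ suc q
              go (suc q) _ = q , refl

          q : ℕ
          q = proj₁ size

        decode : Fin (suc q) → Fin n → Fin m
        decode l = finToFun {m} {n} (subst Fin (sym (proj₂ size)) l)

        private
          encode : (Fin n → Fin m) → Fin (suc q)
          encode g = subst Fin (proj₂ size) (funToFin g)

          decode-encode : ∀ g β → decode (encode g) β ≡ g β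
          decode-encode g β = trans (cong (λ l → finToFun {m} {n} l β) (subst-sym-subst (proj₂ size)))
            (finToFun-funToFin g β)

          Touch : V → V → Set
          Touch x y = U x ⊎ U y

          -- All kept options of `x` are tested against all kept options of `y`. A solution
          -- therefore leaves no conflict that touches `U`, whatever is selected later among the
          -- kept options.
          Forbidden : Fin (suc q) → Fin (suc q) → V → V → Set
          Forbidden l l' x y = Touch x y × ∃ λ β → ∃ λ γ → Conf x (combine (decode l β) β) y (combine (decode l' γ) γ)

          forbidden-borel : ∀ l l' → Borel {V × V} (uncurry (Forbidden l l'))
          forbidden-borel l l' = σ-∩ (σ-∪ (proj₁-measurable U-borel) (proj₂-measurable U-borel))
            (σ-Fin∃ λ β → σ-Fin∃ λ γ → borel _ _)

          forbidden-local : ∀ {l l' x y} → Forbidden l l' x y → Ball R x y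
          forbidden-local (_ , _ , _ , c) = near c

          Link : V → V → Set
          Link = Linked zero R (λ _ _ → ⊤) (λ _ → σ-const ⊤) Forbidden forbidden-borel forbidden-local

          link-near : ∀ {x y} → Link x y → Ball R x y
          link-near (_ , _ , inj₁ (_ , _ , _ , c)) = near c
          link-near (_ , _ , inj₂ (_ , _ , _ , c)) = ball-sym R (near c)

          link-touch : ∀ {x y} → Link x y → Touch x y
          link-touch (_ , _ , inj₁ (t , _)) = t
          link-touch (_ , _ , inj₂ (t , _)) = swap t

          link-sym : ∀ {x y} → Link x y → Link y x
          link-sym (i , j , inj₁ f) = j , i , inj₂ f
          link-sym (i , j , inj₂ f) = j , i , inj₁ f

          -- Of two linked vertices at least one lies in `U`, so a walk along links is followed at
          -- distance at most `R` by a walk inside `U`. Skipping over a vertex outside `U` makes its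
          -- steps as long as `R + R`, whence the radius in `Close`.
          shadow : ∀ {v a w w'} → U a → Ball R a w → Star (Close U) v a → Star Link w w' →
            ∃ λ a → Star (Close U) v a × Ball R a w'
          shadow Ua d s ε = _ , s , d
          shadow {a = a} {w} Ua d s (_◅_ {j = w₁} l ls) with em {P = U w}
          ... | yes Uw = shadow Uw (link-near l) (s ◅◅ ((Ua , Uw , ball-mono (m≤m+n R R) d) ◅ ε)) ls
          ... | no ¬Uw with link-touch l
          ...   | inj₁ Uw = ⊥-elim (¬Uw Uw)
          ...   | inj₂ Uw₁ = shadow Uw₁ (ball-refl R) (s ◅◅ ((Ua , Uw₁ , ball-trans R d (link-near l)) ◅ ε)) ls

          finite-U : ∀ {v} → U v → ∃ λ (xs : List V) → ∀ {w} → Star Link v w → w ∈ xs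
          finite-U {v} Uv = let (xs , cover) = U-finite Uv in
            concatMap (proj₁ ∘ ball-list R) xs , λ ls →
              let (a , s , d) = shadow Uv (ball-refl R) ε ls
              in ∈-concatMap⁺ (proj₁ ∘ ball-list R) (lose (cover s) (proj₂ (ball-list R a) d))

          abstract
            finite : ∀ v → ∃ λ (xs : List V) → ∀ {w} → Star Link v w → w ∈ xs
            finite v with em {P = U v}
            ... | yes Uv = finite-U Uv
            ... | no ¬Uv with em {P = ∃ λ w → Link v w}
            ...   | no none = v ∷ [] , λ { ε → here refl ; (l ◅ _) → ⊥-elim (none (_ , l)) }
            ...   | yes (w , l) with link-touch l
            ...     | inj₁ Uv = ⊥-elim (¬Uv Uv)
            ...     | inj₂ Uw = let (xs , cover) = finite-U Uw in xs , λ s → cover (link-sym l ◅ s)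

          module Component (v : V) where
            xs : List V
            xs = proj₁ (finite v)

            idx : V → Fin (length xs)
            idx x with em {P = x ∈ xs}
            ... | yes x∈ = Any.index x∈
            ... | no _ = Any.index (proj₂ (finite v) ε)

            lookup-idx : ∀ {x} → x ∈ xs → List.lookup xs (idx x) ≡ x
            lookup-idx {x} x∈ with em {P = x ∈ xs}
            ... | yes x∈' = sym (Anyₚ.lookup-index x∈')
            ... | no x∉ = ⊥-elim (x∉ x∈)

            vertex : Fin (length xs * n) → V
            vertex g = List.lookup xs (proj₁ (remQuot n g))

            block : Fin (length xs * n) → Fin n
            block g = proj₂ (remQuot {length xs} n g)

            -- The list `xs` may repeat vertices. Only the copy chosen by `idx` takes part in
            -- conflicts; counting all copies could exceed `κ`.
            Canonical : Fin (length xs * n) → Set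
            Canonical g = proj₁ (remQuot n g) ≡ idx (vertex g)

            C : Fin (length xs * n) → Fin m → Fin (length xs * n) → Fin m → Set
            C g i h j = Canonical g × Canonical h × Conf (vertex g) (combine i (block g)) (vertex h) (combine j (block h))

            name : V × Fin (m * n) → Fin (length xs * n) × Fin m
            name (y , j) = place (remQuot n j)
              where
              place : Fin m × Fin n → Fin (length xs * n) × Fin m
              place (i , β) = combine (idx y) β , i

            name-canonical : ∀ {h j} → Canonical h → name (vertex h , combine j (block h)) ≡ (h , j)
            name-canonical {h} {j} can = trans
              (cong (λ (i , β) → combine (idx (vertex h)) β , i) (remQuot-combine {m} {n} j (block h)))
              (cong (_, j) (trans (cong (λ p → combine p (block h)) (sym can)) (combine-remQuot {length xs} n h)))

            C-bounded : ∀ g i → ∃ λ (hs : List (Fin (length xs * n) × Fin m)) →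
              length hs ≤ κ × (∀ {h j} → C g i h j → (h , j) ∈ hs)
            C-bounded g i = map name ys , ≤-trans (≤-reflexive (length-map name ys)) (proj₁ (proj₂ conflicts)) , covers
              where
              conflicts = bounded (vertex g) (combine i (block g))
              ys = proj₁ conflicts
              covers : ∀ {h j} → C g i h j → (h , j) ∈ map name ys
              covers {h} {j} (_ , ch , c) =
                subst (_∈ map name ys) (name-canonical {h} {j} ch) (∈-map⁺ name (proj₂ (proj₂ conflicts) c))

            C-sym : ∀ {g i h j} → C g i h j → C h j g i
            C-sym (cg , ch , c) = ch , cg , sym-c c

            abstract
              transversal : ∃ λ (f : Fin (length xs * n) → Fin m) → ∀ {g h} → g ≢ h → ¬ C g (f g) h (f h)
              transversal = independent-transversal {κ = κ} C C-sym C-bounded 4κ≤m 1≤m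

            assignment : V → Fin (suc q)
            assignment x = encode (λ β → proj₁ transversal (combine (idx x) β))

            solves : ∀ {x y} → x ∈ xs → y ∈ xs → ¬ Forbidden (assignment x) (assignment y) x y
            solves {x} {y} x∈ y∈ (_ , β , γ , c) = proj₂ transversal {g} {h} g≢h
              (canonical x∈ β , canonical y∈ γ , conf)
              where
              g = combine (idx x) β
              h = combine (idx y) γ
              vertex≡ : ∀ {x} → x ∈ xs → ∀ β → vertex (combine (idx x) β) ≡ x
              vertex≡ {x} x∈ β = trans (cong (List.lookup xs ∘ proj₁) (remQuot-combine {length xs} {n} (idx x) β)) (lookup-idx x∈)
              block≡ : ∀ x β → block (combine (idx x) β) ≡ β
              block≡ x β = cong proj₂ (remQuot-combine {length xs} {n} (idx x) β)
              canonical : ∀ {x} → x ∈ xs → ∀ β → Canonical (combine (idx x) β)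
              canonical {x} x∈ β = trans (cong proj₁ (remQuot-combine {length xs} {n} (idx x) β)) (cong idx (sym (vertex≡ x∈ β)))
              g≢h : g ≢ h
              g≢h eq = apart c (trans (sym (vertex≡ x∈ β)) (trans (cong vertex eq) (vertex≡ y∈ γ)))
              conf : Conf (vertex g) (combine (proj₁ transversal g) (block g)) (vertex h) (combine (proj₁ transversal h) (block h))
              conf = transport (sym (vertex≡ x∈ β)) (cong₂ combine (decode-encode _ β) (sym (block≡ x β)))
                (sym (vertex≡ y∈ γ)) (cong₂ combine (decode-encode _ γ) (sym (block≡ y γ))) c
                where
                transport : ∀ {x x' i i' y y' j j'} → x ≡ x' → i ≡ i' → y ≡ y' → j ≡ j' → Conf x i y j → Conf x' i' y' j'
                transport refl refl refl refl c = c

          solvable : ∀ v → ∃ λ (a : V → Fin (suc q)) → (∀ {u} → Star Link v u → ⊤) ×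
            (∀ {u w} → Star Link v u → Star Link v w → ¬ Forbidden (a u) (a w) u w)
          solvable v = Component.assignment v , (λ _ → tt) , λ {u} {w} s t →
            Component.solves v {u} {w} (proj₂ (finite v) s) (proj₂ (finite v) t)

          solution : ∃ λ (f : V → Fin (suc q)) → ℕ-Measurable f × (∀ v → ⊤) × (∀ {u v} → ¬ Forbidden (f u) (f v) u v)
          solution = component-solution zero R (λ _ _ → ⊤) (λ _ → σ-const ⊤) Forbidden forbidden-borel
            (λ {i} {j} → forbidden-local {i} {j}) finite solvable

        abstract
          stage : ∃ λ (f : V → Fin (suc q)) → ℕ-Measurable f × (∀ {x y} → U x ⊎ U y → ∀ β γ →
            ¬ Conf x (combine (decode (f x) β) β) y (combine (decode (f y) γ) γ))
          stage = proj₁ solution , proj₁ (proj₂ solution) ,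
            λ {x} {y} t β γ c → proj₂ (proj₂ (proj₂ solution)) {x} {y} (t , β , γ , c)

      -- With `k` parts left there are `m ^ k` options. One stage keeps `m ^ (k - 1)` of them and
      -- removes every conflict that touches the first part, so each surviving conflict touches a
      -- later one. When no part is left there is one option and no conflict.
      select-independent : ∀ k (K : Conflicts (m ^ k)) (U : Fin k → Pred V 0ℓ) → (∀ i → Borel (U i)) →
        (∀ i → ComponentsFinite (U i)) →
        (∀ {x i y j} → Conflicts.Conf K x i y j → ∃ λ l → U l x ⊎ U l y) →
        ∃ λ (f : V → Fin (m ^ k)) → ℕ-Measurable f × (∀ {x y} → ¬ Conflicts.Conf K x (f x) y (f y))
      select-independent zero K U U-borel U-finite touch =
        (λ _ → zero) , (λ i → σ-const (zero ≡ i)) , λ c → absurd (proj₁ (touch c))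
        where
        absurd : ¬ Fin 0
        absurd ()
      select-independent (suc k) K U U-borel U-finite touch = f , f-measurable , λ {x} {y} → proj₂ (proj₂ rest) {x} {y}
        where
        open Conflicts K
        label : V → Fin _
        label = proj₁ (stage {m ^ k} K (U zero) (U-borel zero) (U-finite zero))
        label-measurable : ℕ-Measurable label
        label-measurable = proj₁ (proj₂ (stage {m ^ k} K (U zero) (U-borel zero) (U-finite zero)))
        option : Fin _ → Fin (m ^ k) → Fin (m ^ suc k)
        option a β = combine (decode {m ^ k} K (U zero) (U-borel zero) (U-finite zero) a β) β
        full : V → Fin (m ^ k) → Fin (m ^ suc k)
        full x = option (label x)
        K'-bounded : ∀ x β → ∃ λ (ys : List (V × Fin (m ^ k))) → length ys ≤ κ ×
          (∀ {y γ} → Conf x (full x β) y (full y γ) → (y , γ) ∈ ys)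
        K'-bounded x β = map short ys , ≤-trans (≤-reflexive (length-map short ys)) (proj₁ (proj₂ old)) , covers
          where
          old = bounded x (full x β)
          ys = proj₁ old
          short : V × Fin (m ^ suc k) → V × Fin (m ^ k)
          short (y , j) = y , proj₂ (remQuot {m} (m ^ k) j)
          covers : ∀ {y γ} → Conf x (full x β) y (full y γ) → (y , γ) ∈ map short ys
          covers {y} {γ} c = subst (_∈ map short ys) (cong (λ p → y , proj₂ p) (remQuot-combine {m} {m ^ k} _ γ))
            (∈-map⁺ short (proj₂ (proj₂ old) c))
        K'-borel : ∀ β γ → Borel {V × V} (λ (x , y) → Conf x (full x β) y (full y γ))
        K'-borel β γ = ℕ-measurable-pred {f = label ∘ proj₁} (λ a → proj₁-measurable (label-measurable a))
          (λ a (x , y) → Conf x (option a β) y (full y γ))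
          (λ a → ℕ-measurable-pred {f = label ∘ proj₂} (λ b → proj₂-measurable (label-measurable b))
            (λ b (x , y) → Conf x (option a β) y (option b γ)) (λ b → borel (option a β) (option b γ)))
        K' : Conflicts (m ^ k)
        K' = record
          { Conf = λ x β y γ → Conf x (full x β) y (full y γ)
          ; borel = K'-borel
          ; sym-c = λ {x} {i} {y} {j} → sym-c
          ; near = λ {x} {i} {y} {j} → near
          ; apart = λ {x} {i} {y} {j} → apart
          ; bounded = K'-bounded }
        touch' : ∀ {x β y γ} → Conf x (full x β) y (full y γ) → ∃ λ i → U (suc i) x ⊎ U (suc i) y
        touch' {x} {β} {y} {γ} c with touch c
        ... | zero , t = ⊥-elim (proj₂ (proj₂ (stage {m ^ k} K (U zero) (U-borel zero) (U-finite zero))) t β γ c)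
        ... | suc i , t = i , t
        rest : ∃ λ (f : V → Fin (m ^ k)) → ℕ-Measurable f × (∀ {x y} → ¬ Conf x (full x (f x)) y (full y (f y)))
        rest = select-independent k K' (λ i → U (suc i)) (λ i → U-borel (suc i)) (λ i → U-finite (suc i))
          (λ {x} {i} {y} {j} → touch' {x} {i} {y} {j})
        f : V → Fin (m ^ suc k)
        f x = full x (proj₁ rest x)
        fin-pred : ∀ {N} {g : V → Fin N} → ℕ-Measurable g → (P : Fin N → Set) → Borel (λ x → P (g x))
        fin-pred {g = g} mg P = resp {A = λ x → ∃ λ b → g x ≡ b × P b}
          ((λ { (b , refl , p) → p }) , λ p → _ , refl , p) (σ-Fin∃ λ b → σ-∩ (mg b) (σ-const (P b)))
        f-measurable : ℕ-Measurable f
        f-measurable i = ℕ-measurable-pred label-measurable (λ a x → option a (proj₁ rest x) ≡ i)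
          (λ a → fin-pred (proj₁ (proj₂ rest)) (λ b → option a b ≡ i))

  -- Greedy colouring and Lovász's argument inside a ball.

  module FiniteColouring where
    open Classical
    open BorelSets using (Coded)
    open BorelGraphs

    restrict : {A : Set} → Pred A 0ℓ → List A → List A
    restrict Q = filter (λ x → em {P = Q x})

    ∈-restrict⁺ : {A : Set} {Q : Pred A 0ℓ} {xs : List A} {x : A} → x ∈ xs → Q x → x ∈ restrict Q xs
    ∈-restrict⁺ {Q = Q} = ∈-filter⁺ (λ x → em {P = Q x})

    ∈-restrict⁻ : {A : Set} {Q : Pred A 0ℓ} {xs : List A} {x : A} → x ∈ restrict Q xs → x ∈ xs × Q x
    ∈-restrict⁻ {Q = Q} {xs} = ∈-filter⁻ (λ x → em {P = Q x}) {xs = xs}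

    restrict-shorter : {A : Set} {Q : Pred A 0ℓ} {xs : List A} {x : A} → x ∈ xs → ¬ Q x → length (restrict Q xs) < length xs
    restrict-shorter {Q = Q} {xs} x∈ ¬q = filter-notAll (λ x → em {P = Q x}) xs (Any.map (λ { refl → ¬q }) x∈)

    argmax : {A : Set} (ρ : A → ℕ) (xs : List A) {x : A} → x ∈ xs → ∃ λ z → z ∈ xs × (∀ {y} → y ∈ xs → ρ y ≤ ρ z)
    argmax ρ (x ∷ []) _ = x , here refl , λ { (here refl) → ≤-refl }
    argmax ρ (x ∷ xs@(_ ∷ _)) _ with argmax ρ xs (here refl)
    ... | z , z∈ , max with ≤-total (ρ x) (ρ z)
    ...   | inj₁ x≤z = z , there z∈ , λ { (here refl) → x≤z ; (there y∈) → max y∈ }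
    ...   | inj₂ z≤x = x , here refl , λ { (here refl) → ≤-refl ; (there y∈) → ≤-trans (max y∈) z≤x }

    injective⇒surjective : ∀ {n} (f : Fin n → Fin n) → (∀ {i j} → f i ≡ f j → i ≡ j) → ∀ j → ∃ λ i → f i ≡ j
    injective⇒surjective {suc n} f inj j = dne λ ¬∃ → 1+n≰n (injective⇒≤
      {f = λ i → punchOut {i = j} {f i} (λ e → ¬∃ (i , sym e))}
      (λ {i} {k} e → inj (punchOut-injective (λ e → ¬∃ (i , sym e)) (λ e → ¬∃ (k , sym e)) e)))

    third : ∀ {n} → 3 ≤ n → (i j : Fin n) → ∃ λ k → k ≢ i × k ≢ j
    third (s≤s (s≤s (s≤s _))) i j with i ≟ᶠ zero | j ≟ᶠ zero
    ... | no i≢0 | no j≢0 = zero , i≢0 ∘ sym , j≢0 ∘ sym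
    ... | yes refl | _ with j ≟ᶠ suc zero
    ...   | yes refl = suc (suc zero) , (λ ()) , λ ()
    ...   | no j≢1 = suc zero , (λ ()) , j≢1 ∘ sym
    third (s≤s (s≤s (s≤s _))) i j | no i≢0 | yes refl with i ≟ᶠ suc zero
    ...   | yes refl = suc (suc zero) , (λ ()) , λ ()
    ...   | no i≢1 = suc zero , i≢1 ∘ sym , λ ()

    module Colour {V : Set} {{cV : Coded V}} {Δ : ℕ} (G : BoundedGraph V Δ) (3≤Δ : 3 ≤ Δ)
      (no-clique : ∀ (c : Fin (suc Δ) → V) → ¬ (∀ i j → i ≢ j → BoundedGraph.Adj G (c i) (c j))) where
      open BoundedGraph G
      open Graphs G

      -- Since `φ` covers all neighbours, this says that the degree is exactly `Δ`.
      Full : Pred V 0ℓ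
      Full v = (∀ i → Adj v (φ i v)) × (∀ i j → i ≢ j → φ i v ≢ φ j v)

      Proper : Pred V 0ℓ → (V → Fin Δ) → Set
      Proper S g = ∀ {u v} → S u → S v → Adj u v → g u ≢ g v

      Free : Pred V 0ℓ → (V → Fin Δ) → V → Fin Δ → Set
      Free S g x i = ∀ y → Adj x y → S y → g y ≢ i

      -- If each colour occurred at a coloured neighbour, the `Δ` colours would occupy the `Δ` maps
      -- `φ` bijectively. Then `x` would have degree `Δ` and all its neighbours would be coloured,
      -- and differently; each alternative denies one of these.
      free-colour : ∀ {S g x} →
        (∃ λ y → Adj x y × ¬ S y) ⊎ (¬ Full x ⊎ ∃₂ λ y z → y ≢ z × Adj x y × Adj x z × g y ≡ g z) →
        ∃ λ i → Free S g x i
      free-colour {S} {g} {x} slack = dne λ none →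
        let used : ∀ i → ∃ λ y → Adj x y × S y × g y ≡ i
            used i = dne λ unused → none (i , λ y a s e → unused (y , a , s , e))
            at : ∀ i → ∃ λ j → φ j x ≡ proj₁ (used i)
            at i = φ-covers (proj₁ (proj₂ (used i)))
            colour-at : ∀ i → g (φ (proj₁ (at i)) x) ≡ i
            colour-at i = trans (cong g (proj₂ (at i))) (proj₂ (proj₂ (proj₂ (used i))))
            at-injective : ∀ {i k} → proj₁ (at i) ≡ proj₁ (at k) → i ≡ k
            at-injective {i} {k} e = trans (sym (colour-at i)) (trans (cong (λ j → g (φ j x)) e) (colour-at k))
            at⁻¹ : ∀ j → ∃ λ i → proj₁ (at i) ≡ j
            at⁻¹ = injective⇒surjective (λ i → proj₁ (at i)) at-injective
            good : ∀ j → Adj x (φ j x) × S (φ j x)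
            good j = let (i , e) = at⁻¹ j ; (y , a , s , _) = used i in
              subst (λ j → Adj x (φ j x) × S (φ j x)) e (subst (λ y → Adj x y × S y) (sym (proj₂ (at i))) (a , s))
            distinct : ∀ j k → g (φ j x) ≡ g (φ k x) → j ≡ k
            distinct j k e = let (i , ei) = at⁻¹ j ; (l , el) = at⁻¹ k in
              trans (sym ei) (trans (cong (proj₁ ∘ at)
                (trans (sym (colour-at i)) (trans (cong (λ j → g (φ j x)) ei)
                  (trans e (trans (cong (λ j → g (φ j x)) (sym el)) (colour-at l)))))) el)
            absurd : (∃ λ y → Adj x y × ¬ S y) ⊎ (¬ Full x ⊎ ∃₂ λ y z → y ≢ z × Adj x y × Adj x z × g y ≡ g z) → ⊥
            absurd = λ
              { (inj₁ (y , a , ¬s)) → let (j , e) = φ-covers a in ¬s (subst S e (proj₂ (good j)))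
              ; (inj₂ (inj₁ ¬full)) → ¬full ((λ j → proj₁ (good j)) , λ j k j≢k e → j≢k (distinct j k (cong g e)))
              ; (inj₂ (inj₂ (y , z , y≢z , ay , az , e))) →
                  let (j , ej) = φ-covers ay ; (k , ek) = φ-covers az in
                  y≢z (trans (sym ej) (trans (cong (λ i → φ i x)
                    (distinct j k (trans (cong g ej) (trans e (cong g (sym ek)))))) ek)) }
        in absurd slack

      record Extension (P Q : Pred V 0ℓ) (g : V → Fin Δ) : Set where
        constructor extension
        field
          colour : V → Fin Δ
          agrees : ∀ {v} → P v → colour v ≡ g v
          proper : Proper Q colour

      proper-mono : ∀ {S T g} → (∀ {v} → T v → S v) → Proper S g → Proper T g
      proper-mono sub p tu tv = p (sub tu) (sub tv)

      extend-one : ∀ {P g x} → Proper P g → ¬ P x → ∀ i → Free P g x i →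
        Σ (Extension P (λ v → P v ⊎ v ≡ x) g) λ e → Extension.colour e x ≡ i
      extend-one {P} {g} {x} proper ¬Px i free = extension h (λ {v} → old {v}) (λ {u} {v} → ok {u} {v}) , new
        where
        h : V → Fin Δ
        h v with em {P = v ≡ x}
        ... | yes _ = i
        ... | no  _ = g v
        new : h x ≡ i
        new with em {P = x ≡ x}
        ... | yes _ = refl
        ... | no x≢x = ⊥-elim (x≢x refl)
        old : ∀ {v} → P v → h v ≡ g v
        old {v} p with em {P = v ≡ x}
        ... | yes refl = ⊥-elim (¬Px p)
        ... | no _ = refl
        ok : Proper (λ v → P v ⊎ v ≡ x) h
        ok (inj₁ p) (inj₁ q) a e = proper p q a (trans (sym (old p)) (trans e (old q)))
        ok (inj₁ p) (inj₂ refl) a e = free _ (symmetric a) p (trans (sym (old p)) (trans e new))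
        ok (inj₂ refl) (inj₁ q) a e = free _ a q (trans (sym (old q)) (trans (sym e) new))
        ok (inj₂ refl) (inj₂ refl) a e = loopless a

      extend-trans : ∀ {P Q R g} → (e : Extension P Q g) → Extension Q R (Extension.colour e) →
        (∀ {v} → P v → Q v) → Extension P R g
      extend-trans (extension h old _) (extension k old' proper') P⊆Q =
        extension k (λ p → trans (old' (P⊆Q p)) (old p)) proper'

      extend-cong : ∀ {P Q R g} → (∀ {v} → R v → Q v) → Extension P Q g → Extension P R g
      extend-cong sub (extension h old proper) = extension h old (proper-mono sub proper)

      extend-free : ∀ {P g x} → Proper P g → ¬ P x →
        (∃ λ y → Adj x y × ¬ P y) ⊎ (¬ Full x ⊎ ∃₂ λ y z → y ≢ z × Adj x y × Adj x z × g y ≡ g z) →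
        Extension P (λ v → P v ⊎ v ≡ x) g
      extend-free proper ¬Px slack = let (i , free) = free-colour slack in proj₁ (extend-one proper ¬Px i free)

      -- Greedy colouring in order of decreasing rank: every vertex still has an uncoloured neighbour.
      extend-ranked : ∀ n {P g} (C : List V) (ρ : V → ℕ) → length C ≤ n → Proper P g → (∀ {x} → x ∈ C → ¬ P x) →
        (∀ {x} → x ∈ C → ∃ λ y → Adj x y × ¬ P y × (y ∈ C → ρ y < ρ x)) → Extension P (λ v → P v ⊎ v ∈ C) g
      extend-ranked n {P} {g} [] ρ len proper outside lower = extension g (λ _ → refl)
        (proper-mono (λ { (inj₁ p) → p }) proper)
      extend-ranked (suc n) {P} {g} C@(_ ∷ _) ρ len proper outside lower with argmax ρ C (here refl)
      ... | x , x∈ , max = extend-cong split (extend-trans first rest inj₁)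
        where
        first : Extension P (λ v → P v ⊎ v ≡ x) g
        first = let (y , a , ¬p , _) = lower x∈ in extend-free proper (outside x∈) (inj₁ (y , a , ¬p))
        C' : List V
        C' = restrict (_≢ x) C
        rest : Extension (λ v → P v ⊎ v ≡ x) (λ v → (P v ⊎ v ≡ x) ⊎ v ∈ C') (Extension.colour first)
        rest = extend-ranked n C' ρ (s≤s⁻¹ (≤-trans (restrict-shorter {Q = _≢ x} x∈ (λ x≢x → x≢x refl)) len))
          (Extension.proper first)
          (λ z∈ → λ { (inj₁ p) → outside (proj₁ (∈-restrict⁻ z∈)) p ; (inj₂ e) → proj₂ (∈-restrict⁻ {Q = _≢ x} {C} z∈) e })
          (λ {z} z∈ → let (y , a , ¬p , less) = lower (proj₁ (∈-restrict⁻ z∈)) in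
            y , a , (λ { (inj₁ p) → ¬p p
                       ; (inj₂ e) → <-irrefl refl (<-≤-trans (subst (λ w → ρ w < ρ z) e (less (subst (_∈ C) (sym e) x∈))) (max (proj₁ (∈-restrict⁻ z∈)))) }) ,
            λ y∈ → less (proj₁ (∈-restrict⁻ y∈)))
        split : ∀ {v} → P v ⊎ v ∈ C → (P v ⊎ v ≡ x) ⊎ v ∈ C'
        split (inj₁ p) = inj₁ (inj₁ p)
        split {v} (inj₂ v∈) with em {P = v ≡ x}
        ... | yes e = inj₁ (inj₂ e)
        ... | no ne = inj₂ (∈-restrict⁺ v∈ ne)

      -- `S` restrains the vertices stepped onto but not the start, so vertices outside `S` are
      -- ranked as well.
      data Reach (S T : Pred V 0ℓ) : ℕ → V → Set where
        stop : ∀ {x} → T x → Reach S T zero x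
        via  : ∀ {n x w} → Adj x w → S w → Reach S T n w → Reach S T (suc n) x

      rank : Pred V 0ℓ → Pred V 0ℓ → V → ℕ
      rank S T = least (λ n x → Reach S T n x)

      rank≤ : ∀ {S T m y} → Reach S T m y → rank S T y ≤ m
      rank≤ {S} {T} {m} {y} r = ≮⇒≥ λ lt → proj₂ (least-spec (λ n x → Reach S T n x) {y} {m} r) m lt r

      rank-reach : ∀ {S T m y} → Reach S T m y → Reach S T (rank S T y) y
      rank-reach {S} {T} {m} {y} r = proj₁ (least-spec (λ n x → Reach S T n x) {y} {m} r)

      rank-descend : ∀ {S T n x} → Reach S T n x → ¬ T x →
        ∃ λ w → Adj x w × S w × (∃ λ m → Reach S T m w) × rank S T w < rank S T x
      rank-descend {S} {T} {n} {x} r ¬t = go (rank-reach r)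
        where
        go : ∀ {k} → Reach S T k x → ∃ λ w → Adj x w × S w × (∃ λ m → Reach S T m w) × rank S T w < k
        go (stop t) = ⊥-elim (¬t t)
        go (via a s r') = _ , a , s , (_ , r') , s≤s (rank≤ r')

      Step : Pred V 0ℓ → V → V → Set
      Step S x y = Adj x y × S x × S y

      step-sym : ∀ {S : Pred V 0ℓ} {x y} → Step S x y → Step S y x
      step-sym (a , s , t) = symmetric a , t , s

      star-reach : ∀ {S T : Pred V 0ℓ} {x y} → Star (Step S) x y → T y → ∃ λ n → Reach S T n x
      star-reach ε t = 0 , stop t
      star-reach {S} {T} ((a , _ , s) ◅ ss) t = let (n , r) = star-reach {S} {T} ss t in suc n , via a s r

      reach-reverse : ∀ {S n x y} → S x → Reach S (_≡ y) n x → Reach S (_≡ x) n y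
      reach-reverse {S} {n} {x} {y} s r = subst (λ k → Reach S (_≡ x) k y) (+-identityʳ n) (go s r (stop refl))
        where
        go : ∀ {m n w} → S w → Reach S (_≡ y) n w → Reach S (_≡ x) m w → Reach S (_≡ x) (n + m) y
        go sw (stop refl) acc = acc
        go {m} {suc n} sw (via a sw' r) acc =
          subst (λ k → Reach S (_≡ x) k y) (+-suc n m) (go sw' r (via (symmetric a) sw acc))

      ball-rank : ∀ R u {x} → Ball R u x → x ≢ u →
        ∃ λ w → Adj x w × Ball R u w × rank (Ball R u) (_≡ u) w < rank (Ball R u) (_≡ u) x
      ball-rank R u {x} b x≢u =
        let (n , r) = to-center R ≤-refl (ball-sym R b)
            (w , a , s , _ , lt) = rank-descend r x≢u
        in w , a , s , lt
        where
        to-center : ∀ n {x} → n ≤ R → Ball n x u → ∃ λ m → Reach (Ball R u) (_≡ u) m x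
        to-center zero    _ e = 0 , stop e
        to-center (suc n) n<R (w , inj₁ refl , b) = to-center n (<⇒≤ n<R) b
        to-center (suc n) n<R (w , inj₂ a , b) =
          let (m , r) = to-center n (<⇒≤ n<R) b in suc m , via a (ball-mono (<⇒≤ n<R) (ball-sym n b)) r

      LocallyConnected : ℕ → V → Set
      LocallyConnected R u = ∀ p q → Adj u p → Adj u q → Star (Step (λ x → Ball R u x × x ≢ u)) p q

      some-colour : Fin Δ
      some-colour = positive 3≤Δ
        where
        positive : ∀ {n} → 3 ≤ n → Fin n
        positive (s≤s _) = zero

      module Block (R : ℕ) (u : V) (full : Full u) (connected : LocallyConnected R u) (1≤R : 1 ≤ R) where

        private
          Inner : Pred V 0ℓ
          Inner x = Ball R u x × x ≢ u

          adj-inner : ∀ {p} → Adj u p → Inner p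
          adj-inner a = ball-mono 1≤R (adj-ball a) , λ { refl → loopless a }

          -- Cores replace the block structure in Brooks' theorem. In a core of least size nothing
          -- can be deleted without losing a neighbour of `u` or connectedness, and all further
          -- properties come from this.
          record Core (xs : List V) : Set where
            field
              inner     : ∀ {x} → x ∈ xs → Inner x
              terminals : ∀ {p} → Adj u p → p ∈ xs
              link      : ∀ {p q} → p ∈ xs → q ∈ xs → Star (Step (_∈ xs)) p q

          some-index : Fin Δ
          some-index = some-colour

          p₀ : V
          p₀ = φ some-index u

          initial-core : ∃ λ xs → Core xs
          initial-core = xs , record
            { inner = λ x∈ → proj₁ (proj₂ (∈-restrict⁻ {Q = Q} {ys} x∈))
            ; terminals = λ a → in-xs (adj-inner a) (connected _ _ (proj₁ full some-index) a)
            ; link = λ p∈ q∈ →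
                let (_ , ip , sp) = ∈-restrict⁻ {Q = Q} {ys} p∈
                    (_ , iq , sq) = ∈-restrict⁻ {Q = Q} {ys} q∈
                in lift ε (reverse step-sym sp) sp ◅◅ lift ε sq ε }
            where
            ys = proj₁ (ball-list R u)
            Q : Pred V 0ℓ
            Q x = Inner x × Star (Step Inner) p₀ x
            xs = restrict Q ys
            in-xs : ∀ {x} → Inner x → Star (Step Inner) p₀ x → x ∈ xs
            in-xs i s = ∈-restrict⁺ (proj₂ (ball-list R u) (proj₁ i)) (i , s)
            lift : ∀ {x y z} → Star (Step Inner) y z → Star (Step Inner) x y → Star (Step Inner) p₀ x → Star (Step (_∈ xs)) x y
            lift _ ε _ = ε
            lift t ((a , i , j) ◅ ss) s = (a , in-xs i s , in-xs j s') ◅ lift t ss s'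
              where s' = s ◅◅ ((a , i , j) ◅ ε)

          minimal : ∃ λ n → (∃ λ xs → length xs ≡ n × Core xs) × (∀ m → m < n → ¬ ∃ λ xs → length xs ≡ m × Core xs)
          minimal = minimum (let (xs , c) = initial-core in length xs , xs , refl , c)

        abstract
          core-exists : ∃ λ xs → Core xs × (∀ ys → length ys < length xs → ¬ Core ys)
          core-exists = let (n , (xs , e , c) , min) = minimal in
            xs , c , λ ys lt c' → min (length ys) (subst (length ys <_) e lt) (ys , refl , c')

        xs : List V
        xs = proj₁ core-exists

        open Core (proj₁ (proj₂ core-exists)) public

        private
          shortest : ∀ ys → length ys < length xs → ¬ Core ys
          shortest = proj₂ (proj₂ core-exists)

          dist : V → V → ℕ
          dist b = rank (_∈ xs) (_≡ b)

          reach : ∀ {b x} → b ∈ xs → x ∈ xs → ∃ λ n → Reach (_∈ xs) (_≡ b) n x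
          reach {b} b∈ x∈ = star-reach {T = _≡ b} (link x∈ b∈) refl

          dist-sym : ∀ {b x} → b ∈ xs → x ∈ xs → dist b x ≡ dist x b
          dist-sym b∈ x∈ = ≤-antisym (half b∈ x∈) (half x∈ b∈)
            where
            half : ∀ {b x} → b ∈ xs → x ∈ xs → dist b x ≤ dist x b
            half b∈ x∈ = rank≤ (reach-reverse b∈ (rank-reach (proj₂ (reach x∈ b∈))))

          -- Along a shortest path to `b` the distance strictly drops, so after its start the path
          -- cannot visit a vertex at the greatest distance.
          avoiding : ∀ {b y} → b ∈ xs → (∀ {x} → x ∈ xs → dist b x ≤ dist b y) →
            ∀ k {p} → dist b p ≤ k → p ∈ xs → p ≢ y → b ≢ y → Star (Step (λ x → x ∈ xs × x ≢ y)) p b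
          avoiding {b} {y} b∈ far k {p} le p∈ p≢y b≢y with em {P = p ≡ b}
          ... | yes refl = ε
          ... | no p≢b with rank-descend (proj₂ (reach b∈ p∈)) p≢b
          avoiding b∈ far zero le p∈ p≢y b≢y | no p≢b | w , a , w∈ , _ , lt = ⊥-elim (n≮0 (<-≤-trans lt le))
          avoiding {b} {y} b∈ far (suc k) le p∈ p≢y b≢y | no p≢b | w , a , w∈ , _ , lt =
            (a , (p∈ , p≢y) , (w∈ , w≢y)) ◅ avoiding b∈ far k (s≤s⁻¹ (≤-trans lt le)) w∈ w≢y b≢y
            where
            w≢y : w ≢ y
            w≢y refl = <-irrefl refl (<-≤-trans lt (far p∈))

          -- Deleting a farthest vertex keeps the core connected, so by minimality it can only be a
          -- terminal.
          far-adjacent : ∀ {b y} → b ∈ xs → y ∈ xs → b ≢ y → (∀ {x} → x ∈ xs → dist b x ≤ dist b y) → Adj u y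
          far-adjacent {b} {y} b∈ y∈ b≢y far = dne λ ¬a → shortest ys (restrict-shorter {Q = _≢ y} y∈ (λ ne → ne refl)) record
            { inner = λ x∈ → inner (proj₁ (∈-restrict⁻ {Q = _≢ y} x∈))
            ; terminals = λ a → ∈-restrict⁺ (terminals a) (λ { refl → ¬a a })
            ; link = λ p∈ q∈ → to-b p∈ ◅◅ reverse step-sym (to-b q∈) }
            where
            ys = restrict (_≢ y) xs
            weaken : ∀ {p q} → Star (Step (λ x → x ∈ xs × x ≢ y)) p q → Star (Step (_∈ ys)) p q
            weaken ε = ε
            weaken ((a , (p∈ , p≢) , (q∈ , q≢)) ◅ ss) = (a , ∈-restrict⁺ p∈ p≢ , ∈-restrict⁺ q∈ q≢) ◅ weaken ss
            to-b : ∀ {p} → p ∈ ys → Star (Step (_∈ ys)) p b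
            to-b p∈ = let (p∈' , p≢y) = ∈-restrict⁻ {Q = _≢ y} p∈ in weaken (avoiding b∈ far _ ≤-refl p∈' p≢y b≢y)

          nonadjacent : ∃₂ λ p q → Adj u p × Adj u q × p ≢ q × ¬ Adj p q
          nonadjacent = dne λ none → no-clique clique λ
            { zero zero i≢j → ⊥-elim (i≢j refl)
            ; zero (suc j) _ → proj₁ full j
            ; (suc i) zero _ → symmetric (proj₁ full i)
            ; (suc i) (suc j) i≢j → dne λ ¬a → none (φ i u , φ j u , proj₁ full i , proj₁ full j ,
                proj₂ full i j (λ { refl → i≢j refl }) , ¬a) }
            where
            clique : Fin (suc Δ) → V
            clique zero    = u
            clique (suc i) = φ i u

          -- A farthest pair of the core serves as Lovász's pair. Both ends are neighbours of `u` by
          -- `far-adjacent`; they are not adjacent, because `u` and its neighbours form no clique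
          -- and some two neighbours are thus at distance at least 2.
          record Diametral : Set where
            field
              {y y'} : V
              y∈  : y ∈ xs
              y'∈ : y' ∈ xs
              far : ∀ {b x} → b ∈ xs → x ∈ xs → dist b x ≤ dist y' y

          abstract
            diametral : Diametral
            diametral =
              let farthest : ∀ b → ∃ λ z → z ∈ xs × (∀ {x} → x ∈ xs → dist b x ≤ dist b z)
                  farthest b = argmax (dist b) xs (terminals (proj₁ full some-index))
                  (b , b∈ , max) = argmax (λ b → dist b (proj₁ (farthest b))) xs (terminals (proj₁ full some-index))
                  (z , z∈ , far) = farthest b
              in record { y∈ = z∈ ; y'∈ = b∈ ; far = λ {c} c∈ x∈ →
                   ≤-trans (proj₂ (proj₂ (farthest c)) x∈) (max c∈) }

        open Diametral diametral public

        private
          distance≥2 : ¬ dist y' y ≤ 1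
          distance≥2 le =
            let (p , q , ap , aq , p≢q , ¬a) = nonadjacent
                r = rank-reach (proj₂ (reach (terminals ap) (terminals aq)))
            in short p≢q ¬a r (≤-trans (far (terminals ap) (terminals aq)) le)
            where
            short : ∀ {p q k} → p ≢ q → ¬ Adj p q → Reach (_∈ xs) (_≡ p) k q → ¬ k ≤ 1
            short p≢q ¬a (stop refl) _ = p≢q refl
            short p≢q ¬a (via a _ (stop refl)) _ = ¬a (symmetric a)
            short p≢q ¬a (via _ _ (via _ _ _)) (s≤s ())

        y≢y' : y ≢ y'
        y≢y' e = distance≥2 (≤-trans (rank≤ (stop e)) z≤n)

        y≁y' : ¬ Adj y y'
        y≁y' a = distance≥2 (rank≤ (via a y'∈ (stop refl)))

        private
          far-y : ∀ {x} → x ∈ xs → dist y' x ≤ dist y' y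
          far-y = far y'∈

          far-y' : ∀ {x} → x ∈ xs → dist y x ≤ dist y y'
          far-y' x∈ = ≤-trans (far y∈ x∈) (≤-reflexive (dist-sym y'∈ y∈))

        adj-y : Adj u y
        adj-y = far-adjacent y'∈ y∈ (y≢y' ∘ sym) far-y

        adj-y' : Adj u y'
        adj-y' = far-adjacent y∈ y'∈ y≢y' far-y'

        Rest : Pred V 0ℓ
        Rest x = x ∈ xs × x ≢ y × x ≢ y'

        private
          -- Away from `t` no edge within `S` crosses the boundary of `O`. A walk to `t` that starts
          -- outside `O`, cut at its first visit to `t`, never enters `O`.
          follow : ∀ {O S : Pred V 0ℓ} {t p} → ¬ O t →
            (∀ {z w} → S z → z ≢ t → S w → w ≢ t → Adj z w → O z → O w) → ¬ O p →
            Star (Step S) p t → Star (Step (λ z → S z × ¬ O z)) p t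
          follow ¬Ot closed ¬Op ε = ε
          follow {O} {S} {t} {p} ¬Ot closed ¬Op (_◅_ {j = w} (a , Sp , Sw) ss) with em {P = p ≡ t}
          ... | yes refl = ε
          ... | no p≢t = (a , (Sp , ¬Op) , (Sw , ¬Ow)) ◅ follow ¬Ot closed ¬Ow ss
            where
            ¬Ow : ¬ O w
            ¬Ow Ow with em {P = w ≡ t}
            ... | yes refl = ¬Ot Ow
            ... | no w≢t = ¬Op (closed Sw w≢t Sp p≢t (symmetric a) Ow)

          another : ∃ λ q → Adj u q × q ≢ y × q ≢ y'
          another = let (i , ei) = φ-covers adj-y ; (j , ej) = φ-covers adj-y'
                        (k , k≢i , k≢j) = third 3≤Δ i j
                    in φ k u , proj₁ full k , (λ e → proj₂ full k i k≢i (trans e (sym ei))) ,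
                       λ e → proj₂ full k j k≢j (trans e (sym ej))

        -- A part of the core that contains no neighbour of `u` and is attached only through `y` and
        -- `y'` may be deleted: the rest still reaches `y` by paths avoiding `y'`, and conversely.
        -- Minimality makes such a part empty.
        module Unreachable (O : Pred V 0ℓ) (no-terminal : ∀ {z} → O z → ¬ Adj u z)
          (closed : ∀ {z w} → O z → Rest z → Rest w → Adj z w → O w) where

          zs : List V
          zs = restrict (λ z → ¬ O z) xs

          weaken : ∀ {r p q} → Star (Step (λ z → (z ∈ xs × z ≢ r) × ¬ O z)) p q → Star (Step (_∈ zs)) p q
          weaken ε = ε
          weaken ((a , ((p∈ , _) , ¬Op) , ((q∈ , _) , ¬Oq)) ◅ ss) =
            (a , ∈-restrict⁺ p∈ ¬Op , ∈-restrict⁺ q∈ ¬Oq) ◅ weaken ss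

          to-y : ∀ {p} → p ∈ xs → ¬ O p → p ≢ y' → Star (Step (_∈ zs)) p y
          to-y p∈ ¬Op p≢y' = weaken (follow {O = O} (λ o → no-terminal o adj-y)
            (λ (z∈ , z≢y') z≢y (w∈ , w≢y') w≢y a o → closed o (z∈ , z≢y , z≢y') (w∈ , w≢y , w≢y') a) ¬Op
            (avoiding y∈ far-y' _ ≤-refl p∈ p≢y' y≢y'))

          to-y' : ∀ {p} → p ∈ xs → ¬ O p → p ≢ y → Star (Step (_∈ zs)) p y'
          to-y' p∈ ¬Op p≢y = weaken (follow {O = O} (λ o → no-terminal o adj-y')
            (λ (z∈ , z≢y) z≢y' (w∈ , w≢y) w≢y' a o → closed o (z∈ , z≢y , z≢y') (w∈ , w≢y , w≢y') a) ¬Op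
            (avoiding y'∈ far-y _ ≤-refl p∈ p≢y (y≢y' ∘ sym)))

          all-to-y : ∀ {p} → p ∈ xs → ¬ O p → Star (Step (_∈ zs)) p y
          all-to-y {p} p∈ ¬Op with em {P = p ≡ y'}
          ... | no p≢y' = to-y p∈ ¬Op p≢y'
          -- `to-y` needs a start other than `y'`. A third neighbour of `u`, available because `Δ`
          -- is at least 3, is joined both to `y'` and to `y`.
          ... | yes refl = let (q , aq , q≢y , q≢y') = another in
            reverse step-sym (to-y' (terminals aq) (λ o → no-terminal o aq) q≢y)
            ◅◅ to-y (terminals aq) (λ o → no-terminal o aq) q≢y'

          smaller : Core zs
          smaller = record
            { inner = λ z∈ → inner (proj₁ (∈-restrict⁻ {Q = λ z → ¬ O z} z∈))
            ; terminals = λ a → ∈-restrict⁺ (terminals a) (λ o → no-terminal o a)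
            ; link = λ p∈ q∈ →
                let (p∈' , ¬Op) = ∈-restrict⁻ {Q = λ z → ¬ O z} {xs} p∈
                    (q∈' , ¬Oq) = ∈-restrict⁻ {Q = λ z → ¬ O z} {xs} q∈
                in all-to-y p∈' ¬Op ◅◅ reverse step-sym (all-to-y q∈' ¬Oq) }

          impossible : ∀ {x} → x ∈ xs → ¬ O x
          impossible x∈ Ox = shortest zs (restrict-shorter {Q = λ z → ¬ O z} x∈ (λ ¬o → ¬o Ox)) smaller

        abstract
          rest-reach : ∀ {x} → Rest x → ∃ λ n → Reach Rest (Adj u) n x
          rest-reach {x} (x∈ , _) = dne λ unreachable →
            Unreachable.impossible (λ z → Star (Step Rest) x z)
              (λ s a → unreachable (star-reach {Rest} {Adj u} s a))
              (λ s r r' a → s ◅◅ ((a , r , r') ◅ ε)) x∈ ε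

          reach-in-core : ∀ {b x} → b ∈ xs → x ∈ xs → ∃ λ n → Reach (_∈ xs) (_≡ b) n x
          reach-in-core = reach

      module _ (R : ℕ) (1≤R : 1 ≤ R) (u : V) {P : Pred V 0ℓ} {g : V → Fin Δ} (proper : Proper P g)
        (outside : ∀ {x} → Ball R u x → ¬ P x) where

        private
          -- Ranks inside the ball fall towards `u`, which is in `ys` and stays uncoloured; so the
          -- greedy order has slack everywhere outside `ys`.
          around : (ys : List V) → (∀ {x} → x ∈ ys → Ball R u x) → u ∈ ys →
            Extension P (λ v → P v ⊎ (Ball R u v × v ∉ ys)) g
          around ys ys⊆ u∈ = extend-cong
            (λ { (inj₁ p) → inj₁ p ; (inj₂ (b , v∉)) → inj₂ (∈-restrict⁺ (proj₂ (ball-list R u) b) (b , v∉)) })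
            (extend-ranked (length C) C (rank (Ball R u) (_≡ u)) ≤-refl proper
              (λ x∈ → outside (proj₁ (in-C x∈)))
              (λ x∈ → let (b , x∉) = in-C x∈
                          (w , a , bw , lt) = ball-rank R u b (λ { refl → x∉ u∈ })
                      in w , a , outside bw , λ _ → lt))
            where
            C = restrict (λ v → Ball R u v × v ∉ ys) (proj₁ (ball-list R u))
            in-C : ∀ {x} → x ∈ C → Ball R u x × x ∉ ys
            in-C x∈ = proj₂ (∈-restrict⁻ {Q = λ v → Ball R u v × v ∉ ys} {proj₁ (ball-list R u)} x∈)

        extend-ball-slack : ¬ Full u → Extension P (λ v → P v ⊎ Ball R u v) g
        extend-ball-slack ¬full = extend-cong split
          (extend-trans first (extend-free (Extension.proper first)
            (λ { (inj₁ p) → outside (ball-refl R) p ; (inj₂ (_ , u∉)) → u∉ (here refl) }) (inj₂ (inj₁ ¬full))) inj₁)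
          where
          first = around (u ∷ []) (λ { (here refl) → ball-refl R }) (here refl)
          split : ∀ {v} → P v ⊎ Ball R u v → (P v ⊎ (Ball R u v × v ∉ u ∷ [])) ⊎ v ≡ u
          split (inj₁ p) = inj₁ (inj₁ p)
          split {v} (inj₂ b) with em {P = v ≡ u}
          ... | yes e = inj₂ e
          ... | no ne = inj₁ (inj₂ (b , λ { (here e) → ne e }))

        module _ (full : Full u) (connected : LocallyConnected R u) where
          open Block R u full connected 1≤R

          private
            first : Extension P (λ v → P v ⊎ (Ball R u v × v ∉ u ∷ xs)) g
            first = around (u ∷ xs) (λ { (here refl) → ball-refl R ; (there x∈) → proj₁ (inner x∈) }) (here refl)

            P₁ : Pred V 0ℓ
            P₁ v = P v ⊎ (Ball R u v × v ∉ u ∷ xs)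

            g₁ = Extension.colour first

            fresh : ∀ {v} → v ∈ u ∷ xs → ¬ P₁ v
            fresh v∈ (inj₂ (_ , v∉)) = v∉ v∈
            fresh (here refl) (inj₁ p) = outside (ball-refl R) p
            fresh (there v∈)  (inj₁ p) = outside (proj₁ (inner v∈)) p

            whole : ∀ {Q} → (∀ {v} → P₁ v → Q v) → (∀ {v} → v ∈ u ∷ xs → Q v) →
              Extension P₁ Q g₁ → Extension P (λ v → P v ⊎ Ball R u v) g
            whole {Q} old new e = extend-cong split (extend-trans first e inj₁)
              where
              split : ∀ {v} → P v ⊎ Ball R u v → Q v
              split (inj₁ p) = old (inj₁ p)
              split {v} (inj₂ b) with em {P = v ∈ u ∷ xs}
              ... | yes v∈ = new v∈
              ... | no v∉ = old (inj₂ (b , v∉))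

            u∉xs : u ∉ xs
            u∉xs u∈ = proj₂ (inner u∈) refl

            -- A coloured neighbour w of some y₀ ∈ N(u): give u the colour of w, so that y₀ gains slack.
            caseA : ∀ {y₀ w} → Adj u y₀ → Adj y₀ w → P₁ w → Extension P (λ v → P v ⊎ Ball R u v) g
            caseA {y₀} {w} ay aw Pw = whole (inj₁ ∘ inj₁ ∘ inj₁) cover
              (extend-trans (proj₁ at-u) (extend-trans middle last inj₁) inj₁)
              where
              at-u = extend-one (Extension.proper first) (fresh (here refl)) (g₁ w)
                (λ _ a p → ⊥-elim (fresh (there (terminals a)) p))
              P₂ : Pred V 0ℓ
              P₂ v = P₁ v ⊎ v ≡ u
              C = restrict (_≢ y₀) xs
              fresh₂ : ∀ {v} → v ∈ xs → ¬ P₂ v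
              fresh₂ v∈ (inj₁ p) = fresh (there v∈) p
              fresh₂ v∈ (inj₂ refl) = u∉xs v∈
              middle : Extension P₂ (λ v → P₂ v ⊎ v ∈ C) (Extension.colour (proj₁ at-u))
              middle = extend-ranked (length C) C (rank (_∈ xs) (_≡ y₀)) ≤-refl (Extension.proper (proj₁ at-u))
                (λ x∈ → fresh₂ (proj₁ (∈-restrict⁻ {Q = _≢ y₀} x∈)))
                (λ x∈ → let (x∈' , x≢y₀) = ∈-restrict⁻ {Q = _≢ y₀} x∈
                            (z , a , z∈ , _ , lt) = rank-descend (proj₂ (reach-in-core (terminals ay) x∈')) x≢y₀
                        in z , a , fresh₂ z∈ , λ _ → lt)
              same : Extension.colour middle u ≡ Extension.colour middle w
              same = trans (Extension.agrees middle (inj₂ refl)) (trans (proj₂ at-u)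
                (sym (trans (Extension.agrees middle (inj₁ Pw)) (Extension.agrees (proj₁ at-u) Pw))))
              last : Extension (λ v → P₂ v ⊎ v ∈ C) (λ v → (P₂ v ⊎ v ∈ C) ⊎ v ≡ y₀) (Extension.colour middle)
              last = extend-free (Extension.proper middle)
                (λ { (inj₁ p) → fresh₂ (terminals ay) p ; (inj₂ y∈) → proj₂ (∈-restrict⁻ {Q = _≢ y₀} {xs} y∈) refl })
                (inj₂ (inj₂ (u , w , (λ { refl → fresh (here refl) Pw }) , symmetric ay , aw , same)))
              cover : ∀ {v} → v ∈ u ∷ xs → ((P₂ v ⊎ v ∈ C) ⊎ v ≡ y₀)
              cover (here refl) = inj₁ (inj₁ (inj₂ refl))
              cover {v} (there v∈) with em {P = v ≡ y₀}
              ... | yes e = inj₂ e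
              ... | no ne = inj₁ (inj₂ (∈-restrict⁺ v∈ ne))

            -- Otherwise the diametral pair y, y' may get the same colour, and u gains slack.
            caseB : ¬ (∃₂ λ y₀ w → Adj u y₀ × Adj y₀ w × P₁ w) → Extension P (λ v → P v ⊎ Ball R u v) g
            caseB none = whole (inj₁ ∘ inj₁ ∘ inj₁ ∘ inj₁) cover
              (extend-trans (proj₁ at-y) (extend-trans (proj₁ at-y') (extend-trans middle last inj₁) inj₁) inj₁)
              where
              at-y = extend-one (Extension.proper first) (fresh (there y∈)) some-colour
                (λ _ a p → ⊥-elim (none (y , _ , adj-y , a , p)))
              P₂ : Pred V 0ℓ
              P₂ v = P₁ v ⊎ v ≡ y
              at-y' = extend-one {P₂} (Extension.proper (proj₁ at-y))
                (λ { (inj₁ p) → fresh (there y'∈) p ; (inj₂ e) → y≢y' (sym e) }) some-colour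
                (λ { _ a (inj₁ p) → ⊥-elim (none (y' , _ , adj-y' , a , p)) ; _ a (inj₂ refl) → ⊥-elim (y≁y' (symmetric a)) })
              P₃ : Pred V 0ℓ
              P₃ v = P₂ v ⊎ v ≡ y'
              C = restrict (λ v → v ≢ y × v ≢ y') xs
              in-C : ∀ {x} → x ∈ C → Rest x
              in-C x∈ = let (a , b , c) = ∈-restrict⁻ {Q = λ v → v ≢ y × v ≢ y'} {xs} x∈ in a , b , c
              fresh₃ : ∀ {v} → Rest v → ¬ P₃ v
              fresh₃ (v∈ , _ , _) (inj₁ (inj₁ p)) = fresh (there v∈) p
              fresh₃ (_ , v≢y , _) (inj₁ (inj₂ e)) = v≢y e
              fresh₃ (_ , _ , v≢y') (inj₂ e) = v≢y' e
              u-fresh : ¬ P₃ u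
              u-fresh (inj₁ (inj₁ p)) = fresh (here refl) p
              u-fresh (inj₁ (inj₂ e)) = loopless (subst (Adj u) (sym e) adj-y)
              u-fresh (inj₂ e) = loopless (subst (Adj u) (sym e) adj-y')
              lower : ∀ {x} → x ∈ C → ∃ λ z → Adj x z × ¬ P₃ z × (z ∈ C → rank Rest (Adj u) z < rank Rest (Adj u) x)
              lower {x} x∈ with em {P = Adj u x}
              ... | yes a = u , symmetric a , u-fresh , λ u∈ → ⊥-elim (u∉xs (proj₁ (in-C u∈)))
              ... | no ¬a with rank-descend (proj₂ (rest-reach (in-C x∈))) ¬a
              ...   | z , a , rz , _ , lt = z , a , fresh₃ rz , λ _ → lt
              middle : Extension P₃ (λ v → P₃ v ⊎ v ∈ C) (Extension.colour (proj₁ at-y'))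
              middle = extend-ranked (length C) C (rank Rest (Adj u)) ≤-refl (Extension.proper (proj₁ at-y'))
                (λ x∈ → fresh₃ (in-C x∈)) lower
              same : Extension.colour middle y ≡ Extension.colour middle y'
              same = trans (Extension.agrees middle (inj₁ (inj₂ refl)))
                (trans (Extension.agrees (proj₁ at-y') (inj₂ refl)) (trans (proj₂ at-y)
                  (sym (trans (Extension.agrees middle (inj₂ refl)) (proj₂ at-y')))))
              last : Extension (λ v → P₃ v ⊎ v ∈ C) (λ v → (P₃ v ⊎ v ∈ C) ⊎ v ≡ u) (Extension.colour middle)
              last = extend-free (Extension.proper middle)
                (λ { (inj₁ p) → u-fresh p ; (inj₂ u∈) → u∉xs (proj₁ (in-C u∈)) })
                (inj₂ (inj₂ (y , y' , y≢y' , adj-y , adj-y' , same)))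
              cover : ∀ {v} → v ∈ u ∷ xs → (P₃ v ⊎ v ∈ C) ⊎ v ≡ u
              cover (here refl) = inj₂ refl
              cover {v} (there v∈) with em {P = v ≡ y} | em {P = v ≡ y'}
              ... | yes e | _ = inj₁ (inj₁ (inj₁ (inj₂ e)))
              ... | no _ | yes e = inj₁ (inj₁ (inj₂ e))
              ... | no ne | no ne' = inj₁ (inj₂ (∈-restrict⁺ v∈ (ne , ne')))

          extend-ball-connected : Extension P (λ v → P v ⊎ Ball R u v) g
          extend-ball-connected with em {P = ∃₂ λ y₀ w → Adj u y₀ × Adj y₀ w × P₁ w}
          ... | yes (y₀ , w , ay , aw , p) = caseA ay aw p
          ... | no none = caseB none

        extend-ball : ¬ (Full u × ¬ LocallyConnected R u) → Extension P (λ v → P v ⊎ Ball R u v) g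
        extend-ball h with em {P = Full u}
        ... | no ¬full = extend-ball-slack ¬full
        ... | yes full = extend-ball-connected full connected
          where
          connected : LocallyConnected R u
          connected = dne λ ¬c → h (full , ¬c)

  -- The forest of pointers, its cells and their branching.

  module PointerForest where
    open Classical
    open BorelSets
    open BorelGraphs
    open FiniteColouring

    concatMap-length : {A B : Set} (f : A → List B) (b : ℕ) → (∀ x → length (f x) ≤ b) → ∀ xs → length (concatMap f xs) ≤ length xs * b
    concatMap-length f b h []       = z≤n
    concatMap-length f b h (x ∷ xs) = ≤-trans (≤-reflexive (length-++ (f x))) (+-mono-≤ (h x) (concatMap-length f b h xs))

    module Cell {V : Set} {{cV : Coded V}} {Δ : ℕ} (G : BoundedGraph V Δ) (3≤Δ : 3 ≤ Δ)
      (no-clique : ∀ (c : Fin (suc Δ) → V) → ¬ (∀ i j → i ≢ j → BoundedGraph.Adj G (c i) (c j))) (r : ℕ) where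
      open BoundedGraph G
      open Graphs G
      open Colour G 3≤Δ no-clique

      ρ : ℕ
      ρ = r + r

      abstract
        -- `R₁` contains every pointer path, of length at most `ρ`, that starts within distance 2 of
        -- the centre. `D₀ = 2 * R₁ + 1` makes the `R₁`-balls around distinct points of `Y` disjoint
        -- with no edge between them.
        R₁ D₀ : ℕ
        R₁ = suc (suc ρ)
        D₀ = suc (R₁ + R₁)

        ρ+2≤R₁ : suc (suc ρ) ≤ R₁
        ρ+2≤R₁ = ≤-refl

        R₁+R₁<D₀ : R₁ + R₁ < D₀
        R₁+R₁<D₀ = ≤-refl

      private
        1≤R₁ : 1 ≤ R₁
        1≤R₁ = ≤-trans (s≤s z≤n) ρ+2≤R₁

        2≤R₁ : 2 ≤ R₁
        2≤R₁ = ≤-trans (s≤s (s≤s z≤n)) ρ+2≤R₁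

      Slack : Pred V 0ℓ
      Slack u = ¬ (Full u × ¬ LocallyConnected R₁ u)

      private
        Full-borel : Borel Full
        Full-borel = σ-∩ (σ-Fin∀ λ i → Adj-Borel id-measurable (φ-measurable i))
          (σ-Fin∀ λ i → σ-Fin∀ λ j → σ-⇒ (σ-const (i ≢ j)) (σ-∁ (≡-Borel (φ-measurable i) (φ-measurable j))))

        Inner : V → Pred V 0ℓ
        Inner u x = Ball R₁ u x × x ≢ u

        Chain : ℕ → V → V → V → Set
        Chain zero    u p q = p ≡ q
        Chain (suc n) u p q = ∃ λ w → Adj p w × (Inner u p × Inner u w) × Chain n u w q

        chain-star : ∀ n {u p q} → Chain n u p q → Star (Step (Inner u)) p q
        chain-star zero    refl = ε
        chain-star (suc n) (w , a , (i , j) , c) = (a , i , j) ◅ chain-star n c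

        star-chain : ∀ {u p q} → Star (Step (Inner u)) p q → ∃ λ n → Chain n u p q
        star-chain ε = 0 , refl
        star-chain ((a , i , j) ◅ ss) = let (n , c) = star-chain ss in suc n , _ , a , (i , j) , c

        Inner-borel : {X : Set} {{_ : Coded X}} {f g : X → V} → Measurable f → Measurable g → Borel (λ x → Inner (f x) (g x))
        Inner-borel mf mg = σ-∩ (Ball-Borel R₁ mf mg) (σ-∁ (≡-Borel mg mf))

        Chain-borel : ∀ n {X : Set} {{_ : Coded X}} {f g h : X → V} → Measurable f → Measurable g → Measurable h →
          Borel (λ x → Chain n (f x) (g x) (h x))
        Chain-borel zero mf mg mh = ≡-Borel mg mh
        Chain-borel (suc n) {X} mf mg mh = ∃Adj-borel mg (σ-∩
          (σ-∩ (Inner-borel (∘-measurable mf proj₁-measurable) (∘-measurable mg proj₁-measurable))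
               (Inner-borel (∘-measurable mf proj₁-measurable) proj₂-measurable))
          (Chain-borel n (∘-measurable mf proj₁-measurable) proj₂-measurable (∘-measurable mh proj₁-measurable)))

        LocallyConnected-borel : Borel (LocallyConnected R₁)
        LocallyConnected-borel = resp
          {A = λ u → ¬ ∃ λ p → Adj u p × ∃ λ q → Adj u q × ¬ ∃ λ n → Chain n u p q}
          ((λ none p q ap aq → dne λ ¬s → none (p , ap , q , aq , λ (n , c) → ¬s (chain-star n c))) ,
           λ all (p , ap , q , aq , ¬c) → ¬c (star-chain (all p q ap aq)))
          (σ-∁ (∃Adj-borel id-measurable (∃Adj-borel proj₁-measurable
            (σ-∁ (σ-⋃ {I = ℕ} λ n → Chain-borel n (∘-measurable proj₁-measurable proj₁-measurable)
              (∘-measurable proj₂-measurable proj₁-measurable) proj₂-measurable)))))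

        abstract
          Y-exists : ∃ λ (I : Pred V 0ℓ) → Borel I × (∀ {v} → I v → Slack v) ×
            (∀ {u v} → I u → I v → Ball D₀ u v → u ≡ v) × (∀ {v} → Slack v → ∃ λ u → I u × Ball D₀ v u)
          Y-exists = maximal-independent D₀ (σ-∁ (σ-∩ Full-borel (σ-∁ LocallyConnected-borel)))

      Y : Pred V 0ℓ
      Y = proj₁ Y-exists

      Y-borel : Borel Y
      Y-borel = proj₁ (proj₂ Y-exists)

      Y-slack : ∀ {v} → Y v → Slack v
      Y-slack = proj₁ (proj₂ (proj₂ Y-exists))

      Y-apart : ∀ {u v} → Y u → Y v → Ball D₀ u v → u ≡ v
      Y-apart = proj₁ (proj₂ (proj₂ (proj₂ Y-exists)))

      NearY : Pred V 0ℓ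
      NearY v = ∃ λ y → Ball D₀ v y × Y y

      slack-near : ∀ {v} → Slack v → NearY v
      slack-near s = let (y , Yy , b) = proj₂ (proj₂ (proj₂ (proj₂ Y-exists))) s in y , b , Yy

      NearY-borel : Borel NearY
      NearY-borel = ∃Ball-borel D₀ id-measurable (proj₂-measurable Y-borel)

      FarY : Pred V 0ℓ
      FarY v = ¬ ∃ λ w → Ball ρ v w × NearY w

      private
        abstract
          Z-exists : ∃ λ (I : Pred V 0ℓ) → Borel I × (∀ {v} → I v → FarY v) ×
            (∀ {u v} → I u → I v → Ball ρ u v → u ≡ v) × (∀ {v} → FarY v → ∃ λ u → I u × Ball ρ v u)
          Z-exists = maximal-independent ρ (σ-∁ (∃Ball-borel ρ id-measurable (proj₂-measurable NearY-borel)))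

      Z : Pred V 0ℓ
      Z = proj₁ Z-exists

      Z-borel : Borel Z
      Z-borel = proj₁ (proj₂ Z-exists)

      Z-far : ∀ {v} → Z v → FarY v
      Z-far = proj₁ (proj₂ (proj₂ Z-exists))

      Z-apart : ∀ {u v} → Z u → Z v → Ball ρ u v → u ≡ v
      Z-apart = proj₁ (proj₂ (proj₂ (proj₂ Z-exists)))

      Source : Pred V 0ℓ
      Source v = NearY v ⊎ Z v

      Source-borel : Borel Source
      Source-borel = σ-∪ NearY-borel Z-borel

      private
        SourceWithin : ℕ → Pred V 0ℓ
        SourceWithin n v = ∃ λ o → Ball n v o × Source o

        SourceWithin-borel : ∀ n → Borel (SourceWithin n)
        SourceWithin-borel n = ∃Ball-borel n id-measurable (proj₂-measurable Source-borel)

        source-within-ρ : ∀ v → SourceWithin ρ v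
        source-within-ρ v with em {P = ∃ λ w → Ball ρ v w × NearY w}
        ... | yes (w , b , n) = w , b , inj₁ n
        ... | no far = let (z , Zz , b) = proj₂ (proj₂ (proj₂ (proj₂ Z-exists))) far in z , b , inj₂ Zz

      abstract
        δ : V → ℕ
        δ = least SourceWithin

        δ-measurable : ℕ-Measurable δ
        δ-measurable = least-measurable {P = SourceWithin} SourceWithin-borel

        δ-within : ∀ v → ∃ λ o → Ball (δ v) v o × Source o
        δ-within v = proj₁ (least-spec SourceWithin {v} {ρ} (source-within-ρ v))

        δ-minimal : ∀ {n v} → SourceWithin n v → ¬ n < δ v
        δ-minimal {n} {v} w = go
          where
          spec : ∀ m → m < least SourceWithin v → ¬ SourceWithin m v
          spec = proj₂ (least-spec SourceWithin {v} {n} w)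
          go : ¬ n < δ v
          go lt = spec n lt w

      δ-least : ∀ {n v o} → Ball n v o → Source o → δ v ≤ n
      δ-least {n} {v} {o} b s = ≮⇒≥ (δ-minimal {n} {v} (o , b , s))

      δ≤ρ : ∀ v → δ v ≤ ρ
      δ≤ρ v = let (o , b , s) = source-within-ρ v in δ-least b s

      δ-source : ∀ {v} → Source v → δ v ≡ 0
      δ-source s = n≤0⇒n≡0 (δ-least refl s)

      source-δ : ∀ {v} → δ v ≡ 0 → Source v
      source-δ {v} e with δ v | δ-within v
      source-δ {v} refl | zero | (_ , refl , s) = s

      δ-lipschitz : ∀ {v w} → Adj v w → δ v ≤ suc (δ w)
      δ-lipschitz {v} {w} a = let (o , b , s) = δ-within w in δ-least {suc (δ w)} (w , inj₂ a , b) s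

      private
        Pointer : V × V → Set
        Pointer (v , w) = (Source v × w ≡ v) ⊎ (¬ Source v × Adj v w × δ v ≡ suc (δ w))

        δ-eq-borel : ∀ k {X : Set} {{_ : Coded X}} {f g : X → V} → Measurable f → Measurable g →
          Borel (λ x → δ (f x) ≡ k + δ (g x))
        δ-eq-borel k {X} {f = f} {g} mf mg = resp {A = λ x → ∃ λ n → δ (g x) ≡ n × δ (f x) ≡ k + n}
          ((λ { (n , refl , e) → e }) , λ e → _ , refl , e)
          (σ-⋃ {I = ℕ} λ n → σ-∩ (mg (δ-measurable n)) (mf (δ-measurable (k + n))))

        Pointer-borel : Borel Pointer
        Pointer-borel = σ-∪ (σ-∩ (proj₁-measurable Source-borel) (≡-Borel proj₂-measurable proj₁-measurable))
          (σ-∩ (proj₁-measurable (σ-∁ Source-borel)) (σ-∩ (Adj-Borel proj₁-measurable proj₂-measurable)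
            (δ-eq-borel 1 proj₁-measurable proj₂-measurable)))

        pointer-exists : ∀ v → ∃ λ w → Ball 1 v w × Pointer (v , w)
        pointer-exists v with em {P = Source v}
        ... | yes s = v , ball-refl 1 , inj₁ (s , refl)
        ... | no ¬s = go (δ v) refl (δ-within v)
          where
          go : ∀ n → δ v ≡ n → SourceWithin n v → ∃ λ w → Ball 1 v w × Pointer (v , w)
          go zero e _ = ⊥-elim (¬s (source-δ e))
          go (suc n) e (o , (w , inj₁ refl , b) , s) =
            ⊥-elim (1+n≰n (≤-trans (≤-reflexive (sym e)) (δ-least b s)))
          go (suc n) e (o , (w , inj₂ a , b) , s) = w , adj-ball a , inj₂ (¬s , a ,
            ≤-antisym (δ-lipschitz a) (≤-trans (s≤s (δ-least b s)) (≤-reflexive (sym e))))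

        abstract
          pointer : ∃ λ (π : V → V) → Measurable π × (∀ v → Pointer (v , π v))
          pointer = let (π , m , spec) = select id-measurable Pointer-borel in
            π , m , λ v → let (w , b , p) = pointer-exists v in spec 1 b p

      π : V → V
      π = proj₁ pointer

      π-adj : ∀ {v} → ¬ Source v → Adj v (π v) × δ v ≡ suc (δ (π v))
      π-adj {v} ¬s with proj₂ (proj₂ pointer) v
      ... | inj₁ (s , _) = ⊥-elim (¬s s)
      ... | inj₂ (_ , a , e) = a , e

      iter : ℕ → V → V
      iter zero    v = v
      iter (suc n) v = iter n (π v)

      iter-measurable : ∀ n → Measurable (iter n)
      iter-measurable zero b = b
      iter-measurable (suc n) b = proj₁ (proj₂ pointer) (iter-measurable n b)

      -- u is the n-th ancestor of v; the clause on δ discards the iterations of π beyond a source.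
      At : ℕ → V → V → Set
      At n v u = iter n v ≡ u × δ v ≡ n + δ u

      At-borel : ∀ n {X : Set} {{_ : Coded X}} {f g : X → V} → Measurable f → Measurable g → Borel (λ x → At n (f x) (g x))
      At-borel n mf mg = σ-∩ (≡-Borel (∘-measurable (iter-measurable n) mf) mg) (δ-eq-borel n mf mg)

      at-zero : ∀ {v} → At 0 v v
      at-zero = refl , refl

      at-step : ∀ {n v u} → At (suc n) v u → Adj v (π v) × At 1 v (π v) × At n (π v) u
      at-step {n} {v} {u} (e , d) = let (a , d') = π-adj ¬s in a , (refl , d') , e , suc-injective (trans (sym d') d)
        where
        ¬s : ¬ Source v
        ¬s s with () ← trans (sym (δ-source s)) d

      iter-+ : ∀ m n v → iter (m + n) v ≡ iter n (iter m v)
      iter-+ zero    n v = refl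
      iter-+ (suc m) n v = iter-+ m n (π v)

      at-trans : ∀ {m n v u t} → At m v u → At n u t → At (m + n) v t
      at-trans {m} {n} {v} {u} {t} (e , d) (e' , d') =
        trans (iter-+ m n v) (trans (cong (iter n) e) e') ,
        trans d (trans (cong (m +_) d') (sym (+-assoc m n (δ t))))

      at-unique : ∀ {n v u t} → At n v u → At n v t → u ≡ t
      at-unique (e , _) (e' , _) = trans (sym e) e'

      at-ball : ∀ n {v u} → At n v u → Ball n v u
      at-ball zero    (e , _) = e
      at-ball (suc n) at = let (a , _ , rest) = at-step at in _ , inj₂ a , at-ball n rest

      at-last : ∀ n {v u} → At (suc n) v u → ∃ λ q → At n v q × At 1 q u
      at-last zero    at = _ , at-zero , at
      at-last (suc n) at = let (_ , at₁ , rest) = at-step at ; (q , at' , last) = at-last n rest in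
        q , at-trans at₁ at' , last

      at-bound : ∀ {n v u} → At n v u → n ≤ ρ
      at-bound {n} {v} {u} (_ , d) = ≤-trans (m≤m+n n (δ u)) (≤-trans (≤-reflexive (sym d)) (δ≤ρ v))

      Desc : V → V → Set
      Desc v u = ∃ λ n → At n v u

      Desc-borel : {X : Set} {{_ : Coded X}} {f g : X → V} → Measurable f → Measurable g → Borel (λ x → Desc (f x) (g x))
      Desc-borel mf mg = σ-⋃ {I = ℕ} λ n → At-borel n mf mg

      desc-trans : ∀ {v u t} → Desc v u → Desc u t → Desc v t
      desc-trans (m , at) (n , at') = m + n , at-trans at at'

      desc-ball : ∀ {v u} → Desc v u → Ball ρ v u
      desc-ball (n , at) = ball-mono (at-bound at) (at-ball n at)

      desc-δ : ∀ {v u} → Desc v u → δ u ≤ δ v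
      desc-δ {v} {u} (n , _ , d) = ≤-trans (m≤n+m (δ u) n) (≤-reflexive (sym d))

      root : V → V
      root v = iter (δ v) v

      root-measurable : Measurable root
      root-measurable {A} a = ℕ-measurable-pred δ-measurable (λ n v → A (iter n v)) (λ n → iter-measurable n a)

      at-source : ∀ n v → δ v ≡ n → At n v (iter n v) × Source (iter n v)
      at-source zero    v e = at-zero , source-δ e
      at-source (suc n) v e =
        let (_ , d) = π-adj {v} (λ s → contradiction' (trans (sym (δ-source s)) e))
            (at , s) = at-source n (π v) (suc-injective (trans (sym d) e))
        in at-trans {1} (refl , d) at , s
        where
        contradiction' : ∀ {n} → 0 ≢ suc n
        contradiction' ()

      at-root : ∀ v → At (δ v) v (root v)
      at-root v = proj₁ (at-source (δ v) v refl)

      root-source : ∀ v → Source (root v)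
      root-source v = proj₂ (at-source (δ v) v refl)

      root-of-source : ∀ {v} → Source v → root v ≡ v
      root-of-source {v} s = cong (λ n → iter n v) (δ-source s)

      desc-root : ∀ {v u} → Desc v u → root v ≡ root u
      desc-root {v} {u} (n , e , d) = trans (cong (λ k → iter k v) d) (trans (iter-+ n (δ u) v) (cong (iter (δ u)) e))

      root-ball : ∀ v → Ball ρ v (root v)
      root-ball v = desc-ball (_ , at-root v)

      cell-not-near : ∀ {v} → Z (root v) → ¬ NearY v
      cell-not-near {v} Zr near = Z-far Zr (v , subst (λ w → Ball ρ w v) (sym (root-of-source (inj₁ near))) (ball-refl ρ) , near)

      -- Vertices with slack are near `Y`, hence sources and their own roots, while `Z` keeps away
      -- from them.
      cell-not-slack : ∀ {v} → Z (root v) → Full v × ¬ LocallyConnected R₁ v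
      cell-not-slack Zr = dne λ s → cell-not-near Zr (slack-near s)

      -- The root of `v` is within `r + r` of `z`, which is why `ρ` has this value: `Z-far` then
      -- excludes a root near `Y`, and `Z-apart` any other root in `Z`.
      interior : ∀ {j v z} → Z z → Ball j v z → j ≤ r → root v ≡ z
      interior {j} {v} {z} Zz b j≤r = which (root-source v)
        where
        δ≤j : δ v ≤ j
        δ≤j = δ-least b (inj₂ Zz)
        z-root : Ball ρ z (root v)
        z-root = ball-mono (+-mono-≤ j≤r (≤-trans δ≤j j≤r)) (ball-trans j (ball-sym j b) (at-ball (δ v) (at-root v)))
        which : Source (root v) → root v ≡ z
        which (inj₁ near) = ⊥-elim (Z-far Zz (root v , z-root , near))
        which (inj₂ Zr) = sym (Z-apart Zz Zr z-root)

      -- A pointer path through `u` would make its start a descendant of `u`. Each step moves at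
      -- most one further from `u`, so the sum `m + n` is preserved.
      path-avoiding : ∀ n {m u p t} → Ball m u p → m + n ≤ R₁ → At n p t → ¬ Desc p u → Star (Step (Inner u)) p t
      path-avoiding zero b le (refl , _) ¬d = ε
      path-avoiding (suc n) {m} {u} {p} b le at ¬d =
        let (a , at₁ , rest) = at-step at
            le' : suc m + n ≤ R₁
            le' = ≤-trans (≤-reflexive (sym (+-suc m n))) le
            b' = subst (λ k → Ball k u (π p)) (+-comm m 1) (ball-trans m b (adj-ball a))
            ¬d' : ¬ Desc (π p) u
            ¬d' d = ¬d (desc-trans (1 , at₁) d)
            here' : ∀ {k x} → Ball k u x → k ≤ R₁ → ¬ Desc x u → Inner u x
            here' b le ¬d = ball-mono le b , λ { refl → ¬d (0 , at-zero) }
        in (a , here' b (≤-trans (m≤m+n m (suc n)) le) ¬d , here' b' (≤-trans (m≤m+n (suc m) n) le') ¬d')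
           ◅ path-avoiding n b' le' rest ¬d'

      neighbour-to-root : ∀ {u c} → Adj u c → ¬ Desc c u → Star (Step (Inner u)) c (root c)
      neighbour-to-root {u} {c} a ¬d = path-avoiding (δ c) (adj-ball a) (≤-trans (≤-trans (s≤s (δ≤ρ c)) (n≤1+n _)) ρ+2≤R₁) (at-root c) ¬d

      -- `δ` changes by at most one along an edge, so a neighbour cannot be two generations below.
      child-depth : ∀ {u c} → Adj u c → Desc c u → At 1 c u
      child-depth {u} {c} a (zero , refl , _) = ⊥-elim (loopless a)
      child-depth {u} {c} a (suc zero , at) = at
      child-depth {u} {c} a (suc (suc n) , _ , d) = ⊥-elim (1+n≰n (≤-trans (s≤s (s≤s (m≤n+m (δ u) n)))
        (≤-trans (≤-reflexive (sym d)) (δ-lipschitz (symmetric a)))))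

      -- A pointer-leaf all of whose neighbours lie in its cell would be locally connected.
      leaf-exit : ∀ {u} → Z (root u) → ¬ (∃ λ q → At 1 q u) → ∃ λ c → Adj u c × root c ≢ root u
      leaf-exit {u} Zu leaf = dne λ none → proj₂ (cell-not-slack Zu) λ p q ap aq →
        to-root none ap ◅◅ reverse step-sym (to-root none aq)
        where
        to-root : ¬ (∃ λ c → Adj u c × root c ≢ root u) → ∀ {p} → Adj u p → Star (Step (Inner u)) p (root u)
        to-root none {p} a = subst (Star (Step (Inner u)) p) (dne λ ne → none (p , a , ne))
          (neighbour-to-root a (λ d → leaf (p , child-depth a d)))

      has-child : ∀ {u} → Z (root u) → (∀ {c} → Adj u c → root c ≡ root u) → ∃ λ q → At 1 q u
      has-child Zu all = dne λ leaf → let (c , a , ne) = leaf-exit Zu leaf in ne (all a)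

      Grandchildren : V → V → V → Set
      Grandchildren u v w = v ≢ w × At 2 v u × At 2 w u

      interior-neighbour : ∀ {u c} → Z (root u) → δ u < r → Adj u c → root c ≡ root u
      interior-neighbour {u} {c} Zu lt a = interior Zu (c⇒root) lt
        where
        c⇒root : Ball (suc (δ u)) c (root u)
        c⇒root = u , inj₂ (symmetric a) , at-ball (δ u) (at-root u)

      -- As `u` is a local cut vertex, some neighbour `c` is not joined to the root around `u`, so
      -- `c` is a child. Two further neighbours of `c` are cut off with it: they are descendants of
      -- `u`, at depth 1 or 2. If both have depth 2, they are the pair. Otherwise one is a sibling
      -- of `c`, and both siblings have children, since an interior vertex is no leaf.
      growth : ∀ {u} → Z (root u) → suc (suc (δ u)) ≤ r → ∃₂ λ v w → Grandchildren u v w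
      growth {u} Zu le = finish separated
        where
        Connected : V → Set
        Connected x = Star (Step (Inner u)) x (root u)
        cell₁ : ∀ {c} → Adj u c → root c ≡ root u
        cell₁ = interior-neighbour Zu (≤-trans (n≤1+n _) le)
        separated : ∃ λ c → Adj u c × ¬ Connected c
        separated = dne λ none → proj₂ (cell-not-slack Zu) λ p q ap aq →
          dne (λ ¬c → none (p , ap , ¬c)) ◅◅ reverse step-sym (dne (λ ¬c → none (q , aq , ¬c)))
        finish : (∃ λ c → Adj u c × ¬ Connected c) → ∃₂ λ v w → Grandchildren u v w
        finish (c , auc , ¬conn) = choose (other i₁ i₁≢i₀) (other i₂ i₂≢i₀)
          where
          c-child : At 1 c u
          c-child = child-depth auc (dne λ ¬d → ¬conn (subst (Star (Step (Inner u)) c) (cell₁ auc) (neighbour-to-root auc ¬d)))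
          child-cell : ∀ {q} → At 1 q u → Z (root q)
          child-cell at = subst Z (sym (desc-root (1 , at))) Zu
          child-δ : ∀ {q} → At 1 q u → δ q < r
          child-δ (_ , d) = ≤-trans (s≤s (≤-reflexive d)) le
          full : Full c
          full = proj₁ (cell-not-slack (child-cell c-child))
          i₀,e : ∃ λ i → φ i c ≡ u
          i₀,e = φ-covers (symmetric auc)
          i₀ i₁ i₂ : Fin Δ
          i₀ = proj₁ i₀,e
          i₁ = proj₁ (third 3≤Δ i₀ i₀)
          i₂ = proj₁ (third 3≤Δ i₀ i₁)
          i₁≢i₀ : i₁ ≢ i₀
          i₁≢i₀ = proj₁ (proj₂ (third 3≤Δ i₀ i₀))
          i₂≢i₀ : i₂ ≢ i₀
          i₂≢i₀ = proj₁ (proj₂ (third 3≤Δ i₀ i₁))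
          i₂≢i₁ : i₂ ≢ i₁
          i₂≢i₁ = proj₂ (proj₂ (third 3≤Δ i₀ i₁))
          c-inner : Inner u c
          c-inner = ball-mono 1≤R₁ (adj-ball auc) , λ { refl → loopless auc }
          other : ∀ i → i ≢ i₀ → At 1 (φ i c) u ⊎ At 2 (φ i c) u
          other i i≢i₀ = depth desc
            where
            x = φ i c
            acx : Adj c x
            acx = proj₁ full i
            x≢u : x ≢ u
            x≢u e = proj₂ full i i₀ i≢i₀ (trans e (sym (proj₂ i₀,e)))
            x-ball : Ball 2 u x
            x-ball = c , inj₂ auc , adj-ball acx
            x-inner : Inner u x
            x-inner = ball-mono 2≤R₁ x-ball , x≢u
            x-root : root x ≡ root u
            x-root = trans (interior-neighbour (child-cell c-child) (child-δ c-child) acx) (cell₁ auc)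
            desc : Desc x u
            desc = dne λ ¬d → ¬conn ((acx , c-inner , x-inner) ◅
              subst (Star (Step (Inner u)) x) x-root
                (path-avoiding (δ x) x-ball (≤-trans (s≤s (s≤s (δ≤ρ x))) ρ+2≤R₁) (at-root x) ¬d))
            depth : Desc x u → At 1 x u ⊎ At 2 x u
            depth (0 , e , _) = ⊥-elim (x≢u e)
            depth (1 , at) = inj₁ at
            depth (2 , at) = inj₂ at
            depth (suc (suc (suc n)) , _ , d) = ⊥-elim (1+n≰n (≤-trans (s≤s (s≤s (s≤s (m≤n+m (δ u) n))))
              (≤-trans (≤-reflexive (sym d)) (≤-trans (δ-lipschitz (symmetric acx)) (s≤s (≤-reflexive (proj₂ c-child)))))))
          sibling : ∀ {x} → Adj c x → At 1 x u → ∃₂ λ v w → Grandchildren u v w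
          sibling {x} acx at =
            let (v , atv) = has-child (child-cell c-child) (interior-neighbour (child-cell c-child) (child-δ c-child))
                (w , atw) = has-child (child-cell at) (interior-neighbour (child-cell at) (child-δ at))
            in v , w , (λ e → loopless (subst (Adj c) (at-unique {1} atw (subst (λ v → At 1 v c) e atv)) acx)) ,
               at-trans atv c-child , at-trans atw at
          choose : At 1 (φ i₁ c) u ⊎ At 2 (φ i₁ c) u → At 1 (φ i₂ c) u ⊎ At 2 (φ i₂ c) u → ∃₂ λ v w → Grandchildren u v w
          choose (inj₁ at) _ = sibling (proj₁ full i₁) at
          choose (inj₂ _) (inj₁ at) = sibling (proj₁ full i₂) at
          choose (inj₂ at) (inj₂ at') = φ i₁ c , φ i₂ c , proj₂ full i₁ i₂ (i₂≢i₁ ∘ sym) , at , at'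

      first-child : ∀ {z} → Z z → 1 ≤ r → ∃ λ c → At 1 c z
      first-child {z} Zz 1≤r = has-child Zr (interior-neighbour Zr (≤-trans (s≤s (≤-reflexive (δ-source (inj₂ Zz)))) 1≤r))
        where
        Zr : Z (root z)
        Zr = subst Z (sym (root-of-source (inj₂ Zz))) Zz

      private
        FirstOfTwo : Pred (V × V) 0ℓ
        FirstOfTwo (u , v) = ∃ λ w → Grandchildren u v w

        Grandchildren-borel : {X : Set} {{_ : Coded X}} {f g h : X → V} → Measurable f → Measurable g → Measurable h →
          Borel (λ x → Grandchildren (f x) (g x) (h x))
        Grandchildren-borel {f = f} {g} {h} mf mg mh = σ-∩ (σ-∁ (≡-Borel {f = g} {h} mg mh))
          (σ-∩ (At-borel 2 {f = g} {f} mg mf) (At-borel 2 {f = h} {f} mh mf))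

        FirstOfTwo-borel : Borel FirstOfTwo
        FirstOfTwo-borel = ∃-borel 2 {f = proj₁} proj₁-measurable {P = λ ((u , v) , w) → Grandchildren u v w}
          (λ g → ball-sym 2 (at-ball 2 (proj₂ (proj₂ g))))
          (Grandchildren-borel {f = proj₁ ∘ proj₁} {proj₂ ∘ proj₁} {proj₂} (∘-measurable proj₁-measurable proj₁-measurable)
            (∘-measurable proj₂-measurable proj₁-measurable) proj₂-measurable)

        first-ball : ∀ {u v w} → Grandchildren u v w → Ball 2 u v
        first-ball {u} {v} (_ , at , _) = ball-sym 2 {v} {u} (at-ball 2 {v} {u} at)

        second-ball : ∀ {u v w} → Grandchildren u v w → Ball 2 u w
        second-ball {u} {v} {w} (_ , _ , at) = ball-sym 2 {w} {u} (at-ball 2 {w} {u} at)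

        Selector : Pred (V × V) 0ℓ → Set₁
        Selector R = ∃ λ (g : V → V) → Measurable g × (∀ n {x v} → Ball n x v → R (x , v) → R (x , g x))

        abstract
          left-selector : Selector FirstOfTwo
          left-selector = select {f = λ u → u} id-measurable {R = FirstOfTwo} FirstOfTwo-borel

        left : V → V
        left = proj₁ left-selector

        left-spec : ∀ {u v w} → Grandchildren u v w → FirstOfTwo (u , left u)
        left-spec {u} {v} {w} g = proj₂ (proj₂ left-selector) 2 {u} {v} (first-ball {u} {v} {w} g) (w , g)

        SecondOfTwo : Pred (V × V) 0ℓ
        SecondOfTwo (u , w) = Grandchildren u (left u) w

        SecondOfTwo-borel : Borel SecondOfTwo
        SecondOfTwo-borel = Grandchildren-borel {f = proj₁} {left ∘ proj₁} {proj₂} proj₁-measurable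
          (∘-measurable {f = proj₁} {g = left} (proj₁ (proj₂ left-selector)) proj₁-measurable) proj₂-measurable

        abstract
          right-selector : Selector SecondOfTwo
          right-selector = select {f = λ u → u} id-measurable {R = SecondOfTwo} SecondOfTwo-borel

        right : V → V
        right = proj₁ right-selector

        right-spec : ∀ {u w} → Grandchildren u (left u) w → Grandchildren u (left u) (right u)
        right-spec {u} {w} g = proj₂ (proj₂ right-selector) 2 {u} {w} (second-ball {u} {left u} {w} g) g

        Child : Pred (V × V) 0ℓ
        Child (z , c) = At 1 c z

        Child-borel : Borel Child
        Child-borel = At-borel 1 {f = proj₂} {proj₁} proj₂-measurable proj₁-measurable

        abstract
          start-selector : Selector Child
          start-selector = select {f = λ u → u} id-measurable {R = Child} Child-borel

        branch : Fin 2 → V → V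
        branch zero    = left
        branch (suc _) = right

        branch-measurable : ∀ b → Measurable (branch b)
        branch-measurable zero    = proj₁ (proj₂ left-selector)
        branch-measurable (suc _) = proj₁ (proj₂ right-selector)

        branches : ∀ {u} → Z (root u) → suc (suc (δ u)) ≤ r → Grandchildren u (branch zero u) (branch (suc zero) u)
        branches {u} Zu le = let (v , w , g) = growth Zu le ; (w' , g') = left-spec {u} {v} {w} g in right-spec {u} {w'} g'

        branch-at : ∀ {u} → Z (root u) → suc (suc (δ u)) ≤ r → ∀ b → At 2 (branch b u) u
        branch-at Zu le zero       = proj₁ (proj₂ (branches Zu le))
        branch-at Zu le (suc zero) = proj₂ (proj₂ (branches Zu le))

        branch-injective : ∀ {u} → Z (root u) → suc (suc (δ u)) ≤ r → ∀ {b c} → branch b u ≡ branch c u → b ≡ c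
        branch-injective Zu le {zero} {zero} e = refl
        branch-injective Zu le {zero} {suc zero} e = ⊥-elim (proj₁ (branches Zu le) e)
        branch-injective Zu le {suc zero} {zero} e = ⊥-elim (proj₁ (branches Zu le) (sym e))
        branch-injective Zu le {suc zero} {suc zero} e = refl

      start : V → V
      start = proj₁ start-selector

      node : ∀ n → Fin (2 ^ n) → V → V
      node zero    _ u = u
      node (suc n) i u = branch (proj₁ (remQuot {2} (2 ^ n) i)) (node n (proj₂ (remQuot {2} (2 ^ n) i)) u)

      node-measurable : ∀ n i → Measurable (node n i)
      node-measurable zero    i = id-measurable
      node-measurable (suc n) i = ∘-measurable {f = node n i'} {g = branch b} (branch-measurable b) (node-measurable n i')
        where
        b = proj₁ (remQuot {2} (2 ^ n) i)
        i' = proj₂ (remQuot {2} (2 ^ n) i)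

      node-at : ∀ n i {u} → Z (root u) → n + n + δ u ≤ r → At (n + n) (node n i u) u
      private
        node-room : ∀ n i {u} → Z (root u) → suc n + suc n + δ u ≤ r → Z (root (node n i u)) × suc (suc (δ (node n i u))) ≤ r

      node-at zero    i Zu le = at-zero
      node-at (suc n) i {u} Zu le = subst (λ k → At k (node (suc n) i u) u) (sym (cong suc (+-suc n n)))
        (at-trans (branch-at (proj₁ room) (proj₂ room) (proj₁ (remQuot {2} (2 ^ n) i)))
          (node-at n (proj₂ (remQuot {2} (2 ^ n) i)) Zu (≤-trans (+-monoˡ-≤ (δ u) (+-mono-≤ (n≤1+n n) (n≤1+n n))) le)))
        where
        room = node-room n (proj₂ (remQuot {2} (2 ^ n) i)) Zu le

      node-room n i {u} Zu le =
        let at = node-at n i Zu (≤-trans (+-monoˡ-≤ (δ u) (+-mono-≤ (n≤1+n n) (n≤1+n n))) le) in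
        subst Z (sym (desc-root (_ , at))) Zu ,
        ≤-trans (s≤s (s≤s (≤-reflexive (proj₂ at)))) (≤-trans (≤-reflexive (cong (_+ δ u) (cong suc (sym (+-suc n n))))) le)

      node-injective : ∀ n {u} → Z (root u) → n + n + δ u ≤ r → ∀ {i j} → node n i u ≡ node n j u → i ≡ j
      node-injective zero    Zu le {zero} {zero} e = refl
      node-injective (suc n) {u} Zu le {i} {j} e = trans (sym (combine-remQuot {2} (2 ^ n) i))
        (trans (cong₂ combine b≡ i'≡) (combine-remQuot {2} (2 ^ n) j))
        where
        bi = proj₁ (remQuot {2} (2 ^ n) i)
        bj = proj₁ (remQuot {2} (2 ^ n) j)
        i' = proj₂ (remQuot {2} (2 ^ n) i)
        j' = proj₂ (remQuot {2} (2 ^ n) j)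
        room-i = node-room n i' Zu le
        room-j = node-room n j' Zu le
        parents : node n i' u ≡ node n j' u
        parents = at-unique {2} (branch-at (proj₁ room-i) (proj₂ room-i) bi)
          (subst (λ v → At 2 v (node n j' u)) (sym e) (branch-at (proj₁ room-j) (proj₂ room-j) bj))
        i'≡ : i' ≡ j'
        i'≡ = node-injective n Zu (≤-trans (+-monoˡ-≤ (δ u) (+-mono-≤ (n≤1+n n) (n≤1+n n))) le) parents
        b≡ : bi ≡ bj
        b≡ = branch-injective (proj₁ room-i) (proj₂ room-i) (trans e (cong (branch bj) (sym parents)))

      start-at : ∀ {z} → Z z → 1 ≤ r → At 1 (start z) z
      start-at {z} Zz 1≤r = let (c , at) = first-child Zz 1≤r in
        proj₂ (proj₂ start-selector) 1 {z} {c} (ball-sym 1 {c} {z} (at-ball 1 {c} {z} at)) at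

      start-measurable : Measurable start
      start-measurable = proj₁ (proj₂ start-selector)

  -- Spots for extra slack, and how many of them can conflict.

  module SlackSpots where
    open Classical
    open BorelSets
    open BorelGraphs
    open FiniteColouring
    open PointerForest
    open BorelTransversal

    n<2^n : ∀ n → n < 2 ^ n
    n<2^n zero    = s≤s z≤n
    n<2^n (suc n) = ≤-trans (+-mono-≤ (≤-trans (s≤s z≤n) (n<2^n n)) (n<2^n n))
      (≤-reflexive (cong (2 ^ n +_) (sym (+-identityʳ (2 ^ n)))))

    module Spot {V : Set} {{cV : Coded V}} {Δ : ℕ} (G : BoundedGraph V Δ) (3≤Δ : 3 ≤ Δ)
      (no-clique : ∀ (c : Fin (suc Δ) → V) → ¬ (∀ i j → i ≢ j → BoundedGraph.Adj G (c i) (c j))) (r : ℕ) where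
      open BoundedGraph G
      open Graphs G
      open Colour G 3≤Δ no-clique
      open Cell G 3≤Δ no-clique r

      -- Giving a and b the same colour produces slack at t.
      Triple : V → V → V → V → Set
      Triple u t a b = (Desc t u × Desc a u × Desc b u) × (Adj t a × Adj t b × a ≢ b × ¬ Adj a b) × (δ t ≤ δ a × δ t ≤ δ b)

      HasT : Pred V 0ℓ
      HasT u = ∃ λ t → ∃ λ a → ∃ λ b → Triple u t a b

      private
        δ≤-borel : {X : Set} {{_ : Coded X}} {f g : X → V} → Measurable f → Measurable g → Borel (λ x → δ (f x) ≤ δ (g x))
        δ≤-borel {X} {f = f} {g} mf mg = resp {A = λ x → ∃ λ m → ∃ λ n → δ (f x) ≡ m × δ (g x) ≡ n × m ≤ n}
          ((λ { (m , n , refl , refl , le) → le }) , λ le → _ , _ , refl , refl , le)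
          (σ-⋃ {I = ℕ} λ m → σ-⋃ {I = ℕ} λ n → σ-∩ (mf (δ-measurable m)) (σ-∩ (mg (δ-measurable n)) (σ-const (m ≤ n))))

        Triple-borel : {X : Set} {{_ : Coded X}} {u t a b : X → V} →
          Measurable u → Measurable t → Measurable a → Measurable b → Borel (λ x → Triple (u x) (t x) (a x) (b x))
        Triple-borel {u = u} {t} {a} {b} mu mt ma mb = σ-∩
          (σ-∩ (Desc-borel {f = t} {u} mt mu) (σ-∩ (Desc-borel {f = a} {u} ma mu) (Desc-borel {f = b} {u} mb mu)))
          (σ-∩ (σ-∩ (Adj-Borel {f = t} mt {a} ma) (σ-∩ (Adj-Borel {f = t} mt {b} mb)
                  (σ-∩ (σ-∁ (≡-Borel {f = a} {b} ma mb)) (σ-∁ (Adj-Borel {f = a} ma {b} mb)))))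
               (σ-∩ (δ≤-borel {f = t} {a} mt ma) (δ≤-borel {f = t} {b} mt mb)))

        HasB : Pred ((V × V) × V) 0ℓ
        HasB ((u , t) , a) = ∃ λ b → Triple u t a b

        HasB-borel : Borel HasB
        HasB-borel = ∃-borel ρ {f = proj₁ ∘ proj₁} (∘-measurable {f = proj₁} {g = proj₁} proj₁-measurable proj₁-measurable)
          {P = λ (((u , t) , a) , b) → Triple u t a b}
          (λ { {(u , t) , a} {b} ((_ , _ , d) , _) → ball-sym ρ {b} {u} (desc-ball {b} {u} d) })
          (Triple-borel {u = proj₁ ∘ proj₁ ∘ proj₁} {proj₂ ∘ proj₁ ∘ proj₁} {proj₂ ∘ proj₁} {proj₂}
            (λ b → proj₁-measurable (proj₁-measurable (proj₁-measurable b)))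
            (λ b → proj₁-measurable (proj₁-measurable (proj₂-measurable b)))
            (λ b → proj₁-measurable (proj₂-measurable b)) proj₂-measurable)

        HasAB : Pred (V × V) 0ℓ
        HasAB (u , t) = ∃ λ a → HasB ((u , t) , a)

        HasAB-borel : Borel HasAB
        HasAB-borel = ∃-borel ρ {f = proj₁} proj₁-measurable {P = HasB}
          (λ { {u , t} {a} (_ , (_ , d , _) , _) → ball-sym ρ {a} {u} (desc-ball {a} {u} d) }) HasB-borel

        HasT-borel : Borel HasT
        HasT-borel = ∃-borel ρ {f = λ u → u} id-measurable {P = HasAB}
          (λ { {u} {t} (_ , _ , (d , _) , _) → ball-sym ρ {t} {u} (desc-ball {t} {u} d) }) HasAB-borel

      Lowest : Pred V 0ℓ
      Lowest t = HasT t × ¬ ∃ λ q → At 1 q t × HasT q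

      private
        Lowest-borel : Borel Lowest
        Lowest-borel = σ-∩ HasT-borel (σ-∁ (∃-borel 1 {f = λ t → t} id-measurable {P = λ (t , q) → At 1 q t × HasT q}
          (λ { {t} {q} (at , _) → ball-sym 1 {q} {t} (at-ball 1 {q} {t} at) })
          (σ-∩ (At-borel 1 {f = proj₂} {proj₁} proj₂-measurable proj₁-measurable) (proj₂-measurable HasT-borel))))

        Selector : Pred (V × V) 0ℓ → Set₁
        Selector R = ∃ λ (g : V → V) → Measurable g × (∀ n {x v} → Ball n x v → R (x , v) → R (x , g x))

        LowBelow : Pred (V × V) 0ℓ
        LowBelow (u , t) = Desc t u × Lowest t

        abstract
          low-selector : Selector LowBelow
          low-selector = select {f = λ u → u} id-measurable {R = LowBelow}
            (σ-∩ (Desc-borel {f = proj₂} {proj₁} proj₂-measurable proj₁-measurable) (proj₂-measurable Lowest-borel))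

          t-selector : Selector HasAB
          t-selector = select {f = λ u → u} id-measurable {R = HasAB} HasAB-borel

        low t-of : V → V
        low = proj₁ low-selector
        t-of = proj₁ t-selector

        low-measurable : Measurable low
        low-measurable = proj₁ (proj₂ low-selector)

        t-measurable : Measurable t-of
        t-measurable = proj₁ (proj₂ t-selector)

        HasB' : Pred (V × V) 0ℓ
        HasB' (u , a) = HasB ((u , t-of u) , a)

        abstract
          a-selector : Selector HasB'
          a-selector = select {f = λ u → u} id-measurable {R = HasB'}
            (⟨_,_⟩-measurable {f = λ (u , _) → u , t-of u} {g = proj₂}
              (⟨_,_⟩-measurable {f = proj₁} {g = t-of ∘ proj₁} proj₁-measurable (λ b → proj₁-measurable (t-measurable b)))
              proj₂-measurable HasB-borel)

        a-of : V → V
        a-of = proj₁ a-selector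

        a-measurable : Measurable a-of
        a-measurable = proj₁ (proj₂ a-selector)

        IsB : Pred (V × V) 0ℓ
        IsB (u , b) = Triple u (t-of u) (a-of u) b

        abstract
          b-selector : Selector IsB
          b-selector = select {f = λ u → u} id-measurable {R = IsB}
            (Triple-borel {u = proj₁} {t-of ∘ proj₁} {a-of ∘ proj₁} {proj₂} proj₁-measurable
              (λ b → proj₁-measurable (t-measurable b)) (λ b → proj₁-measurable (a-measurable b)) proj₂-measurable)

        b-of : V → V
        b-of = proj₁ b-selector

        b-measurable : Measurable b-of
        b-measurable = proj₁ (proj₂ b-selector)

        desc-ball' : ∀ {v u} → Desc v u → Ball ρ u v
        desc-ball' {v} {u} d = ball-sym ρ {v} {u} (desc-ball {v} {u} d)

        triple-spec : ∀ {u} → HasT u → Triple u (t-of u) (a-of u) (b-of u)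
        triple-spec {u} (t , a , b , tr) = b-spec (a-spec (t-spec (a , b , tr) (desc-ball' {t} {u} (proj₁ (proj₁ tr)))))
          where
          t-spec : HasAB (u , t) → Ball ρ u t → HasAB (u , t-of u)
          t-spec h d = proj₂ (proj₂ t-selector) ρ {u} {t} d h
          a-spec : HasAB (u , t-of u) → HasB' (u , a-of u)
          a-spec (a , h) = proj₂ (proj₂ a-selector) ρ {u} {a} (desc-ball' {a} {u} (proj₁ (proj₂ (proj₁ (proj₂ h))))) h
          b-spec : HasB' (u , a-of u) → Triple u (t-of u) (a-of u) (b-of u)
          b-spec (b , h) = proj₂ (proj₂ b-selector) ρ {u} {b} (desc-ball' {b} {u} (proj₂ (proj₂ (proj₁ h)))) h

      -- `k` is fuel: `δ` grows by one with each step down and never exceeds `ρ`.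
      lowest-exists : ∀ k {u} → ρ ≤ k + δ u → HasT u → ∃ λ t → Desc t u × Lowest t
      lowest-exists k {u} le h with em {P = ∃ λ q → At 1 q u × HasT q}
      ... | no none = u , (0 , at-zero) , h , none
      lowest-exists zero {u} le h | yes (q , at , hq) =
        ⊥-elim (1+n≰n (≤-trans (s≤s le) (≤-trans (≤-reflexive (sym (proj₂ at))) (δ≤ρ q))))
      lowest-exists (suc k) {u} le h | yes (q , at , hq) =
        let (t , d , low) = lowest-exists k {q} (≤-trans le (≤-reflexive (trans (sym (+-suc k (δ u))) (cong (k +_) (sym (proj₂ at)))))) hq
        in t , desc-trans d (1 , at) , low

      -- Induction on the generation. Siblings are adjacent, or their parent would carry a triple.
      -- For distinct parents `p` and `q`, adjacent by induction, the triple `(p; v, q)` is avoided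
      -- only if `v` is adjacent to `q`, and then `(q; v, w)` only if `v` is adjacent to `w`.
      generation-clique : ∀ {u} → ¬ HasT u → ∀ n {v w} → At n v u → At n w u → v ≢ w → Adj v w
      generation-clique ¬h zero (refl , _) (refl , _) v≢w = ⊥-elim (v≢w refl)
      generation-clique {u} ¬h (suc n) {v} {w} atv atw v≢w = dne λ ¬a → cases ¬a
        where
        p = π v
        q = π w
        vp = at-step {n} {v} {u} atv
        wq = at-step {n} {w} {u} atw
        p-at : At n p u
        p-at = proj₂ (proj₂ vp)
        q-at : At n q u
        q-at = proj₂ (proj₂ wq)
        child≤ : ∀ {x y} → At 1 x y → δ y ≤ δ x
        child≤ {x} {y} at = desc-δ {x} {y} (1 , at)
        triple : ∀ {t a b} → Desc t u → Desc a u → Desc b u → Adj t a → Adj t b → a ≢ b → δ t ≤ δ a → δ t ≤ δ b → ¬ ¬ Adj a b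
        triple dt da db ta tb a≢b la lb ¬ab = ¬h (_ , _ , _ , (dt , da , db) , (ta , tb , a≢b , ¬ab) , la , lb)
        p-p : Adj p v
        p-p = symmetric (proj₁ vp)
        q-q : Adj q w
        q-q = symmetric (proj₁ wq)
        cases : ¬ Adj v w → ⊥
        cases ¬a with em {P = p ≡ q}
        ... | yes p≡q = triple {p} {v} {w} (n , p-at) (suc n , atv) (suc n , atw) p-p (subst (λ x → Adj x w) (sym p≡q) q-q) v≢w
                (child≤ (proj₁ (proj₂ vp))) (subst (λ x → δ x ≤ δ w) (sym p≡q) (child≤ (proj₁ (proj₂ wq)))) ¬a
        ... | no p≢q = triple {q} {v} {w} (n , q-at) (suc n , atv) (suc n , atw) qv q-q v≢w
                (≤-trans (≤-reflexive q≡p) (child≤ (proj₁ (proj₂ vp)))) (child≤ (proj₁ (proj₂ wq))) ¬a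
          where
          pq : Adj p q
          pq = generation-clique ¬h n p-at q-at p≢q
          q≡p : δ q ≡ δ p
          q≡p = trans (proj₂ q-at) (sym (proj₂ p-at))
          v≢q : v ≢ q
          v≢q e = 1+n≢n (trans (sym (proj₂ (proj₁ (proj₂ vp)))) (trans (cong δ e) q≡p))
          qv : Adj q v
          qv = symmetric (dne (triple {p} {v} {q} (n , p-at) (suc n , atv) (n , q-at) p-p pq v≢q
                 (child≤ (proj₁ (proj₂ vp))) (≤-reflexive (sym q≡p))))

      -- Branching puts `2 ^ Δ`, so more than `Δ`, vertices into generation `Δ + Δ`; without a
      -- triple they would contain a forbidden clique.
      has-triple : ∀ {u} → Z (root u) → Δ + Δ + δ u ≤ r → HasT u
      has-triple {u} Zu le = dne λ ¬h → no-clique member λ i j i≢j →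
        generation-clique ¬h (Δ + Δ) (node-at Δ (name i) Zu le) (node-at Δ (name j) Zu le)
          (λ e → i≢j (inject≤-injective (n<2^n Δ) (n<2^n Δ) i j (node-injective Δ Zu le {name i} {name j} e)))
        where
        name : Fin (suc Δ) → Fin (2 ^ Δ)
        name i = inject≤ i (n<2^n Δ)
        member : Fin (suc Δ) → V
        member i = node Δ (name i) u

      -- One for the spot itself, and for each of at most `Δ` children at most `ρ + 1` generations,
      -- which are cliques and so have at most `Δ + 1` vertices. Linearity in `ρ` is essential for
      -- the final count.
      Q : ℕ
      Q = suc (Δ * (suc ρ * suc Δ))

      private
        generation-list : ∀ {u} → ¬ HasT u → ∀ n → ∃ λ (vs : List V) → length vs ≤ suc Δ × (∀ {v} → At n v u → v ∈ vs)
        generation-list {u} ¬h n with em {P = ∃ λ v → At n v u}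
        ... | no none = [] , z≤n , λ {v} at → ⊥-elim (none (v , at))
        ... | yes (v₀ , at₀) = v₀ ∷ neighbours v₀ , s≤s (≤-reflexive (length-tabulate (λ i → φ i v₀))) , covers
          where
          covers : ∀ {v} → At n v u → v ∈ v₀ ∷ neighbours v₀
          covers {v} at with em {P = v ≡ v₀}
          ... | yes refl = here refl
          ... | no ne = there (∈-neighbours (generation-clique ¬h n at₀ at (ne ∘ sym)))

        first-generations : ∀ {u} → ¬ HasT u → ∀ N → ∃ λ (vs : List V) → length vs ≤ N * suc Δ ×
          (∀ {v} n → n < N → At n v u → v ∈ vs)
        first-generations ¬h zero = [] , z≤n , λ _ ()
        first-generations {u} ¬h (suc N) with first-generations ¬h N | generation-list ¬h N
        ... | vs , len , cover | ws , len' , cover' = ws ++ vs , ≤-trans (≤-reflexive (length-++ ws)) (+-mono-≤ len' len) , both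
          where
          both : ∀ {v} n → n < suc N → At n v u → v ∈ ws ++ vs
          both n n<N at with m<1+n⇒m<n∨m≡n n<N
          ... | inj₁ lt = ∈-++⁺ʳ ws (cover n lt at)
          ... | inj₂ refl = ∈-++⁺ˡ (cover' at)

        -- This is applied to all neighbours of a lowest vertex, not just to its children. Those
        -- with a triple below them, such as the parent, contribute nothing.
        below-list : V → List V
        below-list q with em {P = HasT q}
        ... | yes _ = []
        ... | no ¬h = proj₁ (first-generations ¬h (suc ρ))

        below-length : ∀ q → length (below-list q) ≤ suc ρ * suc Δ
        below-length q with em {P = HasT q}
        ... | yes _ = z≤n
        ... | no ¬h = proj₁ (proj₂ (first-generations ¬h (suc ρ)))

        below-covers : ∀ {q v} → ¬ HasT q → Desc v q → v ∈ below-list q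
        below-covers {q} {v} ¬h (n , at) with em {P = HasT q}
        ... | yes h = ⊥-elim (¬h h)
        ... | no ¬h' = proj₂ (proj₂ (first-generations ¬h' (suc ρ))) n (s≤s (at-bound {n} {v} {q} at)) at

      descendants : V → List V
      descendants t = t ∷ concatMap below-list (neighbours t)

      descendants-length : ∀ t → length (descendants t) ≤ Q
      descendants-length t = s≤s (≤-trans (concatMap-length below-list (suc ρ * suc Δ) below-length (neighbours t))
        (*-monoˡ-≤ (suc ρ * suc Δ) (≤-reflexive (length-tabulate (λ i → φ i t)))))

      descendants-covers : ∀ {t v} → Lowest t → Desc v t → v ∈ descendants t
      descendants-covers {t} {v} low (zero , refl , _) = here refl
      descendants-covers {t} {v} (_ , none) (suc n , at) with at-last n {v} {t} at
      ... | q , at' , child = there (∈-concatMap⁺ below-list (lose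
              (∈-neighbours (symmetric (subst (Adj q) (proj₁ child) (proj₁ (at-step {0} {q} {t} child))))) (below-covers (λ h → none (q , child , h)) (n , at'))))

      -- The depth budget of a cell: 1 for `start`, `n + n` for `n` doublings, and `Δ + Δ` to force
      -- a triple below every top.
      module Family (n J : ℕ) (J≤ : J ≤ 2 ^ n) (room : suc (n + n + (Δ + Δ)) ≤ r) where

        private
          1≤r : 1 ≤ r
          1≤r = ≤-trans (s≤s z≤n) room

        top : Fin J → V → V
        top j z = node n (inject≤ j J≤) (start z)

        spot : Fin J → V → V
        spot j z = low (top j z)

        tₛ aₛ bₛ : Fin J → V → V
        tₛ j z = t-of (spot j z)
        aₛ j z = a-of (spot j z)
        bₛ j z = b-of (spot j z)

        spot-measurable : ∀ j → Measurable (spot j)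
        spot-measurable j b = start-measurable (node-measurable n (inject≤ j J≤) (low-measurable b))

        tₛ-measurable : ∀ j → Measurable (tₛ j)
        tₛ-measurable j b = spot-measurable j (t-measurable b)

        aₛ-measurable : ∀ j → Measurable (aₛ j)
        aₛ-measurable j b = spot-measurable j (a-measurable b)

        bₛ-measurable : ∀ j → Measurable (bₛ j)
        bₛ-measurable j b = spot-measurable j (b-measurable b)

        private
          start-root : ∀ {z} → Z z → root (start z) ≡ z
          start-root {z} Zz = trans (desc-root {start z} {z} (1 , start-at Zz 1≤r)) (root-of-source (inj₂ Zz))

          start-δ : ∀ {z} → Z z → δ (start z) ≡ 1
          start-δ {z} Zz = trans (proj₂ (start-at Zz 1≤r)) (cong suc (δ-source (inj₂ Zz)))

          start-cell : ∀ {z} → Z z → Z (root (start z))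
          start-cell Zz = subst Z (sym (start-root Zz)) Zz

          start-room : ∀ {z} → Z z → n + n + δ (start z) ≤ r
          start-room {z} Zz = ≤-trans (≤-reflexive (trans (cong (n + n +_) (start-δ Zz)) (+-comm (n + n) 1)))
            (≤-trans (s≤s (m≤m+n (n + n) (Δ + Δ))) room)

          top-at : ∀ {z} → Z z → ∀ j → At (n + n) (top j z) (start z)
          top-at Zz j = node-at n (inject≤ j J≤) (start-cell Zz) (start-room Zz)

          top-root : ∀ {z} → Z z → ∀ j → root (top j z) ≡ z
          top-root {z} Zz j = trans (desc-root {top j z} {start z} (n + n , top-at Zz j)) (start-root Zz)

          top-δ : ∀ {z} → Z z → ∀ j → δ (top j z) ≡ n + n + 1
          top-δ Zz j = trans (proj₂ (top-at Zz j)) (cong (n + n +_) (start-δ Zz))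

          top-triple : ∀ {z} → Z z → ∀ j → HasT (top j z)
          top-triple {z} Zz j = has-triple {top j z} (subst Z (sym (top-root Zz j)) Zz)
            (≤-trans (≤-reflexive (trans (cong (Δ + Δ +_) (trans (top-δ Zz j) (+-comm (n + n) 1)))
              (trans (+-suc (Δ + Δ) (n + n)) (cong suc (+-comm (Δ + Δ) (n + n)))))) room)

          spot-low : ∀ {z} → Z z → ∀ j → Desc (spot j z) (top j z) × Lowest (spot j z)
          spot-low {z} Zz j = let (t , d , low) = lowest-exists ρ {top j z} (m≤m+n ρ _) (top-triple Zz j) in
            proj₂ (proj₂ low-selector) ρ {top j z} {t} (desc-ball' {t} {top j z} d) (d , low)

        spot-triple : ∀ {z} → Z z → ∀ j → Triple (spot j z) (tₛ j z) (aₛ j z) (bₛ j z)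
        spot-triple Zz j = triple-spec (proj₁ (proj₂ (spot-low Zz j)))

        below-spot-root : ∀ {z v} → Z z → ∀ j → Desc v (spot j z) → root v ≡ z
        below-spot-root {z} {v} Zz j d = trans (desc-root {v} {top j z}
          (desc-trans {v} {spot j z} {top j z} d (proj₁ (spot-low Zz j)))) (top-root Zz j)

        -- The part of the cell of z cut off when a and b are removed.
        D : Fin J → V → V → Set
        D j z v = Desc v (aₛ j z) ⊎ Desc v (bₛ j z)

        D-below : ∀ {z v} → Z z → ∀ j → D j z v → Desc v (spot j z)
        D-below {z} {v} Zz j (inj₁ d) = desc-trans {v} {aₛ j z} {spot j z} d (proj₁ (proj₂ (proj₁ (spot-triple Zz j))))
        D-below {z} {v} Zz j (inj₂ d) = desc-trans {v} {bₛ j z} {spot j z} d (proj₂ (proj₂ (proj₁ (spot-triple Zz j))))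

        D-root : ∀ {z v} → Z z → ∀ j → D j z v → root v ≡ z
        D-root {z} {v} Zz j d = below-spot-root {z} {v} Zz j (D-below {z} {v} Zz j d)

        D-borel : ∀ j {X : Set} {{_ : Coded X}} {f g : X → V} → Measurable f → Measurable g → Borel (λ x → D j (f x) (g x))
        D-borel j {f = f} {g} mf mg = σ-∪
          (Desc-borel {f = g} {aₛ j ∘ f} mg (λ b → mf (aₛ-measurable j b)))
          (Desc-borel {f = g} {bₛ j ∘ f} mg (λ b → mf (bₛ-measurable j b)))

        private
          -- All tops have the same depth, and a vertex has a single ancestor at that depth.
          D-unique : ∀ {z v} → Z z → ∀ {i j} → D i z v → D j z v → i ≡ j
          D-unique {z} {v} Zz {i} {j} di dj =
            inject≤-injective J≤ J≤ i j (node-injective n (start-cell Zz) (start-room Zz) (same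
              (desc-trans {v} {spot i z} {top i z} (D-below {z} {v} Zz i di) (proj₁ (spot-low Zz i)))
              (desc-trans {v} {spot j z} {top j z} (D-below {z} {v} Zz j dj) (proj₁ (spot-low Zz j)))))
            where
            same : Desc v (top i z) → Desc v (top j z) → top i z ≡ top j z
            same (m , at) (m' , at') = at-unique {m} {v} at (subst (λ k → At k v (top j z)) m'≡m at')
              where
              m'≡m : m' ≡ m
              m'≡m = +-cancelʳ-≡ (δ (top j z)) m' m (trans (sym (proj₂ at'))
                (trans (proj₂ at) (cong (m +_) (trans (top-δ Zz i) (sym (top-δ Zz j))))))

        -- At most `Q` vertices lie below a spot, each with at most `Δ` neighbours, and a neighbour
        -- belongs to at most one piece cut off. The radius leads from `z` down to its piece, across
        -- one edge, and up to `z'`.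
        κ R : ℕ
        κ = Q * Δ
        R = ρ + suc ρ

        -- Spots of one cell are not in conflict, as only one of them will be selected.
        Conf : V → Fin J → V → Fin J → Set
        Conf z i z' j = ((Z z × Z z') × z ≢ z') × ∃ λ v → ∃ λ v' → D i z v × D j z' v' × Adj v v'

        private
          Touching : Fin J → Fin J → Pred (((V × V) × V) × V) 0ℓ
          Touching i j (((z , z') , v) , v') = D i z v × D j z' v' × Adj v v'

          D-ball : ∀ {z v} → Z z → ∀ j → D j z v → Ball ρ z v
          D-ball {z} {v} Zz j d = ball-sym ρ {v} {z} (subst (Ball ρ v) (D-root {z} {v} Zz j d) (root-ball v))

          TouchZ : Fin J → Fin J → Pred (V × V) 0ℓ
          TouchZ i j (z , z') = ∃ λ v → ∃ λ v' → (Z z × Z z') × Touching i j (((z , z') , v) , v')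

          TouchV : Fin J → Fin J → Pred ((V × V) × V) 0ℓ
          TouchV i j ((z , z') , v) = ∃ λ v' → (Z z × Z z') × Touching i j (((z , z') , v) , v')

          TouchV-borel : ∀ i j → Borel (TouchV i j)
          TouchV-borel i j = ∃-borel 1 {f = proj₂} proj₂-measurable
            {P = λ (((z , z') , v) , v') → (Z z × Z z') × Touching i j (((z , z') , v) , v')}
            (λ { (_ , _ , _ , a) → adj-ball a })
            (σ-∩ (σ-∩ (zm Z-borel) (z'm Z-borel))
              (σ-∩ (D-borel i {f = proj₁ ∘ proj₁ ∘ proj₁} {proj₂ ∘ proj₁} zm vm)
                (σ-∩ (D-borel j {f = proj₂ ∘ proj₁ ∘ proj₁} {proj₂} z'm proj₂-measurable)
                     (Adj-Borel {f = proj₂ ∘ proj₁} vm {proj₂} proj₂-measurable))))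
            where
            zm : Measurable {((V × V) × V) × V} {V} (proj₁ ∘ proj₁ ∘ proj₁)
            zm b = proj₁-measurable (proj₁-measurable (proj₁-measurable b))
            z'm : Measurable {((V × V) × V) × V} {V} (proj₂ ∘ proj₁ ∘ proj₁)
            z'm b = proj₁-measurable (proj₁-measurable (proj₂-measurable b))
            vm : Measurable {((V × V) × V) × V} {V} (proj₂ ∘ proj₁)
            vm b = proj₁-measurable (proj₂-measurable b)

          TouchZ-borel : ∀ i j → Borel (TouchZ i j)
          TouchZ-borel i j = ∃-borel ρ {f = proj₁} proj₁-measurable {P = TouchV i j}
            (λ { {z , z'} {v} (_ , (Zz , _) , d , _) → D-ball {z} {v} Zz i d }) (TouchV-borel i j)

          ConfPair : Fin J → Fin J → Pred (V × V) 0ℓ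
          ConfPair i j p = Conf (proj₁ p) i (proj₂ p) j

          Conf-borel : ∀ i j → Borel (ConfPair i j)
          Conf-borel i j = resp {A = Split} (to , from) (σ-∩ (TouchZ-borel i j) (σ-∁ differ))
            where
            Same : Pred (V × V) 0ℓ
            Same p = proj₁ p ≡ proj₂ p
            Split : Pred (V × V) 0ℓ
            Split p = TouchZ i j p × ¬ Same p
            differ : Borel Same
            differ = ≡-Borel {f = proj₁} {proj₂} proj₁-measurable proj₂-measurable
            to : ∀ {p} → Split p → ConfPair i j p
            to {z , z'} ((v , v' , ZZ , t) , ne) = (ZZ , ne) , v , v' , t
            from : ∀ {p} → ConfPair i j p → Split p
            from {z , z'} ((ZZ , ne) , v , v' , t) = (v , v' , ZZ , t) , ne

          Owned : V → Set
          Owned v = ∃ λ j → D j (root v) v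

          record-owner : ∀ v → Dec (Owned v) → List (V × Fin J)
          record-owner v (yes (j , _)) = (root v , j) ∷ []
          record-owner v (no _)        = []

          owner : V → List (V × Fin J)
          owner v = record-owner v em

          owner-length : ∀ v → length (owner v) ≤ 1
          owner-length v = go em
            where
            go : (d : Dec (Owned v)) → length (record-owner v d) ≤ 1
            go (yes _) = s≤s z≤n
            go (no _)  = z≤n

          owner-self : ∀ {v} → Z (root v) → ∀ j → D j (root v) v → (root v , j) ∈ owner v
          owner-self {v} Zr j d = go em
            where
            go : (o : Dec (Owned v)) → (root v , j) ∈ record-owner v o
            go (yes (i , d')) = here (cong (root v ,_) (D-unique {root v} {v} Zr {j} {i} d d'))
            go (no none)      = ⊥-elim (none (j , d))

          owner-covers : ∀ {z v} → Z z → ∀ j → D j z v → (z , j) ∈ owner v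
          owner-covers {z} {v} Zz j d = subst (λ w → (w , j) ∈ owner v) e
            (owner-self {v} (subst Z (sym e) Zz) j (subst (λ w → D j w v) (sym e) d))
            where
            e : root v ≡ z
            e = D-root {z} {v} Zz j d

          Conf-bounded : ∀ z i → ∃ λ (ys : List (V × Fin J)) → length ys ≤ κ × (∀ {z' j} → Conf z i z' j → (z' , j) ∈ ys)
          Conf-bounded z i = concatMap around (descendants (spot i z)) ,
            ≤-trans (concatMap-length around Δ around-length (descendants (spot i z)))
              (*-monoˡ-≤ Δ (descendants-length (spot i z))) , covers
            where
            around : V → List (V × Fin J)
            around v = concatMap owner (neighbours v)
            around-length : ∀ v → length (around v) ≤ Δ
            around-length v = ≤-trans (concatMap-length owner 1 owner-length (neighbours v))
              (≤-reflexive (trans (*-identityʳ _) (length-tabulate (λ i → φ i v))))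
            covers : ∀ {z' j} → Conf z i z' j → (z' , j) ∈ concatMap around (descendants (spot i z))
            covers {z'} {j} (((Zz , Zz') , _) , v , v' , d , d' , a) = ∈-concatMap⁺ around (lose
              (descendants-covers {spot i z} {v} (proj₂ (spot-low Zz i)) (D-below {z} {v} Zz i d))
              (∈-concatMap⁺ owner (lose (∈-neighbours a) (owner-covers {z'} {v'} Zz' j d'))))

          Conf-near : ∀ {z i z' j} → Conf z i z' j → Ball R z z'
          Conf-near {z} {i} {z'} {j} (((Zz , Zz') , _) , v , v' , d , d' , a) =
            ball-trans ρ {suc ρ} {z} {v} {z'} (D-ball {z} {v} Zz i d)
              (v' , inj₂ a , ball-sym ρ {z'} {v'} (D-ball {z'} {v'} Zz' j d'))

          Conf-sym : ∀ {z i z' j} → Conf z i z' j → Conf z' j z i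
          Conf-sym (((Zz , Zz') , ne) , v , v' , d , d' , a) = ((Zz' , Zz) , ne ∘ sym) , v' , v , d' , d , symmetric a

        conflicts : ∀ m (4κ≤m : 4 * κ ≤ m) (1≤m : 1 ≤ m) → Select.Conflicts G m κ R 4κ≤m 1≤m J
        conflicts m 4κ≤m 1≤m = record
          { Conf    = Conf
          ; borel   = Conf-borel
          ; sym-c   = λ {x} {i} {y} {j} → Conf-sym {x} {i} {y} {j}
          ; near    = λ {x} {i} {y} {j} → Conf-near {x} {i} {y} {j}
          ; apart   = λ {x} {i} {y} {j} c → proj₂ (proj₁ c)
          ; bounded = Conf-bounded }

  -- The Borel colouring, layer by layer.

  module LayeredColouring where
    open Classical
    open BorelSets
    open BorelGraphs
    open FiniteColouring
    open PointerForest
    open SlackSpots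

    fin-pred : {X : Set} {{_ : Coded X}} {k : ℕ} {f : X → Fin k} → ℕ-Measurable f →
      (P : Fin k → Pred X 0ℓ) → (∀ i → Borel (P i)) → Borel (λ x → P (f x) x)
    fin-pred {f = f} mf P b = resp {A = λ x → ∃ λ i → f x ≡ i × P i x}
      ((λ { (i , refl , p) → p }) , λ p → _ , refl , p) (σ-Fin∃ λ i → σ-∩ (mf i) (b i))

    countable-fin : ∀ {k} → Fin k → Countable (Fin k)
    countable-fin {suc k} _ = Fin-countable

    module Layers {V : Set} {{cV : Coded V}} {Δ : ℕ} (G : BoundedGraph V Δ) (3≤Δ : 3 ≤ Δ)
      (no-clique : ∀ (c : Fin (suc Δ) → V) → ¬ (∀ i j → i ≢ j → BoundedGraph.Adj G (c i) (c j))) where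
      open BoundedGraph G
      open Graphs G
      open Colour G 3≤Δ no-clique

      private
        instance
          colours-countable : Countable (Fin Δ)
          colours-countable = countable-fin some-colour

      record BorelColouring (P : Pred V 0ℓ) : Set₁ where
        field
          colour     : V → Fin Δ
          measurable : ℕ-Measurable colour
          proper     : Proper P colour

      -- Slack that survives every order of colouring `L`: a neighbour outside both sets stays
      -- uncoloured throughout, and equal colours in `P` are never changed.
      Robust : Pred V 0ℓ → Pred V 0ℓ → (V → Fin Δ) → V → Set
      Robust P L g v = (∃ λ y → Adj v y × ¬ P y × ¬ L y) ⊎
        (∃₂ λ y z → y ≢ z × (Adj v y × Adj v z) × (P y × P z) × g y ≡ g z)

      module _ {P L : Pred V 0ℓ} (P-borel : Borel P) (L-borel : Borel L) (K : BorelColouring P)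
        (disjoint : ∀ {v} → L v → ¬ P v) (robust : ∀ {v} → L v → Robust P L (BorelColouring.colour K) v) where
        open BorelColouring K

        private
          abstract
            c-data : ∃ λ (c : V → ℕ) → ℕ-Measurable c × (∀ {u v} → Ball 1 u v → c u ≡ c v → u ≡ v)
            c-data = countable-colouring 1

          c : V → ℕ
          c = proj₁ c-data

          Done : ℕ → Pred V 0ℓ
          Done n v = P v ⊎ (L v × c v < n)

          c<-borel : ∀ n → Borel (λ v → c v < n)
          c<-borel n = ℕ-measurable-pred (proj₁ (proj₂ c-data)) (λ m _ → m < n) (λ m → σ-const (m < n))

          Done-borel : ∀ n → Borel (Done n)
          Done-borel n = σ-∪ P-borel (σ-∩ L-borel (c<-borel n))

          Available : ℕ → (V → Fin Δ) → ℕ → Pred V 0ℓ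
          Available n g k v = Free (Done n) g v (enum k)

          pick : ℕ → (V → Fin Δ) → V → Fin Δ
          pick n g v = enum (least (Available n g) v)

          Now : ℕ → Pred V 0ℓ
          Now n v = L v × c v ≡ n

          update : ∀ {A : Set} → Dec A → Fin Δ → Fin Δ → Fin Δ
          update (yes _) i _ = i
          update (no _)  _ j = j

          step : ℕ → (V → Fin Δ) → V → Fin Δ
          step n g v = update (em {P = Now n v}) (pick n g v) (g v)

          step-now : ∀ n g {v} → Now n v → step n g v ≡ pick n g v
          step-now n g {v} now = go em
            where
            go : (d : Dec (Now n v)) → update d (pick n g v) (g v) ≡ pick n g v
            go (yes _) = refl
            go (no ¬n) = ⊥-elim (¬n now)

          step-keep : ∀ n g {v} → ¬ Now n v → step n g v ≡ g v
          step-keep n g {v} ¬now = go em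
            where
            go : (d : Dec (Now n v)) → update d (pick n g v) (g v) ≡ g v
            go (yes now) = ⊥-elim (¬now now)
            go (no _) = refl

          stages : ℕ → V → Fin Δ
          stages zero    = colour
          stages (suc n) = step n (stages n)

          Available-borel : ∀ n {g} → ℕ-Measurable g → ∀ k → Borel (Available n g k)
          Available-borel n {g} mg k = resp {A = λ v → ¬ ∃ λ y → Adj v y × Done n y × g y ≡ enum k}
            ((λ none y a d e → none (y , a , d , e)) , λ free (y , a , d , e) → free y a d e)
            (σ-∁ (∃Adj-borel {f = λ v → v} id-measurable {P = λ (v , y) → Done n y × g y ≡ enum k}
              (σ-∩ (proj₂-measurable (Done-borel n)) (proj₂-measurable (mg (enum k))))))

          Now-borel : ∀ n → Borel (Now n)
          Now-borel n = σ-∩ L-borel (proj₁ (proj₂ c-data) n)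

          step-measurable : ∀ n {g} → ℕ-Measurable g → ℕ-Measurable (step n g)
          step-measurable n {g} mg i = resp {A = λ v → (Now n v × pick n g v ≡ i) ⊎ (¬ Now n v × g v ≡ i)}
            (to , from)
            (σ-∪ (σ-∩ (Now-borel n) (ℕ-measurable-pred (least-measurable {P = Available n g} (Available-borel n mg))
                    (λ k _ → enum k ≡ i) (λ k → σ-const (enum k ≡ i))))
                 (σ-∩ (σ-∁ (Now-borel n)) (mg i)))
            where
            to : ∀ {v} → (Now n v × pick n g v ≡ i) ⊎ (¬ Now n v × g v ≡ i) → step n g v ≡ i
            to (inj₁ (now , e)) = trans (step-now n g now) e
            to (inj₂ (¬now , e)) = trans (step-keep n g ¬now) e
            from : ∀ {v} → step n g v ≡ i → (Now n v × pick n g v ≡ i) ⊎ (¬ Now n v × g v ≡ i)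
            from {v} e = go (em {P = Now n v})
              where
              go : Dec (Now n v) → (Now n v × pick n g v ≡ i) ⊎ (¬ Now n v × g v ≡ i)
              go (yes now) = inj₁ (now , trans (sym (step-now n g now)) e)
              go (no ¬now) = inj₂ (¬now , trans (sym (step-keep n g ¬now)) e)

          stages-measurable : ∀ n → ℕ-Measurable (stages n)
          stages-measurable zero    = measurable
          stages-measurable (suc n) = step-measurable n (stages-measurable n)

          stages-P : ∀ n {v} → P v → stages n v ≡ colour v
          stages-P zero    p = refl
          stages-P (suc n) p = trans (step-keep n (stages n) (λ now → disjoint (proj₁ now) p)) (stages-P n p)

          stages-later : ∀ {m n v} → m ≤ n → c v < m → stages n v ≡ stages m v
          stages-later {m} {n} {v} m≤n lt = go (m≤n⇒m<n∨m≡n m≤n)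
            where
            go : m < n ⊎ m ≡ n → stages n v ≡ stages m v
            go (inj₂ refl) = refl
            go (inj₁ (s≤s {n = n'} m≤n')) = trans
              (step-keep n' (stages n') (λ now → <-irrefl (proj₂ now) (<-≤-trans lt m≤n')))
              (stages-later m≤n' lt)

          stages-proper : ∀ n → Proper (Done n) (stages n)
          pick-free : ∀ n {v} → Now n v → Free (Done n) (stages n) v (stages (suc n) v)

          pick-free n {v} now = subst (Free (Done n) (stages n) v) (sym (step-now n (stages n) now))
            (proj₁ (least-spec (Available n (stages n)) {v} {index (proj₁ free)}
              (subst (Free (Done n) (stages n) v) (sym (enum-index (proj₁ free))) (proj₂ free))))
            where
            slack : Robust P L colour v → (∃ λ y → Adj v y × ¬ Done n y) ⊎ (¬ Full v ⊎
              ∃₂ λ y z → y ≢ z × Adj v y × Adj v z × stages n y ≡ stages n z)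
            slack (inj₁ (y , a , ¬p , ¬l)) = inj₁ (y , a , λ { (inj₁ p) → ¬p p ; (inj₂ (l , _)) → ¬l l })
            slack (inj₂ (y , z , ne , (ay , az) , (py , pz) , e)) =
              inj₂ (inj₂ (y , z , ne , ay , az , trans (stages-P n py) (trans e (sym (stages-P n pz)))))
            free : ∃ λ i → Free (Done n) (stages n) v i
            free = free-colour {Done n} {stages n} {v} (slack (robust (proj₁ now)))

          stages-proper zero (inj₁ p) (inj₁ q) a = proper p q a
          stages-proper (suc n) {u} {v} du dv a e = cases (split du) (split dv)
            where
            split : ∀ {w} → Done (suc n) w → Done n w ⊎ Now n w
            split (inj₁ p) = inj₁ (inj₁ p)
            split (inj₂ (l , lt)) with m<1+n⇒m<n∨m≡n lt
            ... | inj₁ lt' = inj₁ (inj₂ (l , lt'))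
            ... | inj₂ eq = inj₂ (l , eq)
            kept : ∀ {w} → Done n w → stages (suc n) w ≡ stages n w
            kept (inj₁ p) = trans (stages-P (suc n) p) (sym (stages-P n p))
            kept (inj₂ (_ , lt)) = stages-later (n≤1+n n) lt
            cases : Done n u ⊎ Now n u → Done n v ⊎ Now n v → ⊥
            cases (inj₁ d) (inj₁ d') = stages-proper n d d' a (trans (sym (kept d)) (trans e (kept d')))
            cases (inj₂ now) (inj₁ d') = pick-free n now v a d' (trans (sym (kept d')) (sym e))
            cases (inj₁ d) (inj₂ now) = pick-free n now u (symmetric a) d (trans (sym (kept d)) e)
            cases (inj₂ now) (inj₂ now') = loopless (subst (Adj u)
              (sym (proj₂ (proj₂ c-data) (adj-ball a) (trans (proj₂ now) (sym (proj₂ now'))))) a)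

          limit : V → Fin Δ
          limit v = stages (suc (c v)) v

          limit-stages : ∀ {n v} → Done n v → c v < n → limit v ≡ stages n v
          limit-stages {n} {v} _ lt = sym (stages-later {suc (c v)} {n} lt ≤-refl)

        abstract
          -- `L` may contain edges, so it is treated in countably many stages: stage `n` colours the
          -- vertices of `L` with `c v ≡ n`, an independent set. The colour of `v` is final after
          -- stage `c v`, hence the limit exists and is Borel.
          extend-layer : Σ (BorelColouring (λ v → P v ⊎ L v)) λ K' →
            ∀ {v} → P v → BorelColouring.colour K' v ≡ colour v
          extend-layer = record
            { colour = limit
            ; measurable = λ i → ℕ-measurable-pred (proj₁ (proj₂ c-data)) (λ n v → stages (suc n) v ≡ i)
                (λ n → stages-measurable (suc n) i)
            ; proper = λ {u} {v} pu pv a e →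
                let n = suc (c u + c v)
                    u<n = s≤s (m≤m+n (c u) (c v))
                    v<n = s≤s (m≤n+m (c v) (c u))
                in stages-proper n (done u<n pu) (done v<n pv) a
                     (trans (sym (limit-stages (done u<n pu) u<n)) (trans e (limit-stages (done v<n pv) v<n))) } ,
            λ {v} p → stages-P (suc (c v)) p
            where
            done : ∀ {n v} → c v < n → P v ⊎ L v → Done n v
            done lt (inj₁ p) = inj₁ p
            done lt (inj₂ l) = inj₂ (l , lt)

      module _ (S T : Pred V 0ℓ) where

        Reach-borel : Borel S → Borel T → ∀ n → Borel (Reach S T n)
        Reach-borel bS bT zero = resp ((λ t → stop t) , λ { (stop t) → t }) bT
        Reach-borel bS bT (suc n) = resp {A = λ v → ∃ λ w → Adj v w × S w × Reach S T n w}
          ((λ (w , a , s , r) → via a s r) , λ { (via a s r) → _ , a , s , r })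
          (∃Adj-borel {f = λ v → v} id-measurable {P = λ (_ , w) → S w × Reach S T n w}
            (σ-∩ (proj₂-measurable bS) (proj₂-measurable (Reach-borel bS bT n))))

        rank-measurable : Borel S → Borel T → ℕ-Measurable (rank S T)
        rank-measurable bS bT = least-measurable {P = λ n x → Reach S T n x} (Reach-borel bS bT)

    module Final {V : Set} {{cV : Coded V}} {Δ : ℕ} (G : BoundedGraph V Δ) (3≤Δ : 3 ≤ Δ)
      (no-clique : ∀ (c : Fin (suc Δ) → V) → ¬ (∀ i j → i ≢ j → BoundedGraph.Adj G (c i) (c j))) (r : ℕ)
      (n J : ℕ) (J≤ : J ≤ 2 ^ n) (room : suc (n + n + (Δ + Δ)) ≤ r) where
      open BoundedGraph G
      open Graphs G
      open Colour G 3≤Δ no-clique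
      open Cell G 3≤Δ no-clique r
      open Spot G 3≤Δ no-clique r
      open Family n J J≤ room
      open Layers G 3≤Δ no-clique

      module _ (f : V → Fin J) (f-measurable : ℕ-Measurable f) (independent : ∀ {x y} → ¬ Conf x (f x) y (f y)) where

        private
          -- `A` consists of the pairs to be coloured alike, `U` of the pieces they cut off, `T` of
          -- the vertices gaining slack, and `W` of the balls around `Y` left to the end.
          A U T W : Pred V 0ℓ
          A v = Z (root v) × (v ≡ aₛ (f (root v)) (root v) ⊎ v ≡ bₛ (f (root v)) (root v))
          U v = Z (root v) × D (f (root v)) (root v) v
          T v = Z (root v) × v ≡ tₛ (f (root v)) (root v)
          W v = ∃ λ y → Ball R₁ v y × Y y

          f-root-measurable : ℕ-Measurable (λ v → f (root v))
          f-root-measurable i = root-measurable (f-measurable i)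

          A-borel : Borel A
          A-borel = σ-∩ (root-measurable Z-borel) (fin-pred f-root-measurable
            (λ j v → v ≡ aₛ j (root v) ⊎ v ≡ bₛ j (root v)) (λ j → σ-∪
              (≡-Borel {f = λ v → v} {λ v → aₛ j (root v)} id-measurable (λ b → root-measurable (aₛ-measurable j b)))
              (≡-Borel {f = λ v → v} {λ v → bₛ j (root v)} id-measurable (λ b → root-measurable (bₛ-measurable j b)))))

          T-borel : Borel T
          T-borel = σ-∩ (root-measurable Z-borel) (fin-pred f-root-measurable
            (λ j v → v ≡ tₛ j (root v)) (λ j →
              ≡-Borel {f = λ v → v} {λ v → tₛ j (root v)} id-measurable (λ b → root-measurable (tₛ-measurable j b))))

          W-borel : Borel W
          W-borel = ∃Ball-borel R₁ {f = λ v → v} id-measurable {P = λ (_ , y) → Y y} (proj₂-measurable Y-borel)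

          triple : ∀ {z} → Z z → Triple (spot (f z) z) (tₛ (f z) z) (aₛ (f z) z) (bₛ (f z) z)
          triple {z} Zz = spot-triple Zz (f z)

          A⇒U : ∀ {v} → A v → U v
          A⇒U {v} (Zr , inj₁ e) = Zr , inj₁ (0 , e , cong δ e)
          A⇒U {v} (Zr , inj₂ e) = Zr , inj₂ (0 , e , cong δ e)

          U-desc : ∀ {v w} → Desc v w → U w → U v
          U-desc {v} {w} d (Zr , u) = subst (λ z → Z z × D (f z) z v) (sym (desc-root {v} {w} d)) (Zr , deeper u)
            where
            deeper : D (f (root w)) (root w) w → D (f (root w)) (root w) v
            deeper (inj₁ d') = inj₁ (desc-trans {v} {w} d d')
            deeper (inj₂ d') = inj₂ (desc-trans {v} {w} d d')

          clash : ∀ {v w} → U v → U w → Adj v w → root v ≡ root w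
          clash {v} {w} (Zv , dv) (Zw , dw) a = dne λ ne → independent {root v} {root w} (((Zv , Zw) , ne) , v , w , dv , dw , a)

          A-independent : ∀ {v w} → A v → A w → ¬ Adj v w
          A-independent {v} {w} av aw a = go (clash (A⇒U av) (A⇒U aw) a) av aw
            where
            same : ∀ {z} → Z z → (v ≡ aₛ (f z) z ⊎ v ≡ bₛ (f z) z) → (w ≡ aₛ (f z) z ⊎ w ≡ bₛ (f z) z) → ⊥
            same {z} Zz (inj₁ e) (inj₁ e') = loopless (subst (Adj v) (trans e' (sym e)) a)
            same {z} Zz (inj₂ e) (inj₂ e') = loopless (subst (Adj v) (trans e' (sym e)) a)
            same {z} Zz (inj₁ e) (inj₂ e') = proj₂ (proj₂ (proj₂ (proj₁ (proj₂ (triple Zz))))) (subst₂ Adj e e' a)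
            same {z} Zz (inj₂ e) (inj₁ e') = proj₂ (proj₂ (proj₂ (proj₁ (proj₂ (triple Zz))))) (subst₂ Adj e' e (symmetric a))
            go : root v ≡ root w → A v → A w → ⊥
            go e (Zv , ev) (_ , ew) = same {root v} Zv ev
              (subst (λ z → w ≡ aₛ (f z) z ⊎ w ≡ bₛ (f z) z) (sym e) ew)

          desc-flat : ∀ {v w} → Desc v w → δ v ≤ δ w → v ≡ w
          desc-flat (zero , e , _) _ = e
          desc-flat {v} {w} (suc k , _ , d) le =
            ⊥-elim (1+n≰n (≤-trans (s≤s (m≤n+m (δ w) k)) (≤-trans (≤-reflexive (sym d)) le)))

          -- This is one use of `δ t ≤ δ a` and `δ t ≤ δ b`: at such depths `t` could lie below `a`
          -- or `b` only by being equal to it, but it is adjacent to both.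
          T⇒¬U : ∀ {v} → T v → ¬ U v
          T⇒¬U {v} (Zr , e) (_ , d) = absurd d
            where
            z = root v
            tr = triple Zr
            below : ∀ {x} → Adj (tₛ (f z) z) x → δ (tₛ (f z) z) ≤ δ x → ¬ Desc v x
            below {x} a le d = loopless (subst (Adj (tₛ (f z) z))
              (sym (desc-flat {tₛ (f z) z} {x} (subst (λ w → Desc w x) e d) le)) a)
            absurd : ¬ D (f z) z v
            absurd (inj₁ d) = below (proj₁ (proj₁ (proj₂ tr))) (proj₁ (proj₂ (proj₂ tr))) d
            absurd (inj₂ d) = below (proj₁ (proj₂ (proj₁ (proj₂ tr)))) (proj₂ (proj₂ (proj₂ tr))) d

          near⇒¬U : ∀ {v} → NearY v → ¬ U v
          near⇒¬U near (Zr , _) = cell-not-near Zr near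

          S Target : Pred V 0ℓ
          S v = ¬ A v
          Target v = T v ⊎ W v

          S-borel : Borel S
          S-borel = σ-∁ A-borel

          Target-borel : Borel Target
          Target-borel = σ-∪ T-borel W-borel

          RS : ℕ → V → Set
          RS = Reach S Target

          -- `U` is closed under descendants, so all ancestors of a vertex outside `U` are outside
          -- `U` and thus outside `A`. The pointer path can be used upwards, and in `descend`
          -- backwards.
          climb : ∀ k {m v w} → At k v w → ¬ U v → RS m w → RS (k + m) v
          climb zero (refl , _) ¬u r = r
          climb (suc k) {v = v} {w} at ¬u r =
            let (a , at₁ , rest) = at-step {k} {v} {w} at
                ¬u' : ¬ U (π v)
                ¬u' u = ¬u (U-desc {v} {π v} (1 , at₁) u)
            in via a (¬u' ∘ A⇒U) (climb k rest ¬u' r)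

          descend : ∀ k {m v w} → At k v w → ¬ U v → RS m v → RS (k + m) w
          descend zero (refl , _) ¬u r = r
          descend (suc k) {m} {v} {w} at ¬u r =
            let (a , at₁ , rest) = at-step {k} {v} {w} at
                ¬u' : ¬ U (π v)
                ¬u' u = ¬u (U-desc {v} {π v} (1 , at₁) u)
            in subst (λ i → RS i w) (+-suc k m) (descend k rest ¬u' (via (symmetric a) (¬u ∘ A⇒U) r))

          reach-Y : ∀ k {v y} → k ≤ D₀ → Ball k v y → Y y → ∃ λ m → m ≤ k × RS m v
          reach-Y zero _ refl Yy = 0 , z≤n , stop (inj₂ (_ , ball-refl R₁ , Yy))
          reach-Y (suc k) {v} le (w , inj₁ refl , b) Yy =
            let (m , m≤k , r) = reach-Y k (<⇒≤ le) b Yy in m , m≤n⇒m≤1+n m≤k , r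
          reach-Y (suc k) {v} {y} le (w , inj₂ a , b) Yy =
            let (m , m≤k , r) = reach-Y k (<⇒≤ le) b Yy
                near : NearY w
                near = y , ball-mono (<⇒≤ le) b , Yy
            in suc m , s≤s m≤k , via a (near⇒¬U near ∘ A⇒U) r

          -- A root near `Y` walks to `Y` through vertices near `Y`, which are never in `U`. A root
          -- in `Z` goes down the reversed pointer path of its own `t`, which is outside `U`.
          reach-root : ∀ {o} → Source o → ∃ λ m → m ≤ ρ + D₀ × RS m o
          reach-root {o} (inj₁ (y , b , Yy)) = let (m , le , r) = reach-Y D₀ ≤-refl b Yy in m , ≤-trans le (m≤n+m D₀ ρ) , r
          reach-root {z} (inj₂ Zz) = δ t + 0 , ≤-trans (≤-reflexive (+-identityʳ (δ t))) (≤-trans (δ≤ρ t) (m≤m+n ρ D₀)) ,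
            descend (δ t) (subst (At (δ t) t) t-root (at-root t)) (T⇒¬U Tt) (stop (inj₁ Tt))
            where
            t = tₛ (f z) z
            t-root : root t ≡ z
            t-root = below-spot-root {z} {t} Zz (f z) (proj₁ (proj₁ (triple Zz)))
            Tt : T t
            Tt = subst (λ z' → Z z' × t ≡ tₛ (f z') z') (sym t-root) (Zz , refl)

          reach-outside : ∀ {v} → ¬ U v → ∃ λ m → m ≤ ρ + (ρ + D₀) × RS m v
          reach-outside {v} ¬u = let (m , le , r) = reach-root (root-source v) in
            δ v + m , +-mono-≤ (δ≤ρ v) le , climb (δ v) (at-root v) ¬u r

          -- One generation below `y`, the vertex `x` would be adjacent to it; two or more below,
          -- `δ x` would be at least `δ y + 2`, yet `x` is a neighbour of `t`, so `δ x` is at most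
          -- `δ t + 1`.
          not-nested : ∀ {x y t} → Adj t x → Adj t y → δ t ≤ δ y → x ≢ y → ¬ Adj x y → ¬ Desc x y
          not-nested tx ty le x≢y ¬a (zero , e , _) = x≢y e
          not-nested {x} {y} tx ty le x≢y ¬a (suc zero , at) =
            ¬a (subst (Adj x) (proj₁ at) (proj₁ (at-step {0} {x} {y} at)))
          not-nested {x} {y} {t} tx ty le x≢y ¬a (suc (suc k) , _ , d) = 1+n≰n (≤-trans (s≤s (s≤s (m≤n+m (δ y) k)))
            (≤-trans (≤-reflexive (sym d)) (≤-trans (δ-lipschitz (symmetric tx)) (s≤s le))))

          child-outside-A : ∀ {v q} → U v → At 1 q v → ¬ A q
          child-outside-A {v} {q} (Zv , dv) at (_ , aq) = contra dv (subst
            (λ z → q ≡ aₛ (f z) z ⊎ q ≡ bₛ (f z) z) (desc-root {q} {v} (1 , at)) aq)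
            where
            z = root v
            tr = triple Zv
            ta = proj₁ (proj₁ (proj₂ tr))
            tb = proj₁ (proj₂ (proj₁ (proj₂ tr)))
            a≢b = proj₁ (proj₂ (proj₂ (proj₁ (proj₂ tr))))
            a≁b = proj₂ (proj₂ (proj₂ (proj₁ (proj₂ tr))))
            strict : ∀ {x} → q ≡ x → ¬ Desc v x
            strict {x} e d = 1+n≰n (≤-trans (s≤s (desc-δ {v} {x} d)) (≤-trans (≤-reflexive (sym (proj₂ at))) (≤-reflexive (cong δ e))))
            through : ∀ {x y} → q ≡ x → Desc v y → Desc x y
            through {x} {y} e d = subst (λ w → Desc w y) e (desc-trans {q} {v} {y} (1 , at) d)
            contra : D (f z) z v → (q ≡ aₛ (f z) z ⊎ q ≡ bₛ (f z) z) → ⊥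
            contra (inj₁ d) (inj₁ e) = strict e d
            contra (inj₂ d) (inj₂ e) = strict e d
            contra (inj₁ d) (inj₂ e) = not-nested tb ta (proj₁ (proj₂ (proj₂ tr))) (a≢b ∘ sym) (a≁b ∘ symmetric) (through e d)
            contra (inj₂ d) (inj₁ e) = not-nested ta tb (proj₂ (proj₂ (proj₂ tr))) a≢b a≁b (through e d)

          -- The escape from a piece cut off: children of its vertices are never in `A`, so one can
          -- go down to a pointer-leaf, which has a neighbour in another cell. That neighbour is
          -- outside `U`, because the selected spots do not conflict. `k` is fuel.
          reach-inside : ∀ k {v} → ρ ≤ k + δ v → U v → ∃ λ m → m ≤ k + suc (ρ + (ρ + D₀)) × RS m v
          reach-inside k {v} le u with em {P = ∃ λ q → At 1 q v}
          ... | no leaf = let (c , a , ne) = leaf-exit (proj₁ u) leaf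
                              ¬uc : ¬ U c
                              ¬uc uc = ne (sym (clash u uc a))
                              (m , m≤ , r) = reach-outside ¬uc
                          in suc m , ≤-trans (s≤s m≤) (m≤n+m _ k) , via a (¬uc ∘ A⇒U) r
          reach-inside zero {v} le u | yes (q , at) =
            ⊥-elim (1+n≰n (≤-trans (s≤s le) (≤-trans (≤-reflexive (sym (proj₂ at))) (δ≤ρ q))))
          reach-inside (suc k) {v} le u | yes (q , at) =
            let (m , m≤ , r) = reach-inside k {q} (≤-trans le (≤-reflexive (trans (sym (+-suc k (δ v))) (cong (k +_) (sym (proj₂ at))))))
                                 (U-desc {q} {v} (1 , at) u)
            in suc m , s≤s m≤ , via (symmetric (subst (Adj q) (proj₁ at) (proj₁ (at-step {0} {q} {v} at)))) (child-outside-A u at) r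

          N : ℕ
          N = ρ + suc (ρ + (ρ + D₀))

          reach-target : ∀ v → ∃ λ m → m ≤ N × RS m v
          reach-target v with em {P = U v}
          ... | yes u = reach-inside ρ (m≤m+n ρ (δ v)) u
          ... | no ¬u = let (m , le , r) = reach-outside ¬u in m , ≤-trans le (≤-trans (n≤1+n _) (m≤n+m _ ρ)) , r

          level : V → ℕ
          level = rank S Target

          level≤N : ∀ v → level v ≤ N
          level≤N v = let (m , le , r) = reach-target v in ≤-trans (rank≤ r) le

          level-measurable : ℕ-Measurable level
          level-measurable = rank-measurable S Target S-borel Target-borel

          level-zero : ∀ {v} → level v ≡ 0 → Target v
          level-zero {v} e = go (subst (λ k → RS k v) e (rank-reach (proj₂ (proj₂ (reach-target v)))))
            where
            go : RS 0 v → Target v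
            go (stop t) = t

          target-level : ∀ {v} → Target v → level v ≡ 0
          target-level t = n≤0⇒n≡0 (rank≤ (stop t))

          Above : ℕ → Pred V 0ℓ
          Above k v = A v ⊎ (S v × k ≤ level v)

          level-pred-borel : (P : ℕ → Set) → Borel (λ v → P (level v))
          level-pred-borel P = ℕ-measurable-pred level-measurable (λ m _ → P m) (λ m → σ-const (P m))

          Above-borel : ∀ k → Borel (Above k)
          Above-borel k = σ-∪ A-borel (σ-∩ S-borel (level-pred-borel (k ≤_)))

          Partial : Pred V 0ℓ → Set₁
          Partial P = Σ (BorelColouring P) λ K → ∀ {v} → A v → BorelColouring.colour K v ≡ some-colour

          restrict-colouring : ∀ {P Q} → (∀ {v} → Q v → P v) → Partial P → Partial Q
          restrict-colouring sub (K , e) = record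
            { colour = BorelColouring.colour K ; measurable = BorelColouring.measurable K
            ; proper = proper-mono sub (BorelColouring.proper K) } , e

          -- Levels are at most `N`, so only `A` is coloured here. It is independent: within a cell
          -- by the choice of triples, across cells by the absence of conflicts.
          top-colouring : Partial (Above (suc N))
          top-colouring = record
            { colour = λ _ → some-colour
            ; measurable = λ i → σ-const (some-colour ≡ i)
            ; proper = λ pu pv a _ → A-independent (only-A pu) (only-A pv) a } , λ _ → refl
            where
            only-A : ∀ {v} → Above (suc N) v → A v
            only-A (inj₁ a) = a
            only-A {v} (inj₂ (_ , le)) = ⊥-elim (1+n≰n (≤-trans le (level≤N v)))

          -- A vertex of positive level has a neighbour of smaller level outside `A`. It is still
          -- uncoloured and provides the slack for this layer.
          next-colouring : ∀ k → Partial (Above (suc (suc k))) → Partial (Above (suc k))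
          next-colouring k (K , e) = restrict-colouring split (proj₁ extended , λ a → trans (proj₂ extended (inj₁ a)) (e a))
            where
            L : Pred V 0ℓ
            L v = S v × level v ≡ suc k
            L-borel : Borel L
            L-borel = σ-∩ S-borel (level-measurable (suc k))
            disjoint : ∀ {v} → L v → ¬ Above (suc (suc k)) v
            disjoint (s , _) (inj₁ a) = s a
            disjoint (_ , e) (inj₂ (_ , le)) = 1+n≰n (≤-trans le (≤-reflexive e))
            robust : ∀ {v} → L v → Robust (Above (suc (suc k))) L (BorelColouring.colour K) v
            robust {v} (_ , e) =
              let (w , a , s , _ , lt) = rank-descend (proj₂ (proj₂ (reach-target v)))
                    (λ t → 0≢1+n (trans (sym (target-level t)) e))
                  lt' : level w < suc k
                  lt' = ≤-trans lt (≤-reflexive e)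
              in inj₁ (w , a , (λ { (inj₁ aw) → s aw ; (inj₂ (_ , le)) → <-irrefl refl (<-≤-trans lt' (≤-trans (n≤1+n _) le)) }) ,
                       λ (_ , e') → <-irrefl e' lt')
            extended = extend-layer (Above-borel (suc (suc k))) L-borel K disjoint robust
            split : ∀ {v} → Above (suc k) v → Above (suc (suc k)) v ⊎ L v
            split (inj₁ a) = inj₁ (inj₁ a)
            split (inj₂ (s , le)) with m≤n⇒m<n∨m≡n le
            ... | inj₁ lt = inj₁ (inj₂ (s , lt))
            ... | inj₂ eq = inj₂ (s , sym eq)

          layers : ∀ k → Partial (Above (suc k)) → Partial (Above 1)
          layers zero    K = K
          layers (suc k) K = layers k (next-colouring k K)

          T⇒S : ∀ {v} → T v → S v
          T⇒S t = T⇒¬U t ∘ A⇒U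

          colour-outside-W : BorelColouring (λ v → ¬ W v)
          colour-outside-W = proj₁ (restrict-colouring split
            (proj₁ extended , λ a → trans (proj₂ extended (inj₁ a)) (proj₂ K a)))
            where
            K = layers N top-colouring
            disjoint : ∀ {v} → T v → ¬ Above 1 v
            disjoint t (inj₁ a) = T⇒S t a
            disjoint t (inj₂ (_ , le)) = 1+n≰n (≤-trans le (≤-reflexive (target-level (inj₁ t))))
            robust : ∀ {v} → T v → Robust (Above 1) T (BorelColouring.colour (proj₁ K)) v
            robust {v} (Zr , e) = inj₂ (aₛ (f z) z , bₛ (f z) z , proj₁ (proj₂ (proj₂ (proj₁ (proj₂ tr)))) ,
              (subst (λ w → Adj w (aₛ (f z) z)) (sym e) (proj₁ (proj₁ (proj₂ tr))) ,
               subst (λ w → Adj w (bₛ (f z) z)) (sym e) (proj₁ (proj₂ (proj₁ (proj₂ tr))))) ,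
              (inj₁ Aa , inj₁ Ab) , trans (proj₂ K Aa) (sym (proj₂ K Ab)))
              where
              z = root v
              tr = triple Zr
              a-root : root (aₛ (f z) z) ≡ z
              a-root = below-spot-root {z} {aₛ (f z) z} Zr (f z) (proj₁ (proj₂ (proj₁ tr)))
              b-root : root (bₛ (f z) z) ≡ z
              b-root = below-spot-root {z} {bₛ (f z) z} Zr (f z) (proj₂ (proj₂ (proj₁ tr)))
              Aa : A (aₛ (f z) z)
              Aa = subst (λ y → Z y × (aₛ (f z) z ≡ aₛ (f y) y ⊎ aₛ (f z) z ≡ bₛ (f y) y)) (sym a-root) (Zr , inj₁ refl)
              Ab : A (bₛ (f z) z)
              Ab = subst (λ y → Z y × (bₛ (f z) z ≡ aₛ (f y) y ⊎ bₛ (f z) z ≡ bₛ (f y) y)) (sym b-root) (Zr , inj₂ refl)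
            extended = extend-layer (Above-borel 1) T-borel (proj₁ K) disjoint robust
            split : ∀ {v} → ¬ W v → Above 1 v ⊎ T v
            split {v} ¬w with em {P = A v}
            ... | yes a = inj₁ (inj₁ a)
            ... | no s = go (level v) refl
              where
              go : ∀ k → level v ≡ k → Above 1 v ⊎ T v
              go zero e with level-zero e
              ... | inj₁ t = inj₂ t
              ... | inj₂ w = ⊥-elim (¬w w)
              go (suc k) e = inj₁ (inj₂ (s , subst (1 ≤_) (sym e) (s≤s z≤n)))

          instance
            colours-countable : Countable (Fin Δ)
            colours-countable = countable-fin some-colour

          module Last = BorelColouring colour-outside-W

          g : V → Fin Δ
          g = Last.colour

          -- The balls around `Y` are completed as a constraint problem on finite components.
          -- Vertices outside `W` must keep their colour and only restrict their neighbours in `W`.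
          Allowed : Fin Δ → Pred V 0ℓ
          Allowed i v = (W v × ∀ w → Adj v w → ¬ W w → g w ≢ i) ⊎ (¬ W v × g v ≡ i)

          allowed-borel : ∀ i → Borel (Allowed i)
          allowed-borel i = σ-∪ (σ-∩ W-borel (resp {A = λ v → ¬ ∃ λ w → Adj v w × (¬ W w × g w ≡ i)}
              ((λ none w a nw e → none (w , a , nw , e)) , λ all (w , a , nw , e) → all w a nw e)
              (σ-∁ (∃Adj-borel {f = λ v → v} id-measurable {P = λ (_ , w) → ¬ W w × g w ≡ i}
                (proj₂-measurable (σ-∩ (σ-∁ W-borel) (Last.measurable i)))))))
            (σ-∩ (σ-∁ W-borel) (Last.measurable i))

          Forbidden : Fin Δ → Fin Δ → V → V → Set
          Forbidden i j u v = (W u × W v) × Adj u v × i ≡ j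

          forbidden-borel : ∀ i j → Borel {V × V} (λ (u , v) → Forbidden i j u v)
          forbidden-borel i j = σ-∩ (σ-∩ (proj₁-measurable W-borel) (proj₂-measurable W-borel)) (σ-∩ adj-borel (σ-const (i ≡ j)))

          forbidden-local : ∀ {i j u v} → Forbidden i j u v → Ball 1 u v
          forbidden-local (_ , a , _) = adj-ball a

          Link : V → V → Set
          Link = Linked some-colour 1 Allowed allowed-borel Forbidden forbidden-borel (λ {i} {j} → forbidden-local {i} {j})

          link-adj : ∀ {u v} → Link u v → (W u × W v) × Adj u v
          link-adj (_ , _ , inj₁ (w , a , _)) = w , a
          link-adj (_ , _ , inj₂ ((wv , wu) , a , _)) = (wu , wv) , symmetric a

          -- A link out of the ball of `y` ends in the ball of some `y'` within `R₁ + 1 + R₁` of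
          -- `y`, and then `Y-apart` gives `y' ≡ y`. So each component lies in one ball.
          stay : ∀ {u v y} → Y y → Ball R₁ u y → Star Link u v → Ball R₁ v y
          stay Yy b ε = b
          stay {u} {v} {y} Yy b (_◅_ {j = w} l ls) with link-adj l
          ... | (_ , (y' , b' , Yy')) , a = stay Yy (subst (Ball R₁ w) (sym (Y-apart Yy Yy' near)) b') ls
            where
            near : Ball D₀ y y'
            near = ball-mono R₁+R₁<D₀ (subst (λ k → Ball k y y') (+-suc R₁ R₁)
              (ball-trans R₁ {suc R₁} {y} {u} {y'} (ball-sym R₁ b) (w , inj₂ a , b')))

          alone : ∀ {u v} → ¬ W u → Star Link u v → v ≡ u
          alone ¬w ε = refl
          alone ¬w (l ◅ _) = ⊥-elim (¬w (proj₁ (proj₁ (link-adj l))))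

          finite : ∀ v → ∃ λ (xs : List V) → ∀ {w} → Star Link v w → w ∈ xs
          finite v with em {P = W v}
          ... | yes (y , b , Yy) = proj₁ (ball-list R₁ y) , λ s → proj₂ (ball-list R₁ y) (ball-sym R₁ (stay Yy b s))
          ... | no ¬w = v ∷ [] , λ s → here (alone ¬w s)

          Solution : V → Set
          Solution v = ∃ λ (a : V → Fin Δ) → (∀ {u} → Star Link v u → Allowed (a u) u) ×
            (∀ {u w} → Star Link v u → Star Link v w → ¬ Forbidden (a u) (a w) u w)

          solve-outside : ∀ {v} → ¬ W v → Solution v
          solve-outside {v} ¬w = g , allowed , forbidden
            where
            allowed : ∀ {u} → Star Link v u → Allowed (g u) u
            allowed {u} s = inj₂ (subst (λ x → ¬ W x) (sym (alone ¬w s)) ¬w , refl)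
            forbidden : ∀ {u w} → Star Link v u → Star Link v w → ¬ Forbidden (g u) (g w) u w
            forbidden {u} s _ ((wu , _) , _) = ¬w (subst W (alone ¬w s) wu)

          module Inside {v y : V} (b : Ball R₁ v y) (Yy : Y y) where

            abstract
              extended : Extension (λ x → ¬ W x) (λ x → ¬ W x ⊎ Ball R₁ y x) g
              extended = extend-ball R₁ (≤-trans (s≤s z≤n) ρ+2≤R₁) y {λ x → ¬ W x} {g} Last.proper
                (λ {x} b' ¬w → ¬w (y , ball-sym R₁ b' , Yy)) (Y-slack Yy)

            h : V → Fin Δ
            h = Extension.colour extended

            ball : ∀ {u} → Star Link v u → Ball R₁ u y
            ball = stay Yy b

            allowed : ∀ {u} → Star Link v u → Allowed (h u) u
            allowed {u} s = inj₁ ((y , ball s , Yy) , λ w a ¬w e →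
              Extension.proper extended (inj₂ (ball-sym R₁ (ball s))) (inj₁ ¬w) a
                (trans (sym e) (sym (Extension.agrees extended ¬w))))

            forbidden : ∀ {u w} → Star Link v u → Star Link v w → ¬ Forbidden (h u) (h w) u w
            forbidden s t (_ , a , e) =
              Extension.proper extended (inj₂ (ball-sym R₁ (ball s))) (inj₂ (ball-sym R₁ (ball t))) a e

          solvable : ∀ v → Solution v
          solvable v = go em
            where
            go : Dec (W v) → Solution v
            go (yes (y , b , Yy)) = Inside.h b Yy , (λ {u} → Inside.allowed b Yy {u}) , λ {u} {w} → Inside.forbidden b Yy {u} {w}
            go (no ¬w) = solve-outside ¬w

        borel-colouring : ∃ λ (h : V → Fin Δ) → ℕ-Measurable h × (∀ u v → Adj u v → h u ≢ h v)
        borel-colouring = proj₁ solution , proj₁ (proj₂ solution) , proper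
          where
          solution : ∃ λ (h : V → Fin Δ) → ℕ-Measurable h × (∀ v → Allowed (h v) v) × (∀ {u v} → ¬ Forbidden (h u) (h v) u v)
          solution = component-solution some-colour 1 Allowed allowed-borel Forbidden forbidden-borel
            (λ {i} {j} → forbidden-local {i} {j}) finite solvable
          h = proj₁ solution
          proper : ∀ u v → Adj u v → h u ≢ h v
          proper u v a e = cases (proj₁ (proj₂ (proj₂ solution)) u) (proj₁ (proj₂ (proj₂ solution)) v)
            where
            cases : Allowed (h u) u → Allowed (h v) v → ⊥
            cases (inj₁ (wu , _)) (inj₁ (wv , _)) = proj₂ (proj₂ (proj₂ solution)) {u} {v} ((wu , wv) , a , e)
            cases (inj₁ (_ , avoid)) (inj₂ (¬wv , gv)) = avoid v a ¬wv (trans gv (sym e))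
            cases (inj₂ (¬wu , gu)) (inj₁ (_ , avoid)) = avoid u (symmetric a) ¬wu (trans gu e)
            cases (inj₂ (¬wu , gu)) (inj₂ (¬wv , gv)) = Last.proper ¬wu ¬wv a (trans gu (trans e (sym gv)))

  -- The choice of constants, powers of the graph, and the conclusion.

  module BorelBrooks where
    open Classical
    open BorelSets
    open LusinNovikov
    open StandardCoding using (standard-coded; IsBorel⇒Borel; Borel⇒IsBorel; IsBorel×⇒Borel)
    open BorelGraphs using (BoundedGraph; module Graphs)
    open SlackSpots using (module Spot; n<2^n)
    open BorelTransversal using (module Select)
    open LayeredColouring using (module Final; fin-pred)
    import Data.Irrelevant as Irrelevant
    open import Data.Nat.Solver using (module +-*-Solver)
    import Data.Refinement as Ref
    open import Data.Refinement using (Refinement; value)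
    import Relation.Binary.Construct.Add.Supremum.NonStrict as NonStrict

    module Numbers (Δ b : ℕ) where

      private
        -- With `r` as below, `suc (r + r)` is `4 n + 4 Δ + 3`, which is at most
        -- `(7 + 4 Δ) (n + 1)`. This is where the 7 comes from, and it bounds `m` by `C * suc n`.
        C : ℕ
        C = 4 * (suc (Δ * ((7 + 4 * Δ) * suc Δ)) * Δ)

        linear : ℕ → ℕ
        linear n = 4 * (suc (Δ * (suc (suc (n + n + (Δ + Δ)) + suc (n + n + (Δ + Δ))) * suc Δ)) * Δ)

        linear-bound : ∀ n → linear n ≤ C * suc n
        linear-bound n = begin
          4 * (suc (Δ * (suc (suc (n + n + (Δ + Δ)) + suc (n + n + (Δ + Δ))) * suc Δ)) * Δ)
            ≤⟨ *-monoʳ-≤ 4 (*-monoˡ-≤ Δ (+-mono-≤ {1} {suc n} (s≤s z≤n) (*-monoʳ-≤ Δ (*-monoˡ-≤ (suc Δ) radius)))) ⟩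
          4 * ((suc n + Δ * ((7 + 4 * Δ) * suc n * suc Δ)) * Δ)
            ≡⟨ solve 2 (λ n d → con 4 :* ((con 1 :+ n :+ d :* ((con 7 :+ con 4 :* d) :* (con 1 :+ n) :* (con 1 :+ d))) :* d)
                 := con 4 :* ((con 1 :+ d :* ((con 7 :+ con 4 :* d) :* (con 1 :+ d))) :* d) :* (con 1 :+ n)) refl n Δ ⟩
          C * suc n ∎
          where
          open ≤-Reasoning
          open +-*-Solver
          radius : suc (suc (n + n + (Δ + Δ)) + suc (n + n + (Δ + Δ))) ≤ (7 + 4 * Δ) * suc n
          radius = ≤-trans (m≤m+n _ (4 + 3 * n + 4 * (Δ * n))) (≤-reflexive
            (solve 2 (λ n d → con 1 :+ (con 1 :+ (n :+ n :+ (d :+ d)) :+ (con 1 :+ (n :+ n :+ (d :+ d)))) :+ (con 4 :+ con 3 :* n :+ con 4 :* (d :* n))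
              := (con 7 :+ con 4 :* d) :* (con 1 :+ n)) refl n Δ))

        -- `K` bounds the number of stages. With `n = p * K`, the goal `m ^ K ≤ 2 ^ n` reduces to
        -- `C * suc n ≤ 2 ^ p`. The left side is at most `c * suc p`, and `p = 4 c` bounds this by
        -- `(2 c + 1)` squared, which is at most `2 ^ q * 2 ^ q = 2 ^ p`.
        K c q p : ℕ
        K = suc b
        c = C * suc K
        q = c + c
        p = q + q

      n : ℕ
      n = p * K

      private
        exponential : C * suc n ≤ 2 ^ p
        exponential = begin
          C * suc (p * K)          ≤⟨ *-monoʳ-≤ C (≤-trans (m≤m+n (suc (p * K)) (p + K)) (≤-reflexive
                                        (solve 2 (λ p k → con 1 :+ p :* k :+ (p :+ k) := (con 1 :+ k) :* (con 1 :+ p)) refl p K))) ⟩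
          C * (suc K * suc p)      ≡⟨ sym (*-assoc C (suc K) (suc p)) ⟩
          c * suc (q + q)          ≤⟨ ≤-trans (m≤m+n _ (c + c + c + 1)) (≤-reflexive
                                        (solve 1 (λ c → c :* (con 1 :+ ((c :+ c) :+ (c :+ c))) :+ (c :+ c :+ c :+ con 1)
                                          := (con 1 :+ (c :+ c)) :* (con 1 :+ (c :+ c))) refl c)) ⟩
          suc q * suc q            ≤⟨ *-mono-≤ (n<2^n q) (n<2^n q) ⟩
          2 ^ q * 2 ^ q            ≡⟨ sym (^-distribˡ-+-* 2 q q) ⟩
          2 ^ (q + q) ∎
          where
          open ≤-Reasoning
          open +-*-Solver

      r m : ℕ
      r = suc (n + n + (Δ + Δ))
      m = 4 * (suc (Δ * (suc (r + r) * suc Δ)) * Δ)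

      enough : ∀ {s} → s ≤ b → 1 ≤ m → m ^ suc s ≤ 2 ^ n
      enough {s} s≤b 1≤m = begin
        m ^ suc s   ≤⟨ ^-monoʳ-≤ m {{>-nonZero 1≤m}} (s≤s s≤b) ⟩
        m ^ K       ≤⟨ ^-monoˡ-≤ K (≤-trans (linear-bound n) exponential) ⟩
        (2 ^ p) ^ K ≡⟨ ^-*-assoc 2 p K ⟩
        2 ^ (p * K) ∎
        where open ≤-Reasoning

    -- Powers are defined by injective paths, balls by walks. A shortest walk is injective, since
    -- every later vertex is strictly closer to the end.
    module Geodesics {V : Set} {{cV : Coded V}} {Δ : ℕ} (B : BoundedGraph V Δ) (G : Graph V)
      (same : ∀ {u v} → BoundedGraph.Adj B u v → Graph.Adj G u v) where
      open BoundedGraph B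
      open Graphs B

      private
        Geodesic : ℕ → V → V → Set
        Geodesic k u v = Ball k u v × (∀ m → m < k → ¬ Ball m u v)

        geodesic-unique : ∀ {j k u v} → Geodesic j u v → Geodesic k u v → j ≡ k
        geodesic-unique {u = u} {v} (b , min) (b' , min') = minimum-unique {P = λ k → Ball k u v} b min b' min'

        record GeodesicPath (k : ℕ) (u v : V) : Set where
          field
            path  : Path G k u v
            close : ∀ i → ∃ λ m → m ≤ k × Geodesic m (Path.vertex path i) v

        geodesic-path : ∀ k {u v} → Geodesic k u v → GeodesicPath k u v
        geodesic-path zero {u} (refl , min) = record
          { path = record
            { vertex = λ _ → u ; injective = λ { {zero} {zero} _ → refl }
            ; start = refl ; end = refl ; step = λ () }
          ; close = λ { zero → 0 , z≤n , refl , min } }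
        geodesic-path (suc k) {u} {v} ((w , inj₁ refl , b) , min) = ⊥-elim (min k ≤-refl b)
        geodesic-path (suc k) {u} {v} geo@((w , inj₂ a , b) , min) = record
          { path = record
            { vertex = vertex' ; injective = λ {i} {j} → injective' i j ; start = refl ; end = Path.end path ; step = step' }
          ; close = λ { zero → suc k , ≤-refl , geo
                      ; (suc i) → let (m , m≤k , g) = close i in m , m≤n⇒m≤1+n m≤k , g } }
          where
          rest : GeodesicPath k w v
          rest = geodesic-path k (b , λ m m<k b' → min (suc m) (s≤s m<k) (w , inj₂ a , b'))
          open GeodesicPath rest
          vertex' : Fin (suc (suc k)) → V
          vertex' zero    = u
          vertex' (suc i) = Path.vertex path i
          fresh : ∀ i → u ≢ Path.vertex path i
          fresh i e = let (m , m≤k , g) = close i in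
            1+n≰n (≤-trans (≤-reflexive (geodesic-unique geo (subst (λ x → Geodesic m x v) (sym e) g))) m≤k)
          injective' : ∀ i j → vertex' i ≡ vertex' j → i ≡ j
          injective' zero zero e = refl
          injective' zero (suc j) e = ⊥-elim (fresh j e)
          injective' (suc i) zero e = ⊥-elim (fresh i (sym e))
          injective' (suc i) (suc j) e = cong suc (Path.injective path e)
          step' : ∀ i → Graph.Adj G (vertex' (inject₁ i)) (vertex' (suc i))
          step' zero = subst (Graph.Adj G u) (sym (Path.start path)) (same a)
          step' (suc i) = Path.step path i

      ball-power : ∀ R {u v} → Ball R u v → u ≢ v → Graph.Adj (G ^ᴳ R) u v
      ball-power R {u} {v} b u≢v =
        let (k , b' , min) = minimum {P = λ k → Ball k u v} (R , b) in
        u≢v , k , ≮⇒≥ (λ lt → min R lt b) , GeodesicPath.path (geodesic-path k (b' , min))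

      component-list : ∀ R (U : Pred V 0ℓ) → ComponentFinite (induced (G ^ᴳ R) U) →
        ∀ {v} → U v → ∃ λ (xs : List V) → ∀ {w} → Star (λ x y → U x × U y × Ball R x y) v w → w ∈ xs
      component-list R U finite {v} Uv =
        let (xs , cover) = finite (v Ref., Irrelevant.[ Uv ]) in
        map value xs , λ s → let (w , star , e) = lift (v Ref., Irrelevant.[ Uv ]) refl s in
          subst (_∈ map value xs) e (∈-map⁺ value (cover w star))
        where
        lift : ∀ {x w} (x' : Refinement V U) → value x' ≡ x → Star (λ x y → U x × U y × Ball R x y) x w →
          ∃ λ w' → Star (Graph.Adj (induced (G ^ᴳ R) U)) x' w' × value w' ≡ w
        lift x' e ε = x' , ε , e
        lift x' refl (_◅_ {j = y} (_ , Uy , b) ss) with em {P = value x' ≡ y}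
        ... | yes e = lift x' e ss
        ... | no ne = let (w , star , e) = lift (y Ref., Irrelevant.[ Uy ]) refl ss in w , (ball-power R b ne ◅ star) , e

    module _ (G : BorelGraph) (Δ : ℕ) where
      open BorelGraph G using (space; graph; adjBorel)
      open StandardBorelSpace space using (Carrier)

      private
        instance
          coded-space : Coded Carrier
          coded-space = standard-coded space

      bounded-graph : HasMaxDegree graph Δ → Σ (BoundedGraph Carrier Δ) λ B → BoundedGraph.Adj B ≡ Graph.Adj graph
      bounded-graph (degrees , _) = record
        { Adj = Graph.Adj graph
        ; symmetric = Graph.symmetric graph
        ; loopless = Graph.loopless graph refl
        ; adj-borel = borel
        ; φ = proj₁ functions
        ; φ-measurable = proj₁ (proj₂ functions)
        ; φ-covers = proj₂ (proj₂ functions) } , refl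
        where
        borel : Borel {Carrier × Carrier} (uncurry (Graph.Adj graph))
        borel = IsBorel×⇒Borel space adjBorel
        abstract
          functions : ∃ λ (φ : Fin Δ → Carrier → Carrier) → (∀ i → Measurable (φ i)) ×
            (∀ {x y} → Graph.Adj graph x y → ∃ λ i → φ i x ≡ y)
          functions = uniformize Δ {E = uncurry (Graph.Adj graph)} borel
            (λ x → let (k , k≤Δ , xs , _ , len , iff) = degrees x in
              xs , ≤-trans (≤-reflexive len) k≤Δ , λ {y} a → Equivalence.from (iff y) a)
            (λ x → x) id-measurable

      module _ (max-degree : HasMaxDegree graph Δ) (Δ≥3 : Δ ≥ 3) (no-clique : ¬ HasClique graph (suc Δ)) where

        private
          B : BoundedGraph Carrier Δ
          B = proj₁ (bounded-graph max-degree)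

          no-clique' : ∀ (c : Fin (suc Δ) → Carrier) → ¬ (∀ i j → i ≢ j → BoundedGraph.Adj B (c i) (c j))
          no-clique' c adjacent = no-clique (c , (λ {i} {j} e → dne λ i≢j →
            BoundedGraph.loopless B (subst (BoundedGraph.Adj B (c i)) (sym e) (adjacent i j i≢j))) , adjacent)

        -- The radius `r` is computed from `b`, and only then is a separation at a scale depending
        -- on `r` requested. Its number of parts is still controlled by `b`, which avoids the
        -- circularity.
        colourable : ∀ b → (∀ R → ∃ λ s → s ≤ b × HasSeparation space (graph ^ᴳ R) s) → BorelColorable G Δ
        colourable b separations = h , (λ A → Borel⇒IsBorel space (fin-pred h-measurable (λ i _ → A i) (λ i → σ-const (A i)))) , proper
          where
          open Numbers Δ b
          -- The conflict radius `R` of `Family`; the separation is taken at twice this radius to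
          -- match `Close`.
          ρ₂ : ℕ
          ρ₂ = r + r + suc (r + r)
          κ : ℕ
          κ = suc (Δ * (suc (r + r) * suc Δ)) * Δ
          1≤κ : 1 ≤ κ
          1≤κ = *-mono-≤ {1} {suc (Δ * (suc (r + r) * suc Δ))} {1} {Δ} (s≤s z≤n) (≤-trans (s≤s z≤n) Δ≥3)
          1≤m : 1 ≤ m
          1≤m = *-mono-≤ {1} {4} (s≤s z≤n) 1≤κ
          s : ℕ
          s = proj₁ (separations (ρ₂ + ρ₂))
          s≤b : s ≤ b
          s≤b = proj₁ (proj₂ (separations (ρ₂ + ρ₂)))
          separation : HasSeparation space (graph ^ᴳ (ρ₂ + ρ₂)) s
          separation = proj₂ (proj₂ (separations (ρ₂ + ρ₂)))
          U : Fin (suc s) → Pred Carrier 0ℓ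
          U = proj₁ separation
          options : ℕ
          options = m ^ suc s
          fits : options ≤ 2 ^ n
          fits = enough s≤b 1≤m
          room : suc (n + n + (Δ + Δ)) ≤ r
          room = ≤-refl
          open Spot.Family B Δ≥3 no-clique' r n options fits room using (Conf; conflicts)
          open Select B m κ ρ₂ ≤-refl 1≤m using (select-independent; ComponentsFinite)
          U-finite : ∀ i → ComponentsFinite (U i)
          U-finite i = Geodesics.component-list B graph id (ρ₂ + ρ₂) (U i) (proj₂ (proj₂ (proj₂ (proj₂ separation))) i)
          selection : ∃ λ (f : Carrier → Fin options) → ℕ-Measurable f × (∀ {x y} → ¬ Conf x (f x) y (f y))
          selection = select-independent (suc s) (conflicts m ≤-refl 1≤m) U
            (λ i → IsBorel⇒Borel space (proj₁ (proj₂ separation) i)) U-finite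
            (λ {x} _ → let (i , Ux) = proj₁ (proj₂ (proj₂ separation)) x in i , inj₁ Ux)
          colouring : ∃ λ (h : Carrier → Fin Δ) → ℕ-Measurable h × (∀ u v → Graph.Adj graph u v → h u ≢ h v)
          colouring = Final.borel-colouring B Δ≥3 no-clique' r n options fits room
            (proj₁ selection) (proj₁ (proj₂ selection)) (λ {x} {y} → proj₂ (proj₂ selection) {x} {y})
          h = proj₁ colouring
          h-measurable = proj₁ (proj₂ colouring)
          proper = proj₂ (proj₂ colouring)

    module _ where
      open Invariants em

      least-finite : ∀ {ℓ} {P : Pred ℕ ℓ} → least P <∞ ∞ → ∃ P
      least-finite {P = P} lt with em {P = ∃ (IsLeast P)}
      ... | yes (n , p , _) = n , p
      least-finite () | no _

      least-≤ : ∀ {ℓ} {P : Pred ℕ ℓ} {b} → least P ≤∞ [ b ] → ∃ λ n → n ≤ b × P n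
      least-≤ {P = P} le with em {P = ∃ (IsLeast P)}
      least-≤ NonStrict.[ n≤b ] | yes (n , p , _) = n , n≤b , p
      least-≤ () | no _

      ≤-least : ∀ {ℓ} {P : Pred ℕ ℓ} {b} → P b → least P ≤∞ [ b ]
      ≤-least {P = P} {b} p with em {P = ∃ (IsLeast P)}
      ... | yes (n , _ , min) = NonStrict.[ min b p ]
      ... | no none = let (n , q , min) = minimum (b , p) in
        ⊥-elim (none (n , q , λ m pm → ≮⇒≥ λ lt → min m lt pm))

      main : (G : BorelGraph) (Δ : ℕ) → HasMaxDegree (BorelGraph.graph G) Δ → Δ ≥ 3 →
        ¬ HasClique (BorelGraph.graph G) (suc Δ) → asi G <∞ ∞ → χᴮ G ≤∞ [ Δ ]
      main G Δ max-degree Δ≥3 no-clique finite =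
        let (b , bound) = least-finite {P = λ b → ∀ R → si (BorelGraph.space G) (BorelGraph.graph G ^ᴳ R) ≤∞ [ b ]} finite in
        ≤-least (colourable G Δ max-degree Δ≥3 no-clique b (λ R → least-≤ (bound R)))

theorem1p17 : (em : ∀ {ℓ} → ExcludedMiddle ℓ) →
    let open Invariants em in
    (G : BorelGraph) (Δ : ℕ) →
    HasMaxDegree (BorelGraph.graph G) Δ →
    Δ ≥ 3 →
    ¬ HasClique (BorelGraph.graph G) (suc Δ) →
    asi G <∞ ∞ →
    χᴮ G ≤∞ [ Δ ]
theorem1p17 = BorelBrooks.main
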